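{- For $|q|<1$ (equivalently, as formal power series in $q$), the following seven identities hold: \begin{align*} f_1^4f_6^2+f_2^2 f_3^4&=2\frac{f_1^2 f_4 f_6^9}{f_2 f_3^2 f_{12}^3},\\ f_2^2 f_3^4- f_1^4 f_6^2&= 4q\frac{f_1f_2^2f_3f_{12}^3}{f_4},\\ f_2^9f_3 f_{12}^2+2 f_1^3 f_4^6 f_6^3&=3 f_1^2 f_2^2 f_3^3 f_4^3 f_6 f_{12},\\ f_2^9 f_3 f_{12}^2-f_1^3 f_4^6 f_6^3&=3q f_1^3 f_2^2 f_4^2 f_6 f_{12}^4,\\ f_2^2f_3^3f_{12}-f_1f_4^3f_6^2&=q \frac{f_1f_2^2f_{12}^4}{f_4},\\ 2 f_1^2 f_3^2 f_4^3 f_6-f_2^7 f_{12}&=\frac{f_1^4 f_4^4 f_6^{10}}{f_2^3 f_3^4 f_{12}^3},\\ 4 f_3 f_4^3-f_1^3 f_{12}&=3\frac{f_2^2 f_3^4 f_{12}}{f_1 f_6^2}. \end{align*}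
   Context: For a positive integer $n$, $f_n:=(q^n;q^n)_\infty=\prod_{j=1}^\infty(1-q^{nj})$. -}

module Defs where

open import Algebra.Bundles.Raw using (RawRing; RawSemiring)
open import Data.Fin.Base using (Fin; zero; suc; toℕ)
open import Data.Fin.Properties using (toℕ<n)
open import Data.Integer.Base as ℤ using (ℤ; 0ℤ; 1ℤ)
import Data.Integer.Properties as ℤₚ
open import Data.Nat.Base as ℕ using (ℕ; zero; suc; _∸_; _≤_; _<_; NonZero; z≤n; s≤s)
import Data.Nat.Properties as ℕₚ
open import Data.Vec.Functional using (Vector; head; _∷_)
open import Level using (0ℓ)
open import Relation.Binary.PropositionalEquality
open import Relation.Nullary.Decidable using (True)

open import Algebra.Properties.Semiring.Sum ℤₚ.+-*-semiring
  using (sum; sum-syntax; sum⁺-syntax; sum-cong-≗; sum-replicate-zero)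

-- The formal power series ∑ₖ F k qᵏ ∈ ℤ⟦q⟧; equality of series is _≗_.
Series : Set
Series = ℕ → ℤ

infixl 6 _+_ _-_
infixl 7 _*_ _/_
infixr 7 _·_
infix  8 -_

_+_ : Series → Series → Series
(F + G) k = F k ℤ.+ G k

-_ : Series → Series
(- F) k = ℤ.- F k

_-_ : Series → Series → Series
F - G = F + (- G)

_*_ : Series → Series → Series
(F * G) k = ∑[ i ≤ k ] (F (toℕ i) ℤ.* G (k ∸ toℕ i))

_·_ : ℤ → Series → Series
(c · F) k = c ℤ.* F k

0# 1# q : Series
0# _ = 0ℤ

1# zero    = 1ℤ
1# (suc _) = 0ℤ

q zero    = 0ℤ
q (suc k) = 1# k

rawRing : RawRing 0ℓ 0ℓ
rawRing = record
  { Carrier = Series ; _≈_ = _≗_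
  ; _+_ = _+_ ; _*_ = _*_ ; -_ = -_ ; 0# = 0# ; 1# = 1#
  }

open import Algebra.Definitions.RawSemiring (RawRing.rawSemiring rawRing) public
  using (_^_)

-- If G has constant coefficient 1 then the coefficients bₖ of 1/G satisfy
-- b₀ = 1 and bₙ₊₁ = - ∑_{i ≤ n} Gᵢ₊₁ bₙ₋ᵢ.  To make the recursion structural,
-- invCoeffs G n lists all of bₙ , bₙ₋₁ , … , b₀.
invCoeffs : Series → (n : ℕ) → Vector ℤ (suc n)
invCoeffs G zero    = λ _ → 1ℤ
invCoeffs G (suc n) =
  (ℤ.- (∑[ i ≤ n ] (G (suc (toℕ i)) ℤ.* invCoeffs G n i))) ∷ invCoeffs G n

inv : Series → Series
inv G n = head (invCoeffs G n)

-- Division is only available by series with constant coefficient 1; the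
-- implicit argument is found by evaluation when G is concrete.
_/_ : (F G : Series) {_ : True (G 0 ℤₚ.≟ 1ℤ)} → Series
F / G = F * inv G

-- qPochhammer n N = (qⁿ;qⁿ)_N
qPochhammer : ℕ → ℕ → Series
qPochhammer n zero    = 1#
qPochhammer n (suc N) = (1# - q ^ (n ℕ.* suc N)) * qPochhammer n N

-- f n = (qⁿ;qⁿ)_∞.  The factors with j > k are 1 modulo qᵏ⁺¹, so they do not
-- affect the coefficient of qᵏ; f-limit below shows that the finite products
-- indeed converge to f n.
f : (n : ℕ) .{{_ : NonZero n}} → Series
f n k = qPochhammer n k k

------------------------------------------------------------------------

inv-inverseʳ : ∀ G → G 0 ≡ 1ℤ → G * inv G ≗ 1#
inv-inverseʳ G G₀≡1 zero rewrite G₀≡1 = refl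
inv-inverseʳ G G₀≡1 (suc n) = begin
  G 0 ℤ.* ℤ.- s ℤ.+ s′  ≡⟨ cong₂ (λ x y → x ℤ.* ℤ.- s ℤ.+ y) G₀≡1 s′≡s ⟩
  1ℤ ℤ.* ℤ.- s ℤ.+ s    ≡⟨ cong (ℤ._+ s) (ℤₚ.*-identityˡ (ℤ.- s)) ⟩
  ℤ.- s ℤ.+ s           ≡⟨ ℤₚ.+-inverseˡ s ⟩
  0ℤ                    ∎
  where
  open ≡-Reasoning

  coeff : ∀ n (i : Fin (suc n)) → inv G (n ∸ toℕ i) ≡ invCoeffs G n i
  coeff zero    zero    = refl
  coeff (suc n) zero    = refl
  coeff (suc n) (suc i) = coeff n i

  s s′ : ℤ
  s  = ∑[ i ≤ n ] (G (suc (toℕ i)) ℤ.* invCoeffs G n i)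
  s′ = ∑[ i ≤ n ] (G (suc (toℕ i)) ℤ.* inv G (n ∸ toℕ i))

  s′≡s : s′ ≡ s
  s′≡s = sum-cong-≗ λ i → cong (G (suc (toℕ i)) ℤ.*_) (coeff n i)

unit-* : ∀ A P k → (∀ i → i ≤ k → A i ≡ 1# i) → (A * P) k ≡ P k
unit-* A P k A≡1 = begin
  A 0 ℤ.* P k ℤ.+ sum rest  ≡⟨ cong₂ (λ x y → x ℤ.* P k ℤ.+ y) (A≡1 0 z≤n) rest≡0 ⟩
  1ℤ ℤ.* P k ℤ.+ 0ℤ         ≡⟨ ℤₚ.+-identityʳ (1ℤ ℤ.* P k) ⟩
  1ℤ ℤ.* P k                ≡⟨ ℤₚ.*-identityˡ (P k) ⟩
  P k                       ∎
  where
  open ≡-Reasoning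

  rest : Vector ℤ k
  rest i = A (suc (toℕ i)) ℤ.* P (k ∸ suc (toℕ i))

  rest≡0 : sum rest ≡ 0ℤ
  rest≡0 = trans
    (sum-cong-≗ λ i → cong (ℤ._* P (k ∸ suc (toℕ i))) (A≡1 (suc (toℕ i)) (toℕ<n i)))
    (sum-replicate-zero k)

q-*-suc : ∀ F k → (q * F) (suc k) ≡ F k
q-*-suc F k = trans (ℤₚ.+-identityˡ ((1# * F) k)) (unit-* 1# F k λ _ _ → refl)

q^-low : ∀ m k → k < m → (q ^ m) k ≡ 0ℤ
q^-low (suc m) zero    _         = refl
q^-low (suc m) (suc k) (s≤s k<m) = trans (q-*-suc (q ^ m) k) (q^-low m k k<m)

f-limit : ∀ n .{{_ : NonZero n}} k N → k ≤ N → qPochhammer n N k ≡ f n k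
f-limit n k N k≤N = subst (λ N → qPochhammer n N k ≡ f n k) (ℕₚ.m∸n+n≡m k≤N) (stable (N ∸ k))
  where
  factor : ∀ d i → i ≤ k → (1# - q ^ (n ℕ.* suc (d ℕ.+ k))) i ≡ 1# i
  factor d i i≤k = trans
    (cong (λ x → 1# i ℤ.+ ℤ.- x) (q^-low (n ℕ.* suc (d ℕ.+ k)) i i<))
    (ℤₚ.+-identityʳ (1# i))
    where
    i< : i < n ℕ.* suc (d ℕ.+ k)
    i< = ℕₚ.≤-trans (s≤s (ℕₚ.≤-trans i≤k (ℕₚ.m≤n+m k d))) (ℕₚ.m≤n*m (suc (d ℕ.+ k)) n)

  stable : ∀ d → qPochhammer n (d ℕ.+ k) k ≡ f n k
  stable zero    = refl
  stable (suc d) = trans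
    (unit-* (1# - q ^ (n ℕ.* suc (d ℕ.+ k))) (qPochhammer n (d ℕ.+ k)) k (factor d))
    (stable d)

{-# OPTIONS --safe #-}

-- The theta functions Σ (±1)ⁿ q^(3n² + jn), j = 0, 1, 2, 3, are eta quotients by
-- the Jacobi triple product.  Summing over (m , n) along m + n and m − n
-- expresses products of two of them bilinearly in the four series
-- Σ q^(6n² + 2jn), so the Plücker relations for 2 × 2 minors become relations
-- between eta quotients.  Four of these relations say that 1 + 4y, 1 − 2y, 1 + 2y
-- and 1 + y are eta quotients for one eta quotient y = q + O(q²), a Hauptmodul of
-- Γ₀(12), and each identity of the lemma is a linear relation among 1, y and
-- these four.  All of this happens modulo qᴷ, where sums and products are finite.
module Submission where

open import Algebra.Bundles using (CommutativeRing)
import Algebra.Properties.AbelianGroup as AbelianGroupProperties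
import Algebra.Properties.CommutativeSemiring.Exp as CommutativeExp
import Algebra.Properties.Group as GroupProperties
import Algebra.Properties.Ring as RingProperties
import Algebra.Properties.Semiring.Exp as Exp
import Algebra.Properties.Semiring.Mult.TCOptimised as Mult
import Algebra.Properties.Semiring.Sum as Sum
import Algebra.Solver.Ring as RingSolver
open import Algebra.Solver.Ring.AlmostCommutativeRing using (fromCommutativeRing; _-Raw-AlmostCommutative⟶_)
open import Algebra.Structures using (IsCommutativeRing)
open import Data.Fin using (toℕ; #_)
open import Data.Fin.Properties using (toℕ≤pred[n])
open import Data.Integer.Base as ℤ using (ℤ; +_; -[1+_]; ∣_∣; 0ℤ)
import Data.Integer.Properties as ℤₚ
open import Data.Integer.Tactic.RingSolver using () renaming (solve-∀ to ℤ-solve)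
open import Data.Maybe.Base using (map)
open import Data.Nat.Base as ℕ using (ℕ; zero; suc; _≤_; _<_; _∸_; z≤n; s≤s; NonZero)
import Data.Nat.Properties as ℕₚ
open import Data.Nat.Tactic.RingSolver using () renaming (solve-∀ to ℕ-solve)
open import Data.Product.Base using (_,_; ∃-syntax)
open import Data.Sum.Base using (_⊎_; inj₁; inj₂)
open import Data.Unit.Base using (tt)
open import Data.Vec.Base using (Vec; []; _∷_)
open import Data.Vec.Relation.Binary.Pointwise.Inductive using (Pointwise; []; _∷_; lookup)
open import Function.Base using (_∘_)
open import Relation.Binary.Consequences using (dec⇒weaklyDec)
open import Relation.Binary.PropositionalEquality as ≡ using (_≡_; _≗_)
open import Relation.Nullary.Decidable using (True; toWitness)

-- Convergence becomes nilpotency: the argument runs over an arbitrary commutative ring with an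
-- element `q` satisfying `q ^ K ≈ 0#`. There each infinite product has `K` factors, `1# - q ^ e`
-- with e ≥ 1 is inverted by a finite geometric sum, and polynomial identities go to a ring solver.
-- The six eta products are monomials in six units `A`, `B`, `D`, `G`, `H`, `z`, each a product of
-- factors 1 - qⁿ or 1 + qⁿ with n in one residue class modulo 6 or in two opposite ones. The triple
-- product also produces `C` and `T`, which Euler's relations `A * C * D ≈ 1#` and `H * T * G ≈ 1#`
-- eliminate. Relations between quotients are kept multiplied out, and common units are cancelled.
-- The double-sum rotation gives the same four series for both signs (±1)ⁿ, so sums and differences
-- of the same bilinear monomials appear, which is what makes them minors of one kind of matrix.

-- Ring solver with integer coefficients over any commutative ring

module IntegerSolver {c ℓ} (R : CommutativeRing c ℓ) where

  open CommutativeRing R hiding (zero)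
  open import Relation.Binary.Reasoning.Setoid setoid
  open RingProperties ring using (-‿distribˡ-*; -‿distribʳ-*; -0#≈0#; -‿involutive)
  open AbelianGroupProperties +-abelianGroup using () renaming (⁻¹-∙-comm to -‿+-comm)
  open Exp semiring using (^-congˡ)
  open Mult semiring using (_×_; ×-homo-+; ×1-homo-*)

  private
    -- The ring morphism from ℤ. Equality of coefficients is decidable there, so the solver can
    -- cancel terms although equality in `Carrier` is not decided.
    ⟦_⟧ : ℤ → Carrier
    ⟦ + n ⟧      = n × 1#
    ⟦ -[1+ n ] ⟧ = - (suc n × 1#)

    neg-homo : ∀ i → ⟦ ℤ.- i ⟧ ≈ - ⟦ i ⟧
    neg-homo (+ zero)  = sym -0#≈0#
    neg-homo (+ suc n) = refl
    neg-homo -[1+ n ]  = sym (-‿involutive _)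

    ⊖-homo : ∀ m n → ⟦ m ℤ.⊖ n ⟧ ≈ m × 1# - n × 1#
    ⊖-homo m       zero    = sym (trans (+-congˡ -0#≈0#) (+-identityʳ _))
    ⊖-homo zero    (suc n) = sym (+-identityˡ _)
    ⊖-homo (suc m) (suc n) = begin
      ⟦ suc m ℤ.⊖ suc n ⟧           ≡⟨ ≡.cong ⟦_⟧ (ℤₚ.[1+m]⊖[1+n]≡m⊖n m n) ⟩
      ⟦ m ℤ.⊖ n ⟧                   ≈⟨ ⊖-homo m n ⟩
      a - b                         ≈⟨ +-congʳ (+-identityʳ a) ⟨
      a + 0# - b                    ≈⟨ +-congʳ (+-congˡ (-‿inverseʳ 1#)) ⟨
      a + (1# - 1#) - b             ≈⟨ +-congʳ (trans (sym (+-assoc a 1# _)) (+-congʳ (+-comm a 1#))) ⟩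
      1# + a - 1# - b               ≈⟨ +-assoc _ _ _ ⟩
      1# + a + (- 1# - b)           ≈⟨ +-congˡ (-‿+-comm 1# b) ⟩
      1# + a - (1# + b)             ≈⟨ +-cong (×-homo-+ 1# 1 m) (-‿cong (×-homo-+ 1# 1 n)) ⟨
      suc m × 1# - suc n × 1#       ∎
      where
      a = m × 1#
      b = n × 1#

    +-homo : ∀ i j → ⟦ i ℤ.+ j ⟧ ≈ ⟦ i ⟧ + ⟦ j ⟧
    +-homo (+ m)    (+ n)    = ×-homo-+ 1# m n
    +-homo (+ m)    -[1+ n ] = ⊖-homo m (suc n)
    +-homo -[1+ m ] (+ n)    = trans (⊖-homo n (suc m)) (+-comm _ _)
    +-homo -[1+ m ] -[1+ n ] = begin
      - (suc (suc (m ℕ.+ n)) × 1#)        ≡⟨ ≡.cong (λ k → - (k × 1#)) (≡.cong suc (ℕₚ.+-suc m n)) ⟨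
      - ((suc m ℕ.+ suc n) × 1#)          ≈⟨ -‿cong (×-homo-+ 1# (suc m) (suc n)) ⟩
      - (suc m × 1# + suc n × 1#)         ≈⟨ -‿+-comm _ _ ⟨
      - (suc m × 1#) - suc n × 1#         ∎

    *-homo⁺ : ∀ m j → ⟦ + m ℤ.* j ⟧ ≈ ⟦ + m ⟧ * ⟦ j ⟧
    *-homo⁺ m (+ n) = trans (reflexive (≡.cong ⟦_⟧ (≡.sym (ℤₚ.pos-* m n)))) (×1-homo-* m n)
    *-homo⁺ m -[1+ n ] = begin
      ⟦ + m ℤ.* -[1+ n ] ⟧            ≡⟨ ≡.cong ⟦_⟧ (ℤₚ.neg-distribʳ-* (+ m) (+ suc n)) ⟨
      ⟦ ℤ.- (+ m ℤ.* + suc n) ⟧       ≈⟨ neg-homo (+ m ℤ.* + suc n) ⟩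
      - ⟦ + m ℤ.* + suc n ⟧           ≈⟨ -‿cong (*-homo⁺ m (+ suc n)) ⟩
      - (m × 1# * (suc n × 1#))       ≈⟨ -‿distribʳ-* _ _ ⟩
      m × 1# * - (suc n × 1#)         ∎

    *-homo : ∀ i j → ⟦ i ℤ.* j ⟧ ≈ ⟦ i ⟧ * ⟦ j ⟧
    *-homo (+ m)    j = *-homo⁺ m j
    *-homo -[1+ m ] j = begin
      ⟦ -[1+ m ] ℤ.* j ⟧              ≡⟨ ≡.cong ⟦_⟧ (ℤₚ.neg-distribˡ-* (+ suc m) j) ⟨
      ⟦ ℤ.- (+ suc m ℤ.* j) ⟧         ≈⟨ neg-homo (+ suc m ℤ.* j) ⟩
      - ⟦ + suc m ℤ.* j ⟧             ≈⟨ -‿cong (*-homo⁺ (suc m) j) ⟩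
      - (suc m × 1# * ⟦ j ⟧)          ≈⟨ -‿distribˡ-* _ _ ⟩
      - (suc m × 1#) * ⟦ j ⟧          ∎

    morphism : ℤ.+-*-rawRing -Raw-AlmostCommutative⟶ fromCommutativeRing R
    morphism = record
      { ⟦_⟧    = ⟦_⟧
      ; +-homo = +-homo
      ; *-homo = *-homo
      ; -‿homo = neg-homo
      ; 0-homo = refl
      ; 1-homo = refl
      }

  open RingSolver ℤ.+-*-rawRing (fromCommutativeRing R) morphism
    (λ i j → map (λ i≡j → reflexive (≡.cong ⟦_⟧ i≡j)) (dec⇒weaklyDec ℤₚ._≟_ i j))
    public using (solve; _:=_; _:+_; _:*_; _:-_; :-_; _:^_; con; var; op; [+]; [*]; Polynomial)
    renaming (⟦_⟧ to eval)

  -- Serves to replace all eta products in an identity by their monomials in one step.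
  eval-cong : ∀ {n} (p : Polynomial n) {ρ ρ′ : Vec Carrier n} →
    Pointwise _≈_ ρ ρ′ → eval p ρ ≈ eval p ρ′
  eval-cong (op [+] p p′) ρ≈ρ′ = +-cong (eval-cong p ρ≈ρ′) (eval-cong p′ ρ≈ρ′)
  eval-cong (op [*] p p′) ρ≈ρ′ = *-cong (eval-cong p ρ≈ρ′) (eval-cong p′ ρ≈ρ′)
  eval-cong (con i)       ρ≈ρ′ = refl
  eval-cong (var i)       ρ≈ρ′ = lookup ρ≈ρ′ i
  eval-cong (p :^ n)      ρ≈ρ′ = ^-congˡ n (eval-cong p ρ≈ρ′)
  eval-cong (:- p)        ρ≈ρ′ = -‿cong (eval-cong p ρ≈ρ′)

-- Sums over ℤ with bounded support and changes of summation variable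

module BilateralSum {c ℓ} (R : CommutativeRing c ℓ) where

  open CommutativeRing R
  open import Relation.Binary.Reasoning.Setoid setoid
  open IntegerSolver R using (solve; _:+_; _:*_; _:=_; con)

  -- The sum over -N ≤ n < N.
  bisum : ℕ → (ℤ → Carrier) → Carrier
  bisum zero    g = 0#
  bisum (suc N) g = bisum N g + (g (+ N) + g -[1+ N ])

  Supported : ℕ → (ℤ → Carrier) → Set ℓ
  Supported N g = ∀ n → N ≤ ∣ n ∣ → g n ≈ 0#

  supported-mono : ∀ {N M g} → N ≤ M → Supported N g → Supported M g
  supported-mono N≤M supp n M≤∣n∣ = supp n (ℕₚ.≤-trans N≤M M≤∣n∣)

  bisum-cong-≤ : ∀ N {g h} → (∀ n → ∣ n ∣ ≤ N → g n ≈ h n) → bisum N g ≈ bisum N h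
  bisum-cong-≤ zero    g≈h = refl
  bisum-cong-≤ (suc N) g≈h = +-cong
    (bisum-cong-≤ N λ n ∣n∣≤N → g≈h n (ℕₚ.m≤n⇒m≤1+n ∣n∣≤N))
    (+-cong (g≈h (+ N) (ℕₚ.n≤1+n N)) (g≈h -[1+ N ] ℕₚ.≤-refl))

  bisum-cong : ∀ N {g h} → (∀ n → g n ≈ h n) → bisum N g ≈ bisum N h
  bisum-cong N g≈h = bisum-cong-≤ N λ n _ → g≈h n

  bisum-+ : ∀ N g h → bisum N (λ n → g n + h n) ≈ bisum N g + bisum N h
  bisum-+ zero    g h = sym (+-identityˡ 0#)
  bisum-+ (suc N) g h = trans (+-congʳ (bisum-+ N g h))
    (solve 6 (λ a b c d e f → (a :+ b) :+ ((c :+ d) :+ (e :+ f))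
                           := (a :+ (c :+ e)) :+ (b :+ (d :+ f))) refl
      (bisum N g) (bisum N h) (g (+ N)) (h (+ N)) (g -[1+ N ]) (h -[1+ N ]))

  bisum-*ˡ : ∀ N x g → bisum N (λ n → x * g n) ≈ x * bisum N g
  bisum-*ˡ zero    x g = sym (zeroʳ x)
  bisum-*ˡ (suc N) x g = trans (+-congʳ (bisum-*ˡ N x g))
    (solve 4 (λ x a b c → x :* a :+ (x :* b :+ x :* c) := x :* (a :+ (b :+ c))) refl
      x (bisum N g) (g (+ N)) (g -[1+ N ]))

  bisum-*ʳ : ∀ N x g → bisum N (λ n → g n * x) ≈ bisum N g * x
  bisum-*ʳ N x g = trans (bisum-cong N λ n → *-comm (g n) x)
    (trans (bisum-*ˡ N x g) (*-comm x (bisum N g)))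

  bisum-* : ∀ N M g h → bisum N (λ m → bisum M λ n → g m * h n) ≈ bisum N g * bisum M h
  bisum-* N M g h =
    trans (bisum-cong N λ m → bisum-*ˡ M (g m) h) (bisum-*ʳ N (bisum M h) g)

  bisum-0 : ∀ N → bisum N (λ _ → 0#) ≈ 0#
  bisum-0 zero    = refl
  bisum-0 (suc N) = trans (+-cong (bisum-0 N) (+-identityˡ 0#)) (+-identityˡ 0#)

  bisum-swap : ∀ N M (F : ℤ → ℤ → Carrier) →
    bisum N (λ m → bisum M (F m)) ≈ bisum M (λ n → bisum N λ m → F m n)
  bisum-swap zero    M F = sym (bisum-0 M)
  bisum-swap (suc N) M F = begin
    bisum N (λ m → bisum M (F m)) + (bisum M (F (+ N)) + bisum M (F -[1+ N ]))
      ≈⟨ +-cong (bisum-swap N M F) (sym (bisum-+ M (F (+ N)) (F -[1+ N ]))) ⟩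
    bisum M (λ n → bisum N λ m → F m n) + bisum M (λ n → F (+ N) n + F -[1+ N ] n)
      ≈⟨ bisum-+ M _ _ ⟨
    bisum M (λ n → bisum (suc N) λ m → F m n) ∎

  bisum-extend : ∀ {N M g} → N ≤ M → Supported N g → bisum M g ≈ bisum N g
  bisum-extend {N} {M} {g} N≤M supp =
    ≡.subst (λ M → bisum M g ≈ bisum N g) (ℕₚ.m∸n+n≡m N≤M) (extend (M ℕ.∸ N))
    where
    extend : ∀ d → bisum (d ℕ.+ N) g ≈ bisum N g
    extend zero    = refl
    extend (suc d) = begin
      bisum (d ℕ.+ N) g + (g (+ (d ℕ.+ N)) + g -[1+ d ℕ.+ N ])
        ≈⟨ +-cong (extend d) (+-cong (supp _ (ℕₚ.m≤n+m N d)) (supp _ (ℕₚ.m≤n⇒m≤1+n (ℕₚ.m≤n+m N d)))) ⟩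
      bisum N g + (0# + 0#)
        ≈⟨ solve 1 (λ a → a :+ (con (+ 0) :+ con (+ 0)) := a) refl (bisum N g) ⟩
      bisum N g ∎

  bisum-suc-boundary : ∀ N g → bisum N (g ∘ ℤ.suc) + g (ℤ.- (+ N)) ≈ bisum N g + g (+ N)
  bisum-suc-boundary zero    g = refl
  bisum-suc-boundary (suc N) g = begin
    bisum N (g ∘ ℤ.suc) + (g (+ suc N) + g (ℤ.suc -[1+ N ])) + g -[1+ N ]
      ≡⟨ ≡.cong (λ i → bisum N (g ∘ ℤ.suc) + (g (+ suc N) + g i) + g -[1+ N ]) (suc-neg N) ⟩
    bisum N (g ∘ ℤ.suc) + (g (+ suc N) + g (ℤ.- (+ N))) + g -[1+ N ]
      ≈⟨ solve 4 (λ a b c d → a :+ (b :+ c) :+ d := (a :+ c) :+ (b :+ d)) refl _ _ _ _ ⟩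
    (bisum N (g ∘ ℤ.suc) + g (ℤ.- (+ N))) + (g (+ suc N) + g -[1+ N ])
      ≈⟨ +-congʳ (bisum-suc-boundary N g) ⟩
    (bisum N g + g (+ N)) + (g (+ suc N) + g -[1+ N ])
      ≈⟨ solve 4 (λ a b c d → (a :+ b) :+ (c :+ d) := a :+ (b :+ d) :+ c) refl _ _ _ _ ⟩
    bisum N g + (g (+ N) + g -[1+ N ]) + g (+ suc N) ∎
    where
    suc-neg : ∀ N → ℤ.suc -[1+ N ] ≡ ℤ.- (+ N)
    suc-neg zero    = ≡.refl
    suc-neg (suc N) = ≡.refl

  bisum-suc : ∀ N {g} → Supported N g → bisum N (g ∘ ℤ.suc) ≈ bisum N g
  bisum-suc N {g} supp = begin
    bisum N (g ∘ ℤ.suc)                   ≈⟨ +-identityʳ _ ⟨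
    bisum N (g ∘ ℤ.suc) + 0#              ≈⟨ +-congˡ (supp _ (ℕₚ.≤-reflexive (≡.sym (ℤₚ.∣-i∣≡∣i∣ (+ N))))) ⟨
    bisum N (g ∘ ℤ.suc) + g (ℤ.- (+ N))   ≈⟨ bisum-suc-boundary N g ⟩
    bisum N g + g (+ N)                   ≈⟨ +-congˡ (supp _ ℕₚ.≤-refl) ⟩
    bisum N g + 0#                        ≈⟨ +-identityʳ _ ⟩
    bisum N g                             ∎

  -- Negation turns the window -N ≤ n < N into -N < n ≤ N, which is also its translate by one.
  bisum-neg : ∀ N {g} → Supported N g → bisum N (g ∘ ℤ.-_) ≈ bisum N g
  bisum-neg N {g} supp = trans (same N) (bisum-suc N supp)
    where
    suc-neg : ∀ N → ℤ.- (+ N) ≡ ℤ.suc -[1+ N ]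
    suc-neg zero    = ≡.refl
    suc-neg (suc N) = ≡.refl

    same : ∀ N → bisum N (g ∘ ℤ.-_) ≈ bisum N (g ∘ ℤ.suc)
    same zero    = refl
    same (suc N) = +-cong (same N)
      (trans (+-comm _ _) (+-congˡ (reflexive (≡.cong g (suc-neg N)))))

  -- The triangle inequality for n = -m + (m + n).
  supported-shift : ∀ {N g} m → Supported N g → Supported (∣ m ∣ ℕ.+ N) (g ∘ (ℤ._+_ m))
  supported-shift {N} m supp n m+N≤n =
    supp (m ℤ.+ n) (ℕₚ.+-cancelˡ-≤ ∣ m ∣ N _ (ℕₚ.≤-trans m+N≤n ∣n∣≤))
    where
    recover : ∀ m n → ℤ.- m ℤ.+ (m ℤ.+ n) ≡ n
    recover = ℤ-solve

    ∣n∣≤ : ∣ n ∣ ≤ ∣ m ∣ ℕ.+ ∣ m ℤ.+ n ∣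
    ∣n∣≤ = ≡.subst₂ (λ x y → ∣ x ∣ ≤ y ℕ.+ ∣ m ℤ.+ n ∣) (recover m n) (ℤₚ.∣-i∣≡∣i∣ m)
      (ℤₚ.∣i+j∣≤∣i∣+∣j∣ (ℤ.- m) (m ℤ.+ n))

  bisum-shift⁺ : ∀ {N M g} k → k ℕ.+ N ≤ M → Supported N g →
    bisum M (g ∘ (ℤ._+_ (+ k))) ≈ bisum M g
  bisum-shift⁺ {M = M} {g} zero _ supp =
    bisum-cong M λ n → reflexive (≡.cong g (ℤₚ.+-identityˡ n))
  bisum-shift⁺ {N} {M} {g} (suc k) k+N<M supp = begin
    bisum M (g ∘ (ℤ._+_ (+ suc k)))         ≈⟨ bisum-cong M (λ n → reflexive (≡.cong g (move (+ k) n))) ⟩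
    bisum M (g ∘ (ℤ._+_ (+ k)) ∘ ℤ.suc)     ≈⟨ bisum-suc M (supported-mono k+N≤M (supported-shift (+ k) supp)) ⟩
    bisum M (g ∘ (ℤ._+_ (+ k)))             ≈⟨ bisum-shift⁺ k k+N≤M supp ⟩
    bisum M g                            ∎
    where
    k+N≤M : k ℕ.+ N ≤ M
    k+N≤M = ℕₚ.≤-trans (ℕₚ.n≤1+n _) k+N<M

    move : ∀ k n → + 1 ℤ.+ k ℤ.+ n ≡ k ℤ.+ (+ 1 ℤ.+ n)
    move = ℤ-solve

  -- A shift down is a shift up read backwards: the positive case is applied to the summand already
  -- shifted, whose support has grown by ∣m∣. This is why ∣m∣ enters the bound twice.
  bisum-shift : ∀ {N M g} m → ∣ m ∣ ℕ.+ (∣ m ∣ ℕ.+ N) ≤ M → Supported N g →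
    bisum M (g ∘ (ℤ._+_ m)) ≈ bisum M g
  bisum-shift {N} (+ k) bound supp =
    bisum-shift⁺ k (ℕₚ.≤-trans (ℕₚ.m≤n+m (k ℕ.+ N) k) bound) supp
  bisum-shift {N} {M} {g} -[1+ k ] bound supp = begin
    bisum M (g ∘ (ℤ._+_ -[1+ k ]))
      ≈⟨ bisum-shift⁺ (suc k) bound (supported-shift -[1+ k ] supp) ⟨
    bisum M (λ n → g (-[1+ k ] ℤ.+ (+ suc k ℤ.+ n)))
      ≈⟨ bisum-cong M (λ n → reflexive (≡.cong g (cancel (+ suc k) n))) ⟩
    bisum M g ∎
    where
    cancel : ∀ k n → ℤ.- k ℤ.+ (k ℤ.+ n) ≡ n
    cancel = ℤ-solve

  -- Exact without any support condition: the half-open window of length 4N is the disjoint union of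
  -- the numbers 2n and 2n + 1 with -N ≤ n < N.
  bisum-parity : ∀ N g → bisum (N ℕ.+ N) g ≈
    bisum N (λ n → g (n ℤ.+ n)) + bisum N (λ n → g (ℤ.suc (n ℤ.+ n)))
  bisum-parity zero    g = sym (+-identityˡ 0#)
  bisum-parity (suc N) g = begin
    bisum (suc N ℕ.+ suc N) g
      ≡⟨ ≡.cong (λ M → bisum (suc M) g) (ℕₚ.+-suc N N) ⟩
    bisum (N ℕ.+ N) g + (a + d) + (b + e)
      ≈⟨ +-congʳ (+-congʳ (bisum-parity N g)) ⟩
    x + y + (a + d) + (b + e)
      ≈⟨ solve 6 (λ x y a b d e → x :+ y :+ (a :+ d) :+ (b :+ e)
                               := (x :+ (a :+ e)) :+ (y :+ (b :+ d))) refl x y a b d e ⟩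
    (x + (a + e)) + (y + (b + d)) ∎
    where
    x y a b d e : Carrier
    x = bisum N (λ n → g (n ℤ.+ n))
    y = bisum N (λ n → g (ℤ.suc (n ℤ.+ n)))
    a = g (+ (N ℕ.+ N))
    b = g (+ suc (N ℕ.+ N))
    d = g -[1+ N ℕ.+ N ]
    e = g -[1+ suc (N ℕ.+ N) ]

  -- For fixed m the inner variable is translated by -m, so that it stands for m + n. After
  -- exchanging the sums it is split by parity into 2r and 2r + 1, and m is translated to r + s.
  bisum-rotate : ∀ N (F : ℤ → ℤ → Carrier) →
    (∀ m n → N ≤ ∣ m ∣ ⊎ N ≤ ∣ n ∣ → F m n ≈ 0#) →
    bisum N (λ m → bisum N (F m)) ≈
      bisum (N ℕ.+ N) (λ r → bisum (5 ℕ.* N) λ s → F (r ℤ.+ s) (r ℤ.- s))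
    + bisum (N ℕ.+ N) (λ r → bisum (5 ℕ.* N) λ s → F (r ℤ.+ s) (ℤ.suc (r ℤ.- s)))
  bisum-rotate N F supp = begin
    bisum N (λ m → bisum N (F m))
      ≈⟨ bisum-cong N (λ m → bisum-extend N≤M (λ n N≤n → supp m n (inj₂ N≤n))) ⟨
    bisum N (λ m → bisum M (F m))
      ≈⟨ bisum-cong-≤ N (λ m m≤N → bisum-shift (ℤ.- m) (shift-bound m m≤N) (λ n N≤n → supp m n (inj₂ N≤n))) ⟨
    bisum N (λ m → bisum M λ n → F m (ℤ.- m ℤ.+ n))
      ≈⟨ bisum-swap N M (λ m n → F m (ℤ.- m ℤ.+ n)) ⟩
    bisum M (λ n → bisum N λ m → F m (ℤ.- m ℤ.+ n))
      ≈⟨ bisum-parity (N ℕ.+ N) _ ⟩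
    bisum L (λ r → bisum N λ m → F m (ℤ.- m ℤ.+ (r ℤ.+ r)))
    + bisum L (λ r → bisum N λ m → F m (ℤ.- m ℤ.+ ℤ.suc (r ℤ.+ r)))
      ≈⟨ +-cong (bisum-cong-≤ L (λ r r≤L → inner (r ℤ.+ r) r r≤L))
                (bisum-cong-≤ L (λ r r≤L → inner (ℤ.suc (r ℤ.+ r)) r r≤L)) ⟩
    bisum L (λ r → bisum P λ s → F (r ℤ.+ s) (ℤ.- (r ℤ.+ s) ℤ.+ (r ℤ.+ r)))
    + bisum L (λ r → bisum P λ s → F (r ℤ.+ s) (ℤ.- (r ℤ.+ s) ℤ.+ ℤ.suc (r ℤ.+ r)))
      ≈⟨ +-cong
           (bisum-cong L λ r → bisum-cong P λ s → reflexive (≡.cong (F (r ℤ.+ s)) (even r s)))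
           (bisum-cong L λ r → bisum-cong P λ s → reflexive (≡.cong (F (r ℤ.+ s)) (odd r s))) ⟩
    bisum L (λ r → bisum P λ s → F (r ℤ.+ s) (r ℤ.- s))
    + bisum L (λ r → bisum P λ s → F (r ℤ.+ s) (ℤ.suc (r ℤ.- s))) ∎
    where
    -- Translating by -m with ∣m∣ ≤ N needs a window of 3N; M = 4N suffices and parity halves it to
    -- L = 2N. Translating by r with ∣r∣ ≤ 2N then needs P = 2N + 2N + N.
    L M P : ℕ
    L = N ℕ.+ N
    M = L ℕ.+ L
    P = 5 ℕ.* N

    even : ∀ r s → ℤ.- (r ℤ.+ s) ℤ.+ (r ℤ.+ r) ≡ r ℤ.- s
    even = ℤ-solve

    odd : ∀ r s → ℤ.- (r ℤ.+ s) ℤ.+ (+ 1 ℤ.+ (r ℤ.+ r)) ≡ + 1 ℤ.+ (r ℤ.- s)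
    odd = ℤ-solve

    N≤M : N ≤ M
    N≤M = ℕₚ.≤-trans (ℕₚ.m≤m+n N N) (ℕₚ.m≤m+n L L)

    shift-bound : ∀ m → ∣ m ∣ ≤ N → ∣ ℤ.- m ∣ ℕ.+ (∣ ℤ.- m ∣ ℕ.+ N) ≤ M
    shift-bound m m≤N rewrite ℤₚ.∣-i∣≡∣i∣ m = ℕₚ.≤-trans
      (ℕₚ.+-mono-≤ m≤N (ℕₚ.+-monoˡ-≤ N m≤N))
      (ℕₚ.≤-trans (ℕₚ.m≤n+m (N ℕ.+ L) N) (ℕₚ.≤-reflexive (≡.sym (ℕₚ.+-assoc N N L))))

    5N : ∀ N → N ℕ.+ N ℕ.+ (N ℕ.+ N ℕ.+ N) ≡ 5 ℕ.* N
    5N = ℕ-solve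

    inner : ∀ k r → ∣ r ∣ ≤ L →
      bisum N (λ m → F m (ℤ.- m ℤ.+ k)) ≈
      bisum P (λ s → F (r ℤ.+ s) (ℤ.- (r ℤ.+ s) ℤ.+ k))
    inner k r r≤L = begin
      bisum N G               ≈⟨ bisum-extend (ℕₚ.m≤n*m N 5) suppG ⟨
      bisum P G               ≈⟨ bisum-shift r bound suppG ⟨
      bisum P (G ∘ (ℤ._+_ r))  ∎
      where
      G : ℤ → Carrier
      G m = F m (ℤ.- m ℤ.+ k)

      suppG : Supported N G
      suppG m N≤m = supp m _ (inj₁ N≤m)

      bound : ∣ r ∣ ℕ.+ (∣ r ∣ ℕ.+ N) ≤ P
      bound = ℕₚ.≤-trans (ℕₚ.+-mono-≤ r≤L (ℕₚ.+-monoˡ-≤ N r≤L)) (ℕₚ.≤-reflexive (5N N))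

-- Exponents of theta series as quadratic forms

module ThetaExponents where

  open ≡.≡-Reasoning

  -- n(n - 1)/2, the exponent in Euler's and Jacobi's expansions.
  tri : ℕ → ℕ
  tri zero    = 0
  tri (suc n) = n ℕ.+ tri n

  tri-large : ∀ n → n ≤ suc (tri n)
  tri-large zero    = z≤n
  tri-large (suc n) = s≤s (ℕₚ.m≤m+n n (tri n))

  tri-double : ∀ n → + tri n ℤ.+ + tri n ≡ + n ℤ.* + n ℤ.- + n
  tri-double zero    = ≡.refl
  tri-double (suc n) = begin
    + n ℤ.+ + tri n ℤ.+ (+ n ℤ.+ + tri n)          ≡⟨ regroup (+ n) (+ tri n) ⟩
    + tri n ℤ.+ + tri n ℤ.+ (+ n ℤ.+ + n)          ≡⟨ ≡.cong (ℤ._+ (+ n ℤ.+ + n)) (tri-double n) ⟩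
    + n ℤ.* + n ℤ.- + n ℤ.+ (+ n ℤ.+ + n)          ≡⟨ square (+ n) ⟩
    (+ 1 ℤ.+ + n) ℤ.* (+ 1 ℤ.+ + n) ℤ.- (+ 1 ℤ.+ + n) ∎
    where
    regroup : ∀ n τ → n ℤ.+ τ ℤ.+ (n ℤ.+ τ) ≡ τ ℤ.+ τ ℤ.+ (n ℤ.+ n)
    regroup = ℤ-solve

    square : ∀ n → n ℤ.* n ℤ.- n ℤ.+ (n ℤ.+ n) ≡ (+ 1 ℤ.+ n) ℤ.* (+ 1 ℤ.+ n) ℤ.- (+ 1 ℤ.+ n)
    square = ℤ-solve

  -- The exponent c n(n + 1)/2 + c′ n(n - 1)/2 of Ramanujan's f(qᶜ, qᶜ′), split by the sign of n so
  -- that it is a natural number obtained without division.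
  ε : ℕ → ℕ → ℤ → ℕ
  ε c c′ (+ n)    = c ℕ.* n ℕ.+ (c ℕ.+ c′) ℕ.* tri n
  ε c c′ -[1+ n ] = c′ ℕ.* suc n ℕ.+ (c ℕ.+ c′) ℕ.* tri (suc n)

  -- Doubling clears the halves. Equalities of exponents then become polynomial identities over ℤ,
  -- and the factor 2 is cancelled at the end.
  ε-double : ∀ c c′ n →
    + ε c c′ n ℤ.* + 2 ≡ (+ c ℤ.+ + c′) ℤ.* (n ℤ.* n) ℤ.+ (+ c ℤ.- + c′) ℤ.* n
  ε-double c c′ (+ n) = ≡.trans
    (≡.cong (ℤ._* + 2) (≡.cong₂ ℤ._+_ (ℤₚ.pos-* c n) (ℤₚ.pos-* (c ℕ.+ c′) (tri n))))
    (≡.trans (expand (+ c) (+ c′) (+ n) (+ tri n))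
      (≡.trans (≡.cong (λ τ → + 2 ℤ.* + c ℤ.* + n ℤ.+ (+ c ℤ.+ + c′) ℤ.* τ) (tri-double n))
        (collect (+ c) (+ c′) (+ n))))
    where
    expand : ∀ c c′ n τ → (c ℤ.* n ℤ.+ (c ℤ.+ c′) ℤ.* τ) ℤ.* + 2 ≡ + 2 ℤ.* c ℤ.* n ℤ.+ (c ℤ.+ c′) ℤ.* (τ ℤ.+ τ)
    expand = ℤ-solve

    collect : ∀ c c′ n → + 2 ℤ.* c ℤ.* n ℤ.+ (c ℤ.+ c′) ℤ.* (n ℤ.* n ℤ.- n) ≡
      (c ℤ.+ c′) ℤ.* (n ℤ.* n) ℤ.+ (c ℤ.- c′) ℤ.* n
    collect = ℤ-solve

  ε-double c c′ -[1+ n ] = ≡.trans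
    (≡.cong (λ p → + (c′ ℕ.* suc n ℕ.+ p ℕ.* tri (suc n)) ℤ.* + 2) (ℕₚ.+-comm c c′))
    (≡.trans (ε-double c′ c (+ suc n)) (flip (+ c) (+ c′) (+ suc n)))
    where
    flip : ∀ c c′ n → (c′ ℤ.+ c) ℤ.* (n ℤ.* n) ℤ.+ (c′ ℤ.- c) ℤ.* n ≡
      (c ℤ.+ c′) ℤ.* (ℤ.- n ℤ.* ℤ.- n) ℤ.+ (c ℤ.- c′) ℤ.* ℤ.- n
    flip = ℤ-solve

  +-double-injective : ∀ {a b} → + a ℤ.* + 2 ≡ + b ℤ.* + 2 → a ≡ b
  +-double-injective eq = ℤₚ.+-injective (ℤₚ.*-cancelʳ-≡ _ _ (+ 2) eq)

  -- The substitution (m , n) = (r + k , r - k) or (r + k , r - k + 1),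
  -- according to the parity of m + n, diagonalises the quadratic form.
  module Rotation (u v w : ℕ) where

    -- Two pairs with common sum 2(u + v + w), parametrised so that the rotated exponents are
    -- natural numbers free of subtraction. In the odd case r = k = 0 means m = 0, n = 1, whose
    -- exponent is `c₂`; hence the offset `w`.
    c₁ c₁′ c₂ c₂′ e₁ e₁′ e₂ e₂′ o₁ o₁′ o₂ o₂′ : ℕ
    c₁  = w ℕ.+ (v ℕ.+ v)
    c₁′ = w ℕ.+ (u ℕ.+ u)
    c₂  = w
    c₂′ = w ℕ.+ (u ℕ.+ v ℕ.+ (u ℕ.+ v))
    e₁  = v ℕ.+ w ℕ.+ (v ℕ.+ w)
    e₁′ = u ℕ.+ u ℕ.+ v ℕ.+ w ℕ.+ (u ℕ.+ u ℕ.+ v ℕ.+ w)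
    e₂  = u ℕ.+ v ℕ.+ v ℕ.+ w ℕ.+ (u ℕ.+ v ℕ.+ v ℕ.+ w)
    e₂′ = u ℕ.+ w ℕ.+ (u ℕ.+ w)
    o₁  = u ℕ.+ v ℕ.+ w ℕ.+ (v ℕ.+ w) ℕ.+ (u ℕ.+ v ℕ.+ w ℕ.+ (v ℕ.+ w))
    o₁′ = u ℕ.+ u
    o₂  = v ℕ.+ v
    o₂′ = u ℕ.+ v ℕ.+ w ℕ.+ (u ℕ.+ w) ℕ.+ (u ℕ.+ v ℕ.+ w ℕ.+ (u ℕ.+ w))

    private
      form : ℕ → ℕ → ℤ → ℤ
      form a b n = (+ a ℤ.+ + b) ℤ.* (n ℤ.* n) ℤ.+ (+ a ℤ.- + b) ℤ.* n

      from-forms : ∀ a a′ b b′ d d′ e e′ m n r k w →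
        form a a′ m ℤ.+ form b b′ n ≡ form d d′ r ℤ.+ form e e′ k ℤ.+ + w ℤ.* + 2 →
        ε a a′ m ℕ.+ ε b b′ n ≡ ε d d′ r ℕ.+ ε e e′ k ℕ.+ w
      from-forms a a′ b b′ d d′ e e′ m n r k w eq = +-double-injective (begin
        (+ ε a a′ m ℤ.+ + ε b b′ n) ℤ.* + 2
          ≡⟨ ℤₚ.*-distribʳ-+ (+ 2) (+ ε a a′ m) (+ ε b b′ n) ⟩
        + ε a a′ m ℤ.* + 2 ℤ.+ + ε b b′ n ℤ.* + 2
          ≡⟨ ≡.cong₂ ℤ._+_ (ε-double a a′ m) (ε-double b b′ n) ⟩
        form a a′ m ℤ.+ form b b′ n
          ≡⟨ eq ⟩
        form d d′ r ℤ.+ form e e′ k ℤ.+ + w ℤ.* + 2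
          ≡⟨ ≡.cong (ℤ._+ + w ℤ.* + 2) (≡.cong₂ ℤ._+_ (ε-double d d′ r) (ε-double e e′ k)) ⟨
        + ε d d′ r ℤ.* + 2 ℤ.+ + ε e e′ k ℤ.* + 2 ℤ.+ + w ℤ.* + 2
          ≡⟨ collect (+ ε d d′ r) (+ ε e e′ k) (+ w) ⟩
        (+ ε d d′ r ℤ.+ + ε e e′ k ℤ.+ + w) ℤ.* + 2 ∎)
        where
        collect : ∀ a b c → a ℤ.* + 2 ℤ.+ b ℤ.* + 2 ℤ.+ c ℤ.* + 2 ≡ (a ℤ.+ b ℤ.+ c) ℤ.* + 2
        collect = ℤ-solve

      -- Stated over ℤ with the exponents written out for the solver. At naturals it agrees with
      -- `form` by computation, since `+ a ℤ.+ + b` evaluates to `+ (a ℕ.+ b)`. The summand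
      -- `+ 0 ℤ.* + 2` gives it the shape of the odd case.
      form-even : ∀ u v w r k →
        ((w ℤ.+ (v ℤ.+ v)) ℤ.+ (w ℤ.+ (u ℤ.+ u))) ℤ.* ((r ℤ.+ k) ℤ.* (r ℤ.+ k)) ℤ.+ ((w ℤ.+ (v ℤ.+ v)) ℤ.- (w ℤ.+ (u ℤ.+ u))) ℤ.* (r ℤ.+ k)
        ℤ.+ (((w) ℤ.+ (w ℤ.+ (u ℤ.+ v ℤ.+ (u ℤ.+ v)))) ℤ.* ((r ℤ.- k) ℤ.* (r ℤ.- k)) ℤ.+ ((w) ℤ.- (w ℤ.+ (u ℤ.+ v ℤ.+ (u ℤ.+ v)))) ℤ.* (r ℤ.- k))
        ≡ ((v ℤ.+ w ℤ.+ (v ℤ.+ w)) ℤ.+ (u ℤ.+ u ℤ.+ v ℤ.+ w ℤ.+ (u ℤ.+ u ℤ.+ v ℤ.+ w))) ℤ.* ((r) ℤ.* (r)) ℤ.+ ((v ℤ.+ w ℤ.+ (v ℤ.+ w)) ℤ.- (u ℤ.+ u ℤ.+ v ℤ.+ w ℤ.+ (u ℤ.+ u ℤ.+ v ℤ.+ w))) ℤ.* (r)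
        ℤ.+ (((u ℤ.+ v ℤ.+ v ℤ.+ w ℤ.+ (u ℤ.+ v ℤ.+ v ℤ.+ w)) ℤ.+ (u ℤ.+ w ℤ.+ (u ℤ.+ w))) ℤ.* ((k) ℤ.* (k)) ℤ.+ ((u ℤ.+ v ℤ.+ v ℤ.+ w ℤ.+ (u ℤ.+ v ℤ.+ v ℤ.+ w)) ℤ.- (u ℤ.+ w ℤ.+ (u ℤ.+ w))) ℤ.* (k)) ℤ.+ + 0 ℤ.* + 2
      form-even = ℤ-solve

      form-odd : ∀ u v w r k →
        ((w ℤ.+ (v ℤ.+ v)) ℤ.+ (w ℤ.+ (u ℤ.+ u))) ℤ.* ((r ℤ.+ k) ℤ.* (r ℤ.+ k)) ℤ.+ ((w ℤ.+ (v ℤ.+ v)) ℤ.- (w ℤ.+ (u ℤ.+ u))) ℤ.* (r ℤ.+ k)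
        ℤ.+ (((w) ℤ.+ (w ℤ.+ (u ℤ.+ v ℤ.+ (u ℤ.+ v)))) ℤ.* ((+ 1 ℤ.+ (r ℤ.- k)) ℤ.* (+ 1 ℤ.+ (r ℤ.- k))) ℤ.+ ((w) ℤ.- (w ℤ.+ (u ℤ.+ v ℤ.+ (u ℤ.+ v)))) ℤ.* (+ 1 ℤ.+ (r ℤ.- k)))
        ≡ ((u ℤ.+ v ℤ.+ w ℤ.+ (v ℤ.+ w) ℤ.+ (u ℤ.+ v ℤ.+ w ℤ.+ (v ℤ.+ w))) ℤ.+ (u ℤ.+ u)) ℤ.* ((r) ℤ.* (r)) ℤ.+ ((u ℤ.+ v ℤ.+ w ℤ.+ (v ℤ.+ w) ℤ.+ (u ℤ.+ v ℤ.+ w ℤ.+ (v ℤ.+ w))) ℤ.- (u ℤ.+ u)) ℤ.* (r)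
        ℤ.+ (((v ℤ.+ v) ℤ.+ (u ℤ.+ v ℤ.+ w ℤ.+ (u ℤ.+ w) ℤ.+ (u ℤ.+ v ℤ.+ w ℤ.+ (u ℤ.+ w)))) ℤ.* ((k) ℤ.* (k)) ℤ.+ ((v ℤ.+ v) ℤ.- (u ℤ.+ v ℤ.+ w ℤ.+ (u ℤ.+ w) ℤ.+ (u ℤ.+ v ℤ.+ w ℤ.+ (u ℤ.+ w)))) ℤ.* (k)) ℤ.+ w ℤ.* + 2
      form-odd = ℤ-solve

    ε-even : ∀ r k → ε c₁ c₁′ (r ℤ.+ k) ℕ.+ ε c₂ c₂′ (r ℤ.- k) ≡ ε e₁ e₁′ r ℕ.+ ε e₂ e₂′ k ℕ.+ 0
    ε-even r k = from-forms c₁ c₁′ c₂ c₂′ e₁ e₁′ e₂ e₂′ (r ℤ.+ k) (r ℤ.- k) r k 0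
      (form-even (+ u) (+ v) (+ w) r k)

    ε-odd : ∀ r k → ε c₁ c₁′ (r ℤ.+ k) ℕ.+ ε c₂ c₂′ (ℤ.suc (r ℤ.- k)) ≡ ε o₁ o₁′ r ℕ.+ ε o₂ o₂′ k ℕ.+ w
    ε-odd r k = from-forms c₁ c₁′ c₂ c₂′ o₁ o₁′ o₂ o₂′ (r ℤ.+ k) (ℤ.suc (r ℤ.- k)) r k w
      (form-odd (+ u) (+ v) (+ w) r k)

-- Jacobi's triple product for a nilpotent base

module TripleProduct {c ℓ} (R : CommutativeRing c ℓ) where

  open BilateralSum R
  open ThetaExponents

  open CommutativeRing R
  open import Relation.Binary.Reasoning.Setoid setoid
  open IntegerSolver R using (solve; _:+_; _:*_; _:=_; con)
  open Exp semiring using (_^_; ^-homo-*; ^-assocʳ)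

  prod : ℕ → (ℕ → Carrier) → Carrier
  prod zero    g = 1#
  prod (suc N) g = g N * prod N g

  prod-cong : ∀ N {g h} → (∀ j → g j ≈ h j) → prod N g ≈ prod N h
  prod-cong zero    g≈h = refl
  prod-cong (suc N) g≈h = *-cong (g≈h N) (prod-cong N g≈h)

  prod-stable : ∀ {N M g} → N ≤ M → (∀ j → N ≤ j → g j ≈ 1#) → prod M g ≈ prod N g
  prod-stable {N} {M} {g} N≤M g≈1 =
    ≡.subst (λ M → prod M g ≈ prod N g) (ℕₚ.m∸n+n≡m N≤M) (stable (M ℕ.∸ N))
    where
    stable : ∀ d → prod (d ℕ.+ N) g ≈ prod N g
    stable zero    = refl
    stable (suc d) = trans (*-cong (g≈1 _ (ℕₚ.m≤n+m N d)) (stable d)) (*-identityˡ _)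

  ^-vanish : ∀ {y m n} → y ^ m ≈ 0# → m ≤ n → y ^ n ≈ 0#
  ^-vanish {y} {m} {n} y^m≈0 m≤n = begin
    y ^ n                    ≡⟨ ≡.cong (y ^_) (ℕₚ.m∸n+n≡m m≤n) ⟨
    y ^ (n ℕ.∸ m ℕ.+ m)      ≈⟨ ^-homo-* y (n ℕ.∸ m) m ⟩
    y ^ (n ℕ.∸ m) * y ^ m    ≈⟨ *-congˡ y^m≈0 ⟩
    y ^ (n ℕ.∸ m) * 0#       ≈⟨ zeroʳ _ ⟩
    0#                       ∎

  minus-unique : ∀ {y z w} → z ≈ w + y * z → (1# - y) * z ≈ w
  minus-unique {y} {z} {w} z≈w+yz = begin
    (1# - y) * z        ≈⟨ [y-z]x≈yx-zx z 1# y ⟩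
    1# * z - y * z      ≈⟨ +-congʳ (trans (*-identityˡ z) z≈w+yz) ⟩
    w + y * z - y * z   ≈⟨ //-rightDividesʳ (y * z) w ⟩
    w                   ∎
    where
    open RingProperties ring using ([y-z]x≈yx-zx)
    open GroupProperties +-group using (//-rightDividesʳ)

  -- 1 + y + ... + yⁿ⁻¹, the inverse of 1 - y as soon as yⁿ vanishes.
  geometric : Carrier → ℕ → Carrier
  geometric y zero    = 0#
  geometric y (suc n) = 1# + y * geometric y n

  geometric-recursion : ∀ y n → geometric y n + y ^ n ≈ 1# + y * geometric y n
  geometric-recursion y zero    = solve 1 (λ y → con (+ 0) :+ con (+ 1) := con (+ 1) :+ y :* con (+ 0)) refl y
  geometric-recursion y (suc n) = begin
    1# + y * g + y * y ^ n    ≈⟨ solve 3 (λ y g p → con (+ 1) :+ y :* g :+ y :* p := con (+ 1) :+ y :* (g :+ p)) refl y g (y ^ n) ⟩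
    1# + y * (g + y ^ n)      ≈⟨ +-congˡ (*-congˡ (geometric-recursion y n)) ⟩
    1# + y * (1# + y * g)     ∎
    where g = geometric y n

  geometric-fixed : ∀ {y n} → y ^ n ≈ 0# → geometric y n ≈ 1# + y * geometric y n
  geometric-fixed {y} {n} y^n≈0 = begin
    geometric y n            ≈⟨ +-identityʳ _ ⟨
    geometric y n + 0#       ≈⟨ +-congˡ y^n≈0 ⟨
    geometric y n + y ^ n    ≈⟨ geometric-recursion y n ⟩
    1# + y * geometric y n   ∎

  module _ (x x′ Q : Carrier) (xx′≈Q : x * x′ ≈ Q) (K : ℕ) (Q^K≈0 : Q ^ K ≈ 0#) where

    -- The terms xⁿ Q^(n(n - 1)/2). For n < 0 the relation `x * x′ ≈ Q` lets powers of `x′` take the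
    -- place of negative powers of `x`, which need not be a unit.
    t : ℤ → Carrier
    t (+ n)    = x ^ n * Q ^ tri n
    t -[1+ n ] = x′ ^ suc n * Q ^ tri (suc n)

    private
      -- From index K + 1 on `tri` is at least K, so `Q ^ tri n` vanishes.
      L : ℕ
      L = suc K

      -- 1/(Q;Q)ₖ, assembled from geometric sums.
      r : ℕ → Carrier
      r zero    = 1#
      r (suc k) = r k * geometric (Q ^ suc k) K

      u : ℕ → Carrier
      u N = prod N λ j → 1# - Q ^ suc j

      Q^suc-vanish : ∀ k → (Q ^ suc k) ^ K ≈ 0#
      Q^suc-vanish k = trans (^-assocʳ Q (suc k) K) (^-vanish Q^K≈0 (ℕₚ.m≤n*m K (suc k)))

      r-recursion : ∀ k → r (suc k) ≈ r k + Q ^ suc k * r (suc k)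
      r-recursion k = begin
        r k * g                   ≈⟨ *-congˡ (geometric-fixed {n = K} (Q^suc-vanish k)) ⟩
        r k * (1# + Q ^ suc k * g)  ≈⟨ solve 3 (λ r y g → r :* (con (+ 1) :+ y :* g) := r :+ y :* (r :* g)) refl (r k) (Q ^ suc k) g ⟩
        r k + Q ^ suc k * (r k * g) ∎
        where g = geometric (Q ^ suc k) K

      ur≈1 : ∀ k → u k * r k ≈ 1#
      ur≈1 zero    = *-identityˡ 1#
      ur≈1 (suc k) = begin
        (1# - Q ^ suc k) * u k * r (suc k)   ≈⟨ solve 3 (λ a b c → a :* b :* c := b :* (a :* c)) refl _ _ _ ⟩
        u k * ((1# - Q ^ suc k) * r (suc k)) ≈⟨ *-congˡ (minus-unique (r-recursion k)) ⟩
        u k * r k                            ≈⟨ ur≈1 k ⟩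
        1#                                   ∎

      u-stable : ∀ {k} → K ≤ k → u k ≈ u K
      u-stable K≤k = prod-stable K≤k λ j K≤j → begin
        1# - Q ^ suc j   ≈⟨ +-congˡ (-‿cong (^-vanish Q^K≈0 (ℕₚ.m≤n⇒m≤1+n K≤j))) ⟩
        1# - 0#          ≈⟨ +-congˡ (RingProperties.-0#≈0# ring) ⟩
        1# + 0#          ≈⟨ +-identityʳ 1# ⟩
        1#               ∎

      r-stable : ∀ {k} → K ≤ k → r k ≈ r K
      r-stable {k} K≤k = begin
        r k               ≈⟨ *-identityˡ (r k) ⟨
        1# * r k          ≈⟨ *-congʳ (ur≈1 K) ⟨
        u K * r K * r k   ≈⟨ *-congʳ (*-congʳ (u-stable K≤k)) ⟨
        u k * r K * r k   ≈⟨ solve 3 (λ a b c → a :* b :* c := a :* c :* b) refl _ _ _ ⟩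
        u k * r k * r K   ≈⟨ *-congʳ (ur≈1 k) ⟩
        1# * r K          ≈⟨ *-identityˡ (r K) ⟩
        r K               ∎

      -- 1/(Q;Q)ₙ continued by zero to n < 0, the usual convention; it keeps the recursion in A free
      -- of exceptional indices.
      h : ℤ → Carrier
      h (+ k)    = r k
      h -[1+ _ ] = 0#

      usum : ℕ → (ℕ → Carrier) → Carrier
      usum zero    g = 0#
      usum (suc N) g = usum N g + g N

      a : Carrier → ℕ → Carrier
      a y m = y ^ m * Q ^ tri m * r m

      *-^-distrib : ∀ m y z → (y * z) ^ m ≈ y ^ m * z ^ m
      *-^-distrib zero    y z = sym (*-identityˡ 1#)
      *-^-distrib (suc m) y z = trans (*-congˡ (*-^-distrib m y z))
        (solve 4 (λ y z p q → y :* z :* (p :* q) := y :* p :* (z :* q)) refl y z (y ^ m) (z ^ m))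

      a-scaled : ∀ y m → a (y * Q) m ≈ Q ^ m * a y m
      a-scaled y m = trans (*-congʳ (*-congʳ (*-^-distrib m y Q)))
        (solve 4 (λ p q t r → p :* q :* t :* r := q :* (p :* t :* r)) refl _ _ _ _)

      -- Splitting 1/(Q;Q)ₘ₊₁ as 1/(Q;Q)ₘ + Qᵐ⁺¹/(Q;Q)ₘ₊₁ leaves y times the preceding term and the
      -- same term, both at yQ. Summed up, this is Euler's functional equation E(y) = (1 + y) E(yQ).
      a-recursion : ∀ y m → a y (suc m) ≈ a (y * Q) (suc m) + y * a (y * Q) m
      a-recursion y m = begin
        y ^ suc m * Q ^ tri (suc m) * r (suc m)
          ≈⟨ *-congˡ (r-recursion m) ⟩
        y ^ suc m * Q ^ tri (suc m) * (r m + Q ^ suc m * r (suc m))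
          ≈⟨ solve 4 (λ p r₀ q r₁ → p :* (r₀ :+ q :* r₁) := q :* (p :* r₁) :+ p :* r₀) refl _ _ _ _ ⟩
        Q ^ suc m * a y (suc m) + y ^ suc m * Q ^ (m ℕ.+ tri m) * r m
          ≈⟨ +-cong (sym (a-scaled y (suc m))) (*-congʳ (*-congˡ (^-homo-* Q m (tri m)))) ⟩
        a (y * Q) (suc m) + y * y ^ m * (Q ^ m * Q ^ tri m) * r m
          ≈⟨ +-congˡ (solve 5 (λ y p q t r → y :* p :* (q :* t) :* r := y :* (q :* (p :* t :* r))) refl _ _ _ _ _) ⟩
        a (y * Q) (suc m) + y * (Q ^ m * a y m)
          ≈⟨ +-congˡ (*-congˡ (a-scaled y m)) ⟨
        a (y * Q) (suc m) + y * a (y * Q) m ∎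

      usum-recursion : ∀ y N → usum (suc N) (a y) ≈ usum (suc N) (a (y * Q)) + y * usum N (a (y * Q))
      usum-recursion y zero    = sym (trans (+-congˡ (zeroʳ y)) (+-identityʳ _))
      usum-recursion y (suc N) = begin
        usum (suc N) (a y) + a y (suc N)
          ≈⟨ +-cong (usum-recursion y N) (a-recursion y N) ⟩
        usum (suc N) (a yQ) + y * usum N (a yQ) + (a yQ (suc N) + y * a yQ N)
          ≈⟨ solve 5 (λ s y t b c → s :+ y :* t :+ (b :+ y :* c) := s :+ b :+ y :* (t :+ c)) refl _ _ _ _ _ ⟩
        usum (suc N) (a yQ) + a yQ (suc N) + y * (usum N (a yQ) + a yQ N) ∎
        where yQ = y * Q

      Q^tri-vanish : ∀ {n} → L ≤ n → Q ^ tri n ≈ 0#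
      Q^tri-vanish {n} L≤n = ^-vanish Q^K≈0 (ℕₚ.≤-pred (ℕₚ.≤-trans L≤n (tri-large n)))

      a-vanish : ∀ y {m} → L ≤ m → a y m ≈ 0#
      a-vanish y {m} L≤m = begin
        y ^ m * Q ^ tri m * r m   ≈⟨ *-congʳ (*-congˡ (Q^tri-vanish L≤m)) ⟩
        y ^ m * 0# * r m          ≈⟨ solve 2 (λ p r → p :* con (+ 0) :* r := con (+ 0)) refl _ _ ⟩
        0#                        ∎

      E : Carrier → Carrier
      E y = usum (suc L) (a y)

      E-recursion : ∀ y → E y ≈ (1# + y) * E (y * Q)
      E-recursion y = begin
        E y                                             ≈⟨ usum-recursion y L ⟩
        E (y * Q) + y * usum L (a (y * Q))              ≈⟨ +-congˡ (*-congˡ (+-identityʳ _)) ⟨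
        E (y * Q) + y * (usum L (a (y * Q)) + 0#)       ≈⟨ +-congˡ (*-congˡ (+-congˡ (a-vanish (y * Q) {L} ℕₚ.≤-refl))) ⟨
        E (y * Q) + y * E (y * Q)                       ≈⟨ solve 2 (λ y e → e :+ y :* e := (con (+ 1) :+ y) :* e) refl y _ ⟩
        (1# + y) * E (y * Q)                            ∎

      usum-cong : ∀ N {g h} → (∀ m → g m ≈ h m) → usum N g ≈ usum N h
      usum-cong zero    g≈h = refl
      usum-cong (suc N) g≈h = +-cong (usum-cong N g≈h) (g≈h N)

      E-cong : ∀ {y z} → y ≈ z → E y ≈ E z
      E-cong {y} {z} y≈z = usum-cong (suc L) λ m → *-congʳ (*-congʳ (Exp.^-congˡ semiring m y≈z))

      E-0 : E 0# ≈ 1#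
      E-0 = go L
        where
        go : ∀ N → usum (suc N) (a 0#) ≈ 1#
        go zero    = solve 0 (con (+ 0) :+ con (+ 1) :* con (+ 1) :* con (+ 1) := con (+ 1)) refl
        go (suc N) = trans (+-cong (go N)
          (solve 3 (λ p t r → con (+ 0) :* p :* t :* r := con (+ 0)) refl _ _ _)) (+-identityʳ 1#)

      E-unfold : ∀ y N → E y ≈ prod N (λ j → 1# + y * Q ^ j) * E (y * Q ^ N)
      E-unfold y zero    = trans (E-cong (sym (*-identityʳ y))) (sym (*-identityˡ _))
      E-unfold y (suc N) = begin
        E y                                             ≈⟨ E-unfold y N ⟩
        P * E (y * Q ^ N)                               ≈⟨ *-congˡ (E-recursion (y * Q ^ N)) ⟩
        P * ((1# + y * Q ^ N) * E (y * Q ^ N * Q))      ≈⟨ *-congˡ (*-congˡ (E-cong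
            (solve 3 (λ y p q → y :* p :* q := y :* (q :* p)) refl y (Q ^ N) Q))) ⟩
        P * ((1# + y * Q ^ N) * E (y * Q ^ suc N))      ≈⟨ solve 3 (λ p b e → p :* (b :* e) := b :* p :* e) refl _ _ _ ⟩
        (1# + y * Q ^ N) * P * E (y * Q ^ suc N)        ∎
        where P = prod N (λ j → 1# + y * Q ^ j)

      -- Iterating the functional equation K times moves the argument to y Q^K = 0, where only the
      -- constant term survives.
      euler : ∀ y → E y ≈ prod K (λ j → 1# + y * Q ^ j)
      euler y = begin
        E y                    ≈⟨ E-unfold y K ⟩
        P * E (y * Q ^ K)      ≈⟨ *-congˡ (E-cong (trans (*-congˡ Q^K≈0) (zeroʳ y))) ⟩
        P * E 0#               ≈⟨ *-congˡ E-0 ⟩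
        P * 1#                 ≈⟨ *-identityʳ P ⟩
        P                      ∎
        where P = prod K (λ j → 1# + y * Q ^ j)

    t-supported : Supported (suc K) t
    t-supported (+ n)    L≤n = trans (*-congˡ (Q^tri-vanish L≤n)) (zeroʳ _)
    t-supported -[1+ n ] L≤n = trans (*-congˡ (Q^tri-vanish L≤n)) (zeroʳ _)

    private
      -- The coefficients of ∏_{j<A} (1 + x Qʲ) ∏_{j≥0} (1 + x′ Qʲ).
      g : ℕ → ℤ → Carrier
      g A n = h (+ A ℤ.- n) * t n

      P : ℕ → Carrier
      P A = bisum (suc L) (g A)

      g-supported : ∀ A → Supported L (g A)
      g-supported A n L≤n = trans (*-congˡ (t-supported n L≤n)) (zeroʳ _)

      -- The relation 1/(Q;Q)ₖ = 1/(Q;Q)ₖ₋₁ + Qᵏ/(Q;Q)ₖ at k = A - m, multiplied by Qᵐ so that no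
      -- negative power of Q appears when k < 0.
      h-recursion : ∀ A m →
        Q ^ m * h (A ℤ.⊖ m) ≈ Q ^ m * h (A ℤ.⊖ suc m) + Q ^ A * h (A ℤ.⊖ m)
      h-recursion zero    zero    = solve 0 (con (+ 1) :* con (+ 1) := con (+ 1) :* con (+ 0) :+ con (+ 1) :* con (+ 1)) refl
      h-recursion zero    (suc m) = solve 1 (λ p → p :* con (+ 0) := p :* con (+ 0) :+ con (+ 1) :* con (+ 0)) refl _
      h-recursion (suc A) zero    = begin
        1# * r (suc A)                           ≈⟨ *-identityˡ _ ⟩
        r (suc A)                                ≈⟨ r-recursion A ⟩
        r A + Q ^ suc A * r (suc A)              ≈⟨ +-congʳ (*-identityˡ _) ⟨
        1# * r A + Q ^ suc A * r (suc A)         ∎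
      h-recursion (suc A) (suc m) = begin
        Q ^ suc m * h (suc A ℤ.⊖ suc m)
          ≡⟨ ≡.cong (λ i → Q ^ suc m * h i) (ℤₚ.[1+m]⊖[1+n]≡m⊖n A m) ⟩
        Q * Q ^ m * h (A ℤ.⊖ m)
          ≈⟨ trans (*-assoc _ _ _) (*-congˡ (h-recursion A m)) ⟩
        Q * (Q ^ m * h (A ℤ.⊖ suc m) + Q ^ A * h (A ℤ.⊖ m))
          ≈⟨ solve 5 (λ q p k s l → q :* (p :* k :+ s :* l) := q :* p :* k :+ q :* s :* l) refl _ _ _ _ _ ⟩
        Q ^ suc m * h (A ℤ.⊖ suc m) + Q ^ suc A * h (A ℤ.⊖ m)
          ≡⟨ ≡.cong₂ (λ i j → Q ^ suc m * h i + Q ^ suc A * h j)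
               (ℤₚ.[1+m]⊖[1+n]≡m⊖n A (suc m)) (ℤₚ.[1+m]⊖[1+n]≡m⊖n A m) ⟨
        Q ^ suc m * h (suc A ℤ.⊖ suc (suc m)) + Q ^ suc A * h (suc A ℤ.⊖ suc m) ∎

      -- The index n = -m. Here `x` meets `x′`, and `x * x′ ≈ Q` supplies the power Q^(A + m + 1)
      -- that the recursion of `r` asks for.
      g-recursion⁻ : ∀ A m →
        r (suc (A ℕ.+ m)) * (x′ ^ m * Q ^ tri m) ≈
        r (A ℕ.+ m) * (x′ ^ m * Q ^ tri m)
        + x * Q ^ A * (r (suc (A ℕ.+ m)) * (x′ ^ suc m * Q ^ tri (suc m)))
      g-recursion⁻ A m = begin
        r (suc (A ℕ.+ m)) * T
          ≈⟨ *-congʳ (r-recursion (A ℕ.+ m)) ⟩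
        (r (A ℕ.+ m) + Q * Q ^ (A ℕ.+ m) * r′) * T
          ≈⟨ *-congʳ (+-congˡ (*-congʳ (*-cong (sym xx′≈Q) (^-homo-* Q A m)))) ⟩
        (r (A ℕ.+ m) + x * x′ * (Q ^ A * Q ^ m) * r′) * T
          ≈⟨ solve 8 (λ r₀ x x′ a b r₁ p q →
               (r₀ :+ x :* x′ :* (a :* b) :* r₁) :* (p :* q)
               := r₀ :* (p :* q) :+ x :* a :* (r₁ :* (x′ :* p :* (b :* q)))) refl
               (r (A ℕ.+ m)) x x′ (Q ^ A) (Q ^ m) r′ (x′ ^ m) (Q ^ tri m) ⟩
        r (A ℕ.+ m) * T + x * Q ^ A * (r′ * (x′ ^ suc m * (Q ^ m * Q ^ tri m)))
          ≈⟨ +-congˡ (*-congˡ (*-congˡ (*-congˡ (^-homo-* Q m (tri m))))) ⟨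
        r (A ℕ.+ m) * T + x * Q ^ A * (r′ * (x′ ^ suc m * Q ^ tri (suc m))) ∎
        where
        r′ = r (suc (A ℕ.+ m))
        T  = x′ ^ m * Q ^ tri m

      g-recursion⁺ : ∀ A m →
        h (A ℤ.⊖ m) * t (+ suc m) ≈
        h (A ℤ.⊖ suc m) * t (+ suc m) + x * Q ^ A * (h (A ℤ.⊖ m) * t (+ m))
      g-recursion⁺ A m = begin
        h₁ * (x ^ suc m * Q ^ (m ℕ.+ tri m))
          ≈⟨ *-congˡ (*-congˡ (^-homo-* Q m (tri m))) ⟩
        h₁ * (x * x ^ m * (Q ^ m * Q ^ tri m))
          ≈⟨ solve 5 (λ h x p q s → h :* (x :* p :* (q :* s)) := x :* p :* s :* (q :* h)) refl h₁ x (x ^ m) (Q ^ m) (Q ^ tri m) ⟩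
        x * x ^ m * Q ^ tri m * (Q ^ m * h₁)
          ≈⟨ *-congˡ (h-recursion A m) ⟩
        x * x ^ m * Q ^ tri m * (Q ^ m * h₀ + Q ^ A * h₁)
          ≈⟨ solve 7 (λ h₁ h₀ x p q s a → x :* p :* s :* (q :* h₀ :+ a :* h₁)
               := h₀ :* (x :* p :* (q :* s)) :+ x :* a :* (h₁ :* (p :* s))) refl
               h₁ h₀ x (x ^ m) (Q ^ m) (Q ^ tri m) (Q ^ A) ⟩
        h₀ * (x ^ suc m * (Q ^ m * Q ^ tri m)) + x * Q ^ A * (h₁ * t (+ m))
          ≈⟨ +-congʳ (*-congˡ (*-congˡ (^-homo-* Q m (tri m)))) ⟨
        h₀ * t (+ suc m) + x * Q ^ A * (h₁ * t (+ m)) ∎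
        where
        h₀ = h (A ℤ.⊖ suc m)
        h₁ = h (A ℤ.⊖ m)

      g-recursion : ∀ A n → g (suc A) n ≈ g A n + x * Q ^ A * g A (ℤ.pred n)
      g-recursion A (+ zero) rewrite ℕₚ.+-comm A 1 | ℕₚ.+-identityʳ A =
        ≡.subst (λ k → r (suc k) * (1# * 1#) ≈ r k * (1# * 1#) + x * Q ^ A * (r (suc k) * (x′ ^ 1 * Q ^ tri 1)))
          (ℕₚ.+-identityʳ A) (g-recursion⁻ A 0)
      g-recursion A -[1+ m ] rewrite ℕₚ.+-suc A (suc m) = g-recursion⁻ A (suc m)
      g-recursion A (+ suc m)
        rewrite ℤₚ.[1+m]⊖[1+n]≡m⊖n A m | ℤₚ.m-n≡m⊖n A m = g-recursion⁺ A m

      P-recursion : ∀ A → P (suc A) ≈ (1# + x * Q ^ A) * P A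
      P-recursion A = begin
        P (suc A)
          ≈⟨ bisum-cong (suc L) (g-recursion A) ⟩
        bisum (suc L) (λ n → g A n + x * Q ^ A * g A (ℤ.pred n))
          ≈⟨ bisum-+ (suc L) _ _ ⟩
        P A + bisum (suc L) (λ n → x * Q ^ A * g A (ℤ.pred n))
          ≈⟨ +-congˡ (bisum-*ˡ (suc L) (x * Q ^ A) (g A ∘ ℤ.pred)) ⟩
        P A + x * Q ^ A * bisum (suc L) (g A ∘ ℤ.pred)
          -- Composing with `ℤ.pred` widens the support by one, which is why the window is `suc L`
          -- and not `L`.
          ≈⟨ +-congˡ (*-congˡ (bisum-suc (suc L) (supported-shift (ℤ.- + 1) (g-supported A)))) ⟨
        P A + x * Q ^ A * bisum (suc L) (g A ∘ ℤ.pred ∘ ℤ.suc)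
          ≈⟨ +-congˡ (*-congˡ (bisum-cong (suc L) λ n → reflexive (≡.cong (g A) (ℤₚ.pred-suc n)))) ⟩
        P A + x * Q ^ A * P A
          ≈⟨ solve 2 (λ y p → p :+ y :* p := (con (+ 1) :+ y) :* p) refl (x * Q ^ A) (P A) ⟩
        (1# + x * Q ^ A) * P A ∎

      P-unfold : ∀ A → P A ≈ prod A (λ j → 1# + x * Q ^ j) * P 0
      P-unfold zero    = sym (*-identityˡ _)
      P-unfold (suc A) = trans (P-recursion A) (trans (*-congˡ (P-unfold A)) (sym (*-assoc _ _ _)))

      -- At A = 0 the factor `h` kills all n > 0 and leaves Euler's series in `x′`. The window has
      -- one index more than `E` has terms; its term vanishes.
      P0≈E : P 0 ≈ E x′
      P0≈E = begin
        bisum (suc L) (g 0)            ≈⟨ go L ⟩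
        usum (suc L) (a x′) + a x′ (suc L)  ≈⟨ +-congˡ (a-vanish x′ (ℕₚ.n≤1+n L)) ⟩
        usum (suc L) (a x′) + 0#       ≈⟨ +-identityʳ _ ⟩
        E x′                           ∎
        where
        go : ∀ N → bisum (suc N) (g 0) ≈ usum (suc (suc N)) (a x′)
        go zero    = solve 2 (λ p r → con (+ 0) :+ (con (+ 1) :* (con (+ 1) :* con (+ 1)) :+ r :* p)
          := con (+ 0) :+ con (+ 1) :* con (+ 1) :* con (+ 1) :+ p :* r) refl (x′ ^ 1 * Q ^ tri 1) (r 1)
        go (suc N) = +-cong (go N) (trans (+-congʳ (zeroˡ _)) (trans (+-identityˡ _) (*-comm _ _)))

    -- `P A` is the product over j < A of 1 + x Qʲ times the full product of 1 + x′ Qʲ. For large A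
    -- its weights `h (A - n)` all equal `r K` on the window, so it is also `r K` times the theta
    -- series, and `u K` cancels `r K`.
    jacobi : prod K (λ j → 1# - Q ^ suc j)
           * (prod K (λ j → 1# + x * Q ^ j) * prod K (λ j → 1# + x′ * Q ^ j))
           ≈ bisum (suc (suc K)) t
    jacobi = begin
      u K * (prod K X * prod K X′)   ≈⟨ *-congˡ (*-cong (prod-stable (ℕₚ.m≤m+n K (suc L)) X≈1) (euler x′)) ⟨
      u K * (prod M X * E x′)        ≈⟨ *-congˡ (*-congˡ P0≈E) ⟨
      u K * (prod M X * P 0)         ≈⟨ *-congˡ (P-unfold M) ⟨
      u K * P M                      ≈⟨ *-congˡ (bisum-cong-≤ (suc L) λ n n≤ → *-congʳ (h-stable n n≤)) ⟩
      u K * bisum (suc L) (λ n → r K * t n) ≈⟨ *-congˡ (bisum-*ˡ (suc L) (r K) t) ⟩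
      u K * (r K * bisum (suc L) t)  ≈⟨ *-assoc _ _ _ ⟨
      u K * r K * bisum (suc L) t    ≈⟨ *-congʳ (ur≈1 K) ⟩
      1# * bisum (suc L) t           ≈⟨ *-identityˡ _ ⟩
      bisum (suc L) t                ∎
      where
      -- Large enough for M - n ≥ K at every n in the window.
      M : ℕ
      M = K ℕ.+ suc L

      X X′ : ℕ → Carrier
      X  j = 1# + x * Q ^ j
      X′ j = 1# + x′ * Q ^ j

      X≈1 : ∀ j → K ≤ j → X j ≈ 1#
      X≈1 j K≤j = trans (+-congˡ (trans (*-congˡ (^-vanish Q^K≈0 K≤j)) (zeroʳ x))) (+-identityʳ 1#)

      h-stable : ∀ n → ∣ n ∣ ≤ suc L → h (+ M ℤ.- n) ≈ r K
      h-stable (+ n) n≤ rewrite ℤₚ.m-n≡m⊖n M n | ℤₚ.⊖-≥ (ℕₚ.≤-trans n≤ (ℕₚ.m≤n+m (suc L) K)) =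
        r-stable (ℕₚ.≤-trans (ℕₚ.m≤m+n K (suc L ℕ.∸ n)) (ℕₚ.≤-reflexive (≡.sym (ℕₚ.+-∸-assoc K n≤))))
      h-stable -[1+ n ] _ = r-stable (ℕₚ.≤-trans (ℕₚ.m≤m+n K (suc L)) (ℕₚ.m≤m+n M (suc n)))

-- Theta series with sign and products of two of them

module Theta {c ℓ} (R : CommutativeRing c ℓ) (q : CommutativeRing.Carrier R) (K : ℕ)
  (q^K≈0 : CommutativeRing._≈_ R (Exp._^_ (CommutativeRing.semiring R) q K) (CommutativeRing.0# R)) where

  open BilateralSum R
  open ThetaExponents
  open TripleProduct R

  open CommutativeRing R hiding (zero)
  open import Relation.Binary.Reasoning.Setoid setoid
  open IntegerSolver R using (solve; _:+_; _:*_; _:=_; con)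
  open Exp semiring using (_^_; ^-homo-*; ^-assocʳ; ^-congˡ)

  -- `s ^ ∣ n ∣` plays the part of sⁿ, since s² = 1 makes s its own inverse.
  term : Carrier → ℕ → ℕ → ℤ → Carrier
  term s c c′ n = s ^ ∣ n ∣ * q ^ ε c c′ n

  -- Ramanujan's f(s qᶜ, s qᶜ′) for s² = 1.
  theta : Carrier → ℕ → ℕ → Carrier
  theta s c c′ = bisum (suc (suc K)) (term s c c′)

  term-supported : ∀ s c c′ → 1 ≤ c ℕ.+ c′ → Supported (suc K) (term s c c′)
  term-supported s c c′ 1≤ n K<∣n∣ =
    trans (*-congˡ (^-vanish q^K≈0 (ℕₚ.≤-trans (ℕₚ.≤-pred (ℕₚ.≤-trans K<∣n∣ (tri-large ∣ n ∣))) (bound n)))) (zeroʳ _)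
    where
    tri≤ : ∀ b n → tri n ≤ b ℕ.+ (c ℕ.+ c′) ℕ.* tri n
    tri≤ b n = ℕₚ.≤-trans (ℕₚ.m≤n*m (tri n) (c ℕ.+ c′) {{ℕ.>-nonZero 1≤}}) (ℕₚ.m≤n+m _ b)

    bound : ∀ n → tri ∣ n ∣ ≤ ε c c′ n
    bound (+ n)    = tri≤ _ n
    bound -[1+ n ] = tri≤ _ (suc n)

  theta-extend : ∀ s c c′ {N} → 1 ≤ c ℕ.+ c′ → suc (suc K) ≤ N → bisum N (term s c c′) ≈ theta s c c′
  theta-extend s c c′ 1≤ K≤N =
    bisum-extend K≤N (supported-mono (ℕₚ.n≤1+n (suc K)) (term-supported s c c′ 1≤))

  theta-sym : ∀ s c c′ → 1 ≤ c ℕ.+ c′ → theta s c c′ ≈ theta s c′ c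
  theta-sym s c c′ 1≤ = begin
    bisum N (term s c c′)
      ≈⟨ bisum-neg N (supported-mono (ℕₚ.n≤1+n (suc K)) (term-supported s c c′ 1≤)) ⟨
    bisum N (term s c c′ ∘ ℤ.-_)
      ≡⟨⟩
    bisum N (λ n → s ^ ∣ ℤ.- n ∣ * q ^ ε c c′ (ℤ.- n))
      ≈⟨ bisum-cong N (λ n → reflexive (≡.cong₂ (λ i j → s ^ i * q ^ j) (ℤₚ.∣-i∣≡∣i∣ n) (ε-neg n))) ⟩
    bisum N (term s c′ c) ∎
    where
    N = suc (suc K)

    base : ∀ a b → a ℕ.* 0 ℕ.+ (a ℕ.+ b) ℕ.* 0 ≡ b ℕ.* 0 ℕ.+ (b ℕ.+ a) ℕ.* 0
    base = ℕ-solve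

    ε-neg : ∀ n → ε c c′ (ℤ.- n) ≡ ε c′ c n
    ε-neg (+ zero)  = base c c′
    ε-neg (+ suc n) = ≡.cong (λ p → c′ ℕ.* suc n ℕ.+ p ℕ.* tri (suc n)) (ℕₚ.+-comm c c′)
    ε-neg -[1+ n ]  = ≡.cong (λ p → c ℕ.* suc n ℕ.+ p ℕ.* tri (suc n)) (ℕₚ.+-comm c c′)

  -- The triple product at x = s qᶜ and x′ = s qᶜ′, whose product is q^(c + c′) because s² = 1.
  theta-jacobi : ∀ s c c′ → s * s ≈ 1# → 1 ≤ c ℕ.+ c′ →
    theta s c c′ ≈
      prod K (λ j → 1# - q ^ ((c ℕ.+ c′) ℕ.* suc j))
    * (prod K (λ j → 1# + s * q ^ (c ℕ.+ (c ℕ.+ c′) ℕ.* j))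
    *  prod K (λ j → 1# + s * q ^ (c′ ℕ.+ (c ℕ.+ c′) ℕ.* j)))
  theta-jacobi s c c′ s²≈1 1≤ = sym (begin
    _ ≈⟨ *-cong (prod-cong K λ j → +-congˡ (-‿cong (sym (^-assocʳ q p (suc j)))))
                (*-cong (prod-cong K (shifted c)) (prod-cong K (shifted c′))) ⟩
    _ ≈⟨ jacobi (s * q ^ c) (s * q ^ c′) Q xx′≈Q K Q^K≈0 ⟩
    bisum (suc (suc K)) _ ≈⟨ bisum-cong (suc (suc K)) t≈term ⟩
    theta s c c′ ∎)
    where
    p = c ℕ.+ c′
    Q = q ^ p

    Q^K≈0 : Q ^ K ≈ 0#
    Q^K≈0 = trans (^-assocʳ q p K) (^-vanish q^K≈0 (ℕₚ.m≤n*m K p {{ℕ.>-nonZero 1≤}}))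

    xx′≈Q : s * q ^ c * (s * q ^ c′) ≈ Q
    xx′≈Q = begin
      s * q ^ c * (s * q ^ c′)   ≈⟨ solve 3 (λ s a b → s :* a :* (s :* b) := s :* s :* (a :* b)) refl s (q ^ c) (q ^ c′) ⟩
      s * s * (q ^ c * q ^ c′)   ≈⟨ *-cong s²≈1 (sym (^-homo-* q c c′)) ⟩
      1# * q ^ p                 ≈⟨ *-identityˡ _ ⟩
      q ^ p                      ∎

    shifted : ∀ b j → 1# + s * q ^ (b ℕ.+ p ℕ.* j) ≈ 1# + s * q ^ b * Q ^ j
    shifted b j = +-congˡ (begin
      s * q ^ (b ℕ.+ p ℕ.* j)       ≈⟨ *-congˡ (^-homo-* q b (p ℕ.* j)) ⟩
      s * (q ^ b * q ^ (p ℕ.* j))   ≈⟨ *-congˡ (*-congˡ (^-assocʳ q p j)) ⟨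
      s * (q ^ b * Q ^ j)           ≈⟨ *-assoc _ _ _ ⟨
      s * q ^ b * Q ^ j             ∎)

    power : ∀ b n → (s * q ^ b) ^ n * Q ^ tri n ≈ s ^ n * q ^ (b ℕ.* n ℕ.+ p ℕ.* tri n)
    power b n = begin
      (s * q ^ b) ^ n * Q ^ tri n
        ≈⟨ *-cong (CommutativeExp.^-distrib-* commutativeSemiring s (q ^ b) n) (^-assocʳ q p (tri n)) ⟩
      s ^ n * (q ^ b) ^ n * q ^ (p ℕ.* tri n)
        ≈⟨ *-congʳ (*-congˡ (^-assocʳ q b n)) ⟩
      s ^ n * q ^ (b ℕ.* n) * q ^ (p ℕ.* tri n)
        ≈⟨ trans (*-assoc _ _ _) (*-congˡ (sym (^-homo-* q (b ℕ.* n) (p ℕ.* tri n)))) ⟩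
      s ^ n * q ^ (b ℕ.* n ℕ.+ p ℕ.* tri n) ∎

    t≈term : ∀ n → t (s * q ^ c) (s * q ^ c′) Q xx′≈Q K Q^K≈0 n ≈ term s c c′ n
    t≈term (+ n)    = power c n
    t≈term -[1+ n ] = power c′ (suc n)

  1^ : ∀ n → 1# ^ n ≈ 1#
  1^ zero    = refl
  1^ (suc n) = trans (*-identityˡ _) (1^ n)

  sign-suc : ∀ s → s * s ≈ 1# → ∀ n → s ^ ∣ ℤ.suc n ∣ ≈ s * s ^ ∣ n ∣
  sign-suc s s²≈1 (+ n)          = refl
  sign-suc s s²≈1 -[1+ zero ]    = sym (trans (*-congˡ (*-identityʳ s)) s²≈1)
  sign-suc s s²≈1 -[1+ suc n ]   = begin
    s ^ suc n              ≈⟨ *-identityˡ _ ⟨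
    1# * s ^ suc n         ≈⟨ *-congʳ s²≈1 ⟨
    s * s * s ^ suc n      ≈⟨ *-assoc _ _ _ ⟩
    s * (s * s ^ suc n)    ∎

  -- ∣n∣ is not additive, but its parity is, and only parity matters when s² = 1.
  sign-+ : ∀ s → s * s ≈ 1# → ∀ m n → s ^ ∣ m ℤ.+ n ∣ ≈ s ^ ∣ m ∣ * s ^ ∣ n ∣
  sign-+ s s²≈1 (+ zero) n = trans (reflexive (≡.cong (λ i → s ^ ∣ i ∣) (ℤₚ.+-identityˡ n))) (sym (*-identityˡ _))
  sign-+ s s²≈1 (+ suc m) n = begin
    s ^ ∣ + suc m ℤ.+ n ∣            ≡⟨ ≡.cong (λ i → s ^ ∣ i ∣) (ℤₚ.+-assoc (+ 1) (+ m) n) ⟩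
    s ^ ∣ ℤ.suc (+ m ℤ.+ n) ∣        ≈⟨ sign-suc s s²≈1 (+ m ℤ.+ n) ⟩
    s * s ^ ∣ + m ℤ.+ n ∣            ≈⟨ *-congˡ (sign-+ s s²≈1 (+ m) n) ⟩
    s * (s ^ m * s ^ ∣ n ∣)          ≈⟨ *-assoc _ _ _ ⟨
    s * s ^ m * s ^ ∣ n ∣            ∎
  sign-+ s s²≈1 -[1+ m ] n = begin
    s ^ ∣ i ∣                        ≈⟨ *-identityˡ _ ⟨
    1# * s ^ ∣ i ∣                   ≈⟨ *-congʳ s²≈1 ⟨
    s * s * s ^ ∣ i ∣                ≈⟨ *-assoc _ _ _ ⟩
    s * (s * s ^ ∣ i ∣)              ≈⟨ *-congˡ (sign-suc s s²≈1 i) ⟨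
    s * s ^ ∣ ℤ.suc i ∣              ≡⟨ ≡.cong (λ j → s * s ^ ∣ j ∣) (up m) ⟩
    s * s ^ ∣ ℤ.- (+ m) ℤ.+ n ∣      ≈⟨ *-congˡ (previous m) ⟩
    s * (s ^ m * s ^ ∣ n ∣)          ≈⟨ *-assoc _ _ _ ⟨
    s ^ suc m * s ^ ∣ n ∣            ∎
    where
    i = -[1+ m ] ℤ.+ n

    shift : ∀ m n → + 1 ℤ.+ (ℤ.- (+ 1 ℤ.+ m) ℤ.+ n) ≡ ℤ.- m ℤ.+ n
    shift = ℤ-solve

    up : ∀ m → ℤ.suc (-[1+ m ] ℤ.+ n) ≡ ℤ.- (+ m) ℤ.+ n
    up m = shift (+ m) n

    previous : ∀ m → s ^ ∣ ℤ.- (+ m) ℤ.+ n ∣ ≈ s ^ m * s ^ ∣ n ∣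
    previous zero    = sign-+ s s²≈1 (+ zero) n
    previous (suc m) = sign-+ s s²≈1 -[1+ m ] n

  -- The two indices add up to the even number 2r.
  sign-double : ∀ s → s * s ≈ 1# → ∀ r k → s ^ ∣ r ℤ.+ k ∣ * s ^ ∣ r ℤ.- k ∣ ≈ 1#
  sign-double s s²≈1 r k = begin
    s ^ ∣ r ℤ.+ k ∣ * s ^ ∣ r ℤ.- k ∣       ≈⟨ sign-+ s s²≈1 (r ℤ.+ k) (r ℤ.- k) ⟨
    s ^ ∣ r ℤ.+ k ℤ.+ (r ℤ.- k) ∣           ≡⟨ ≡.cong (λ i → s ^ ∣ i ∣) (twice r k) ⟩
    s ^ ∣ r ℤ.+ r ∣                         ≈⟨ sign-+ s s²≈1 r r ⟩
    s ^ ∣ r ∣ * s ^ ∣ r ∣                   ≈⟨ CommutativeExp.^-distrib-* commutativeSemiring s s ∣ r ∣ ⟨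
    (s * s) ^ ∣ r ∣                         ≈⟨ ^-congˡ ∣ r ∣ s²≈1 ⟩
    1# ^ ∣ r ∣                              ≈⟨ 1^ ∣ r ∣ ⟩
    1#                                      ∎
    where
    twice : ∀ r k → r ℤ.+ k ℤ.+ (r ℤ.- k) ≡ r ℤ.+ r
    twice = ℤ-solve

  module _ (u v w : ℕ) (1≤u+v+w : 1 ≤ u ℕ.+ v ℕ.+ w) where
    open Rotation u v w

    -- After rotation the summands factor into a function of r and one of k. The signs cancel where
    -- m + n is even and leave a single `s` where it is odd, so the four series on the right are
    -- independent of `s`.
    theta-product : ∀ s → s * s ≈ 1# →
      theta s c₁ c₁′ * theta s c₂ c₂′ ≈
      theta 1# e₁ e₁′ * theta 1# e₂ e₂′ + s * q ^ w * (theta 1# o₁ o₁′ * theta 1# o₂ o₂′)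
    theta-product s s²≈1 = begin
      theta s c₁ c₁′ * theta s c₂ c₂′
        ≈⟨ bisum-* N N (term s c₁ c₁′) (term s c₂ c₂′) ⟨
      bisum N (λ m → bisum N (F m))
        ≈⟨ bisum-rotate N F F-supported ⟩
      bisum L (λ r → bisum P λ k → F (r ℤ.+ k) (r ℤ.- k))
      + bisum L (λ r → bisum P λ k → F (r ℤ.+ k) (ℤ.suc (r ℤ.- k)))
        ≈⟨ +-cong (bisum-cong L λ r → bisum-cong P (even r)) (bisum-cong L λ r → bisum-cong P (odd r)) ⟩
      bisum L (λ r → bisum P λ k → T e₁ e₁′ r * T e₂ e₂′ k)
      + bisum L (λ r → bisum P λ k → s * q ^ w * T o₁ o₁′ r * T o₂ o₂′ k)
        ≈⟨ +-cong (bisum-* L P _ _) (trans (bisum-* L P _ _) (*-congʳ (bisum-*ˡ L (s * q ^ w) (T o₁ o₁′)))) ⟩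
      bisum L (T e₁ e₁′) * bisum P (T e₂ e₂′)
      + s * q ^ w * bisum L (T o₁ o₁′) * bisum P (T o₂ o₂′)
        ≈⟨ +-cong (*-cong (theta-extend 1# e₁ e₁′ (1≤sum₂ (sum-e₁ u v w)) N≤L) (theta-extend 1# e₂ e₂′ (1≤sum₂ (sum-e₂ u v w)) N≤P))
             (*-cong (*-congˡ (theta-extend 1# o₁ o₁′ (1≤sum₂ (sum-o₁ u v w)) N≤L)) (theta-extend 1# o₂ o₂′ (1≤sum₂ (sum-o₂ u v w)) N≤P)) ⟩
      theta 1# e₁ e₁′ * theta 1# e₂ e₂′ + s * q ^ w * theta 1# o₁ o₁′ * theta 1# o₂ o₂′
        ≈⟨ +-congˡ (*-assoc _ _ _) ⟩
      theta 1# e₁ e₁′ * theta 1# e₂ e₂′ + s * q ^ w * (theta 1# o₁ o₁′ * theta 1# o₂ o₂′) ∎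
      where
      N L P : ℕ
      N = suc (suc K)
      L = N ℕ.+ N
      P = 5 ℕ.* N

      N≤L : N ≤ L
      N≤L = ℕₚ.m≤m+n N N

      N≤P : N ≤ P
      N≤P = ℕₚ.m≤n*m N 5

      T : ℕ → ℕ → ℤ → Carrier
      T = term 1#

      F : ℤ → ℤ → Carrier
      F m n = term s c₁ c₁′ m * term s c₂ c₂′ n

      1≤sum₁ : ∀ {p} → u ℕ.+ v ℕ.+ w ℕ.+ (u ℕ.+ v ℕ.+ w) ≡ p → 1 ≤ p
      1≤sum₁ ≡.refl = ℕₚ.≤-trans 1≤u+v+w (ℕₚ.m≤m+n _ _)

      1≤sum₂ : ∀ {p} → 4 ℕ.* (u ℕ.+ v ℕ.+ w) ≡ p → 1 ≤ p
      1≤sum₂ ≡.refl = ℕₚ.≤-trans 1≤u+v+w (ℕₚ.m≤n*m _ 4)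

      sum-c₁ : ∀ u v w → u ℕ.+ v ℕ.+ w ℕ.+ (u ℕ.+ v ℕ.+ w) ≡ (w ℕ.+ (v ℕ.+ v)) ℕ.+ (w ℕ.+ (u ℕ.+ u))
      sum-c₁ = ℕ-solve

      sum-c₂ : ∀ u v w → u ℕ.+ v ℕ.+ w ℕ.+ (u ℕ.+ v ℕ.+ w) ≡ (w) ℕ.+ (w ℕ.+ (u ℕ.+ v ℕ.+ (u ℕ.+ v)))
      sum-c₂ = ℕ-solve

      sum-e₁ : ∀ u v w → 4 ℕ.* (u ℕ.+ v ℕ.+ w) ≡ (v ℕ.+ w ℕ.+ (v ℕ.+ w)) ℕ.+ (u ℕ.+ u ℕ.+ v ℕ.+ w ℕ.+ (u ℕ.+ u ℕ.+ v ℕ.+ w))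
      sum-e₁ = ℕ-solve

      sum-e₂ : ∀ u v w → 4 ℕ.* (u ℕ.+ v ℕ.+ w) ≡ (u ℕ.+ v ℕ.+ v ℕ.+ w ℕ.+ (u ℕ.+ v ℕ.+ v ℕ.+ w)) ℕ.+ (u ℕ.+ w ℕ.+ (u ℕ.+ w))
      sum-e₂ = ℕ-solve

      sum-o₁ : ∀ u v w → 4 ℕ.* (u ℕ.+ v ℕ.+ w) ≡ (u ℕ.+ v ℕ.+ w ℕ.+ (v ℕ.+ w) ℕ.+ (u ℕ.+ v ℕ.+ w ℕ.+ (v ℕ.+ w))) ℕ.+ (u ℕ.+ u)
      sum-o₁ = ℕ-solve

      sum-o₂ : ∀ u v w → 4 ℕ.* (u ℕ.+ v ℕ.+ w) ≡ (v ℕ.+ v) ℕ.+ (u ℕ.+ v ℕ.+ w ℕ.+ (u ℕ.+ w) ℕ.+ (u ℕ.+ v ℕ.+ w ℕ.+ (u ℕ.+ w)))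
      sum-o₂ = ℕ-solve

      F-supported : ∀ m n → N ≤ ∣ m ∣ ⊎ N ≤ ∣ n ∣ → F m n ≈ 0#
      F-supported m n (inj₁ N≤m) = trans
        (*-congʳ (term-supported s c₁ c₁′ (1≤sum₁ (sum-c₁ u v w)) m (ℕₚ.≤-trans (ℕₚ.n≤1+n _) N≤m))) (zeroˡ _)
      F-supported m n (inj₂ N≤n) = trans
        (*-congˡ (term-supported s c₂ c₂′ (1≤sum₁ (sum-c₂ u v w)) n (ℕₚ.≤-trans (ℕₚ.n≤1+n _) N≤n))) (zeroʳ _)

      T≈ : ∀ a a′ n → q ^ ε a a′ n ≈ T a a′ n
      T≈ a a′ n = sym (trans (*-congʳ (1^ ∣ n ∣)) (*-identityˡ _))

      combine : ∀ m n {a a′ b b′ x} r k i → ε c₁ c₁′ m ℕ.+ ε c₂ c₂′ n ≡ ε a a′ r ℕ.+ ε b b′ k ℕ.+ i →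
        s ^ ∣ m ∣ * s ^ ∣ n ∣ ≈ x → F m n ≈ x * q ^ i * T a a′ r * T b b′ k
      combine m n {a} {a′} {b} {b′} {x} r k i exponents signs = begin
        s ^ ∣ m ∣ * q ^ α * (s ^ ∣ n ∣ * q ^ β)
          ≈⟨ solve 4 (λ s t a b → s :* a :* (t :* b) := s :* t :* (a :* b)) refl (s ^ ∣ m ∣) (s ^ ∣ n ∣) (q ^ α) (q ^ β) ⟩
        s ^ ∣ m ∣ * s ^ ∣ n ∣ * (q ^ α * q ^ β)
          ≈⟨ *-cong signs (sym (^-homo-* q α β)) ⟩
        x * q ^ (α ℕ.+ β)
          ≡⟨ ≡.cong (λ e → x * q ^ e) exponents ⟩
        x * q ^ (ε a a′ r ℕ.+ ε b b′ k ℕ.+ i)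
          ≈⟨ *-congˡ (trans (^-homo-* q (ε a a′ r ℕ.+ ε b b′ k) i) (*-congʳ (^-homo-* q (ε a a′ r) (ε b b′ k)))) ⟩
        x * (q ^ ε a a′ r * q ^ ε b b′ k * q ^ i)
          ≈⟨ solve 4 (λ x a b c → x :* (a :* b :* c) := x :* c :* a :* b) refl x (q ^ ε a a′ r) (q ^ ε b b′ k) (q ^ i) ⟩
        x * q ^ i * q ^ ε a a′ r * q ^ ε b b′ k
          ≈⟨ *-cong (*-congˡ (T≈ a a′ r)) (T≈ b b′ k) ⟩
        x * q ^ i * T a a′ r * T b b′ k ∎
        where
        α = ε c₁ c₁′ m
        β = ε c₂ c₂′ n

      even : ∀ r k → F (r ℤ.+ k) (r ℤ.- k) ≈ T e₁ e₁′ r * T e₂ e₂′ k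
      even r k = trans
        (combine (r ℤ.+ k) (r ℤ.- k) r k 0 (ε-even r k) (sign-double s s²≈1 r k))
        (*-congʳ (trans (*-congʳ (*-identityˡ 1#)) (*-identityˡ _)))

      odd : ∀ r k → F (r ℤ.+ k) (ℤ.suc (r ℤ.- k)) ≈ s * q ^ w * T o₁ o₁′ r * T o₂ o₂′ k
      odd r k = combine (r ℤ.+ k) (ℤ.suc (r ℤ.- k)) r k w (ε-odd r k) (begin
        s ^ ∣ r ℤ.+ k ∣ * s ^ ∣ ℤ.suc (r ℤ.- k) ∣     ≈⟨ *-congˡ (sign-suc s s²≈1 (r ℤ.- k)) ⟩
        s ^ ∣ r ℤ.+ k ∣ * (s * s ^ ∣ r ℤ.- k ∣)       ≈⟨ solve 3 (λ s a b → a :* (s :* b) := s :* (a :* b)) refl s _ _ ⟩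
        s * (s ^ ∣ r ℤ.+ k ∣ * s ^ ∣ r ℤ.- k ∣)       ≈⟨ *-congˡ (sign-double s s²≈1 r k) ⟩
        s * 1#                                       ≈⟨ *-identityʳ s ⟩
        s                                            ∎)

-- Units and cancellation

module EtaAlgebra {c ℓ} (R : CommutativeRing c ℓ) where

  open IntegerSolver R

  open CommutativeRing R hiding (zero)
  open import Relation.Binary.Reasoning.Setoid setoid
  open Exp semiring using (_^_)

  Unit : Carrier → Set _
  Unit x = ∃[ y ] x * y ≈ 1#

  unit-* : ∀ {x y} → Unit x → Unit y → Unit (x * y)
  unit-* {x} {y} (x⁻¹ , xx⁻¹≈1) (y⁻¹ , yy⁻¹≈1) = x⁻¹ * y⁻¹ , (begin
    x * y * (x⁻¹ * y⁻¹)     ≈⟨ solve 4 (λ x y a b → x :* y :* (a :* b) := x :* a :* (y :* b)) refl x y x⁻¹ y⁻¹ ⟩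
    x * x⁻¹ * (y * y⁻¹)     ≈⟨ *-cong xx⁻¹≈1 yy⁻¹≈1 ⟩
    1# * 1#                 ≈⟨ *-identityˡ 1# ⟩
    1#                      ∎)

  unit-^ : ∀ {x} n → Unit x → Unit (x ^ n)
  unit-^ zero    _      = 1# , *-identityˡ 1#
  unit-^ (suc n) unit-x = unit-* unit-x (unit-^ n unit-x)

  unit-cancel : ∀ {x y z} → Unit x → x * y ≈ x * z → y ≈ z
  unit-cancel {x} {y} {z} (x⁻¹ , xx⁻¹≈1) xy≈xz = begin
    y               ≈⟨ expand y ⟩
    x⁻¹ * (x * y)   ≈⟨ *-congˡ xy≈xz ⟩
    x⁻¹ * (x * z)   ≈⟨ expand z ⟨
    z               ∎
    where
    expand : ∀ y → y ≈ x⁻¹ * (x * y)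
    expand y = begin
      y               ≈⟨ *-identityˡ y ⟨
      1# * y          ≈⟨ *-congʳ xx⁻¹≈1 ⟨
      x * x⁻¹ * y     ≈⟨ solve 3 (λ x a y → x :* a :* y := a :* (x :* y)) refl x x⁻¹ y ⟩
      x⁻¹ * (x * y)   ∎

  -- Plücker relations between products of theta functions

  -- Specialisations of the Plücker relation among the 2 × 2 minors of a
  -- 2 × 4 matrix.  Here Mⱼ and Pⱼ stand for Σ (∓1)ⁿ q^(3n² + jn) and bⱼ for
  -- Σ q^(6n² + 2jn).
  module Plücker (q b₀ b₁ b₂ b₃ : Carrier)
    {M₁² M₂² M₂M₀ P₀² P₁² P₂² P₃² P₂P₀ P₃P₁ : Carrier}
    (hM₁ : M₁² ≈ b₀ * b₁ - q * q * (b₃ * b₂))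
    (hM₂ : M₂² ≈ b₀ * b₂ - q * (b₃ * b₁))
    (hM₂₀ : M₂M₀ ≈ b₁ * b₁ - q * (b₂ * b₂))
    (hP₀ : P₀² ≈ b₀ * b₀ + q * q * q * (b₃ * b₃))
    (hP₁ : P₁² ≈ b₀ * b₁ + q * q * (b₃ * b₂))
    (hP₂ : P₂² ≈ b₀ * b₂ + q * (b₃ * b₁))
    (hP₃ : P₃² ≈ b₀ * b₃ + b₃ * b₀)
    (hP₂₀ : P₂P₀ ≈ b₁ * b₁ + q * (b₂ * b₂))
    (hP₃₁ : P₃P₁ ≈ b₁ * b₂ + b₂ * b₁) where

    -- Columns (b₀, q²b₃), (b₀, -q²b₃), (b₂, b₁), (b₁, qb₂). All three products of complementary
    -- minors contain a factor q, which is dropped.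
    plücker₁ : M₁² * P₂² ≈ M₂² * P₁² + q * P₃² * M₂M₀
    plücker₁ = begin
      M₁² * P₂² ≈⟨ *-cong hM₁ hP₂ ⟩
      _ ≈⟨ solve 5 (λ q b₀ b₁ b₂ b₃ →
             (b₀ :* b₁ :- q :* q :* (b₃ :* b₂)) :* (b₀ :* b₂ :+ q :* (b₃ :* b₁))
             := (b₀ :* b₂ :- q :* (b₃ :* b₁)) :* (b₀ :* b₁ :+ q :* q :* (b₃ :* b₂))
                :+ q :* (b₀ :* b₃ :+ b₃ :* b₀) :* (b₁ :* b₁ :- q :* (b₂ :* b₂))) refl q b₀ b₁ b₂ b₃ ⟩
      _ ≈⟨ +-cong (*-cong hM₂ hP₁) (*-cong (*-congˡ hP₃) hM₂₀) ⟨
      M₂² * P₁² + q * P₃² * M₂M₀ ∎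

    -- Columns (b₀, -q²b₃), (b₂, b₁), (-b₂, b₁), (b₁, qb₂).
    plücker₂ : P₁² * P₂P₀ ≈ M₁² * M₂M₀ + q * P₃P₁ * P₂²
    plücker₂ = begin
      P₁² * P₂P₀ ≈⟨ *-cong hP₁ hP₂₀ ⟩
      _ ≈⟨ solve 5 (λ q b₀ b₁ b₂ b₃ →
             (b₀ :* b₁ :+ q :* q :* (b₃ :* b₂)) :* (b₁ :* b₁ :+ q :* (b₂ :* b₂))
             := (b₀ :* b₁ :- q :* q :* (b₃ :* b₂)) :* (b₁ :* b₁ :- q :* (b₂ :* b₂))
                :+ q :* (b₁ :* b₂ :+ b₂ :* b₁) :* (b₀ :* b₂ :+ q :* (b₃ :* b₁))) refl q b₀ b₁ b₂ b₃ ⟩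
      _ ≈⟨ +-cong (*-cong hM₁ hM₂₀) (*-cong (*-congˡ hP₃₁) hP₂) ⟨
      M₁² * M₂M₀ + q * P₃P₁ * P₂² ∎

    -- The preceding relation under b₃ ↦ -b₃, which exchanges M₁² with P₁² and M₂² with P₂².
    plücker₃ : M₁² * P₂P₀ ≈ P₁² * M₂M₀ + q * P₃P₁ * M₂²
    plücker₃ = begin
      M₁² * P₂P₀ ≈⟨ *-cong hM₁ hP₂₀ ⟩
      _ ≈⟨ solve 5 (λ q b₀ b₁ b₂ b₃ →
             (b₀ :* b₁ :- q :* q :* (b₃ :* b₂)) :* (b₁ :* b₁ :+ q :* (b₂ :* b₂))
             := (b₀ :* b₁ :+ q :* q :* (b₃ :* b₂)) :* (b₁ :* b₁ :- q :* (b₂ :* b₂))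
                :+ q :* (b₁ :* b₂ :+ b₂ :* b₁) :* (b₀ :* b₂ :- q :* (b₃ :* b₁))) refl q b₀ b₁ b₂ b₃ ⟩
      _ ≈⟨ +-cong (*-cong hP₁ hM₂₀) (*-cong (*-congˡ hP₃₁) hM₂) ⟨
      P₁² * M₂M₀ + q * P₃P₁ * M₂² ∎

    -- Columns (b₀, q²b₃), (-qb₃, b₀), (b₂, b₁), (b₁, qb₂).
    plücker₄ : M₁² * P₁² ≈ q * (M₂² * P₂²) + P₀² * M₂M₀
    plücker₄ = begin
      M₁² * P₁² ≈⟨ *-cong hM₁ hP₁ ⟩
      _ ≈⟨ solve 5 (λ q b₀ b₁ b₂ b₃ →
             (b₀ :* b₁ :- q :* q :* (b₃ :* b₂)) :* (b₀ :* b₁ :+ q :* q :* (b₃ :* b₂))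
             := q :* ((b₀ :* b₂ :- q :* (b₃ :* b₁)) :* (b₀ :* b₂ :+ q :* (b₃ :* b₁)))
                :+ (b₀ :* b₀ :+ q :* q :* q :* (b₃ :* b₃)) :* (b₁ :* b₁ :- q :* (b₂ :* b₂))) refl q b₀ b₁ b₂ b₃ ⟩
      _ ≈⟨ +-cong (*-congˡ (*-cong hM₂ hP₂)) (*-cong hP₀ hM₂₀) ⟨
      q * (M₂² * P₂²) + P₀² * M₂M₀ ∎

  -- The Hauptmodul and the eta quotients linear in it

  2# 3# 4# : Carrier
  2# = 1# + 1#
  3# = 2# + 1#
  4# = 3# + 1#

  module Parametrisation (q A B C D G H T : Carrier)
    (unit-A : Unit A) (unit-D : Unit D)
    (ACD≈1 : A * C * D ≈ 1#) (HTG≈1 : H * T * G ≈ 1#)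
    (p₁ : B ^ 2 * C ^ 2 ≈ A ^ 2 * D ^ 2 + q * (4# * G ^ 4) * (A * H ^ 2))
    (p₂ : D ^ 2 * (C * T ^ 2) ≈ B ^ 2 * (A * H ^ 2) + q * (2# * G ^ 2 * D) * C ^ 2)
    (p₃ : B ^ 2 * (C * T ^ 2) ≈ D ^ 2 * (A * H ^ 2) + q * (2# * G ^ 2 * D) * A ^ 2)
    (p₄ : B ^ 2 * D ^ 2 ≈ q * (A ^ 2 * C ^ 2) + T ^ 4 * (A * H ^ 2))
    where

    -- For the residue-class products this is q f₂³f₃³f₁₂⁶ / (f₁f₄²f₆⁹).
    y : Carrier
    y = q * (G ^ 4 * (H ^ 2 * (A * C ^ 2)))

    private
      unit² : ∀ {e} → e ≈ 1# → ∀ x → x * e ^ 2 ≈ x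
      unit² {e} e≈1 x = trans (*-congˡ (trans (*-cong e≈1 (*-congʳ e≈1))
        (solve 0 (con (+ 1) :* (con (+ 1) :* con (+ 1)) := con (+ 1)) refl))) (*-identityʳ x)

      acd : Carrier
      acd = A * C * D

      htg : Carrier
      htg = H * T * G

    -- Multiplying by (ACD)² = 1 produces the C² contained in `y`.
    qG⁴H² : q * (G ^ 4 * H ^ 2) ≈ A * D ^ 2 * y
    qG⁴H² = begin
      q * (G ^ 4 * H ^ 2)            ≈⟨ unit² ACD≈1 _ ⟨
      q * (G ^ 4 * H ^ 2) * acd ^ 2
        ≈⟨ solve 6 (λ q A C D G H →
             q :* (G :^ 4 :* H :^ 2) :* (A :* C :* D) :^ 2
             := A :* D :^ 2 :* (q :* (G :^ 4 :* (H :^ 2 :* (A :* C :^ 2))))) refl q A C D G H ⟩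
      A * D ^ 2 * y                  ∎

    -- `p₁` times A²D²: the left side is B²(ACD)², and the last term becomes 4A⁴D⁴y.
    B² : B ^ 2 ≈ A ^ 4 * D ^ 4 * (1# + 4# * y)
    B² = begin
      B ^ 2                               ≈⟨ unit² ACD≈1 _ ⟨
      B ^ 2 * acd ^ 2
        ≈⟨ solve 4 (λ A B C D → B :^ 2 :* (A :* C :* D) :^ 2
             := A :^ 2 :* D :^ 2 :* (B :^ 2 :* C :^ 2)) refl A B C D ⟩
      A ^ 2 * D ^ 2 * (B ^ 2 * C ^ 2)     ≈⟨ *-congˡ p₁ ⟩
      A ^ 2 * D ^ 2 * (A ^ 2 * D ^ 2 + q * (4# * G ^ 4) * (A * H ^ 2))
        ≈⟨ solve 5 (λ q A D G H →
             A :^ 2 :* D :^ 2 :* (A :^ 2 :* D :^ 2 :+ q :* (con (+ 4) :* G :^ 4) :* (A :* H :^ 2))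
             := A :^ 4 :* D :^ 4 :+ A :^ 3 :* D :^ 2 :* con (+ 4) :* (q :* (G :^ 4 :* H :^ 2))) refl q A D G H ⟩
      A ^ 4 * D ^ 4 + A ^ 3 * D ^ 2 * 4# * (q * (G ^ 4 * H ^ 2))
        ≈⟨ +-congˡ (*-congˡ qG⁴H²) ⟩
      A ^ 4 * D ^ 4 + A ^ 3 * D ^ 2 * 4# * (A * D ^ 2 * y)
        ≈⟨ solve 3 (λ A D y → A :^ 4 :* D :^ 4 :+ A :^ 3 :* D :^ 2 :* con (+ 4) :* (A :* D :^ 2 :* y)
             := A :^ 4 :* D :^ 4 :* (con (+ 1) :+ con (+ 4) :* y)) refl A D y ⟩
      A ^ 4 * D ^ 4 * (1# + 4# * y) ∎

    -- `p₂` times AH²G²: the left side is D(ACD)(HTG)², which collapses to D, and the last term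
    -- becomes 2Dy.
    A²B²H⁴G² : A ^ 2 * B ^ 2 * (H ^ 4 * G ^ 2) ≈ D * (1# - 2# * y)
    A²B²H⁴G² = begin
      A ^ 2 * B ^ 2 * (H ^ 4 * G ^ 2)
        ≈⟨ solve 7 (λ q A B C D G H →
             A :^ 2 :* B :^ 2 :* (H :^ 4 :* G :^ 2)
             := A :* H :^ 2 :* G :^ 2 :* (B :^ 2 :* (A :* H :^ 2) :+ q :* (con (+ 2) :* G :^ 2 :* D) :* C :^ 2)
                :- D :* (con (+ 2) :* (q :* (G :^ 4 :* (H :^ 2 :* (A :* C :^ 2)))))) refl q A B C D G H ⟩
      A * H ^ 2 * G ^ 2 * (B ^ 2 * (A * H ^ 2) + q * (2# * G ^ 2 * D) * C ^ 2) - D * (2# * y)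
        ≈⟨ +-congʳ (*-congˡ p₂) ⟨
      A * H ^ 2 * G ^ 2 * (D ^ 2 * (C * T ^ 2)) - D * (2# * y)
        ≈⟨ +-congʳ (solve 6 (λ A C D G H T →
             A :* H :^ 2 :* G :^ 2 :* (D :^ 2 :* (C :* T :^ 2))
             := D :* (A :* C :* D) :* (H :* T :* G) :^ 2) refl A C D G H T) ⟩
      D * acd * htg ^ 2 - D * (2# * y)
        ≈⟨ +-congʳ (trans (unit² HTG≈1 _) (*-congˡ ACD≈1)) ⟩
      D * 1# - D * (2# * y)
        ≈⟨ solve 2 (λ D y → D :* con (+ 1) :- D :* (con (+ 2) :* y) := D :* (con (+ 1) :- con (+ 2) :* y)) refl D y ⟩
      D * (1# - 2# * y) ∎

    -- `p₄` times H²G⁴: the term with T⁴ is A(HTG)⁴, the other one is Ay.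
    B²D²H²G⁴ : B ^ 2 * D ^ 2 * (H ^ 2 * G ^ 4) ≈ A * (1# + y)
    B²D²H²G⁴ = begin
      B ^ 2 * D ^ 2 * (H ^ 2 * G ^ 4)
        ≈⟨ *-congʳ p₄ ⟩
      (q * (A ^ 2 * C ^ 2) + T ^ 4 * (A * H ^ 2)) * (H ^ 2 * G ^ 4)
        ≈⟨ solve 6 (λ q A C G H T →
             (q :* (A :^ 2 :* C :^ 2) :+ T :^ 4 :* (A :* H :^ 2)) :* (H :^ 2 :* G :^ 4)
             := A :* (H :* T :* G) :^ 2 :* (H :* T :* G) :^ 2
                :+ A :* (q :* (G :^ 4 :* (H :^ 2 :* (A :* C :^ 2))))) refl q A C G H T ⟩
      A * htg ^ 2 * htg ^ 2 + A * y
        ≈⟨ +-congʳ (trans (unit² HTG≈1 _) (unit² HTG≈1 _)) ⟩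
      A + A * y
        ≈⟨ solve 2 (λ A y → A :+ A :* y := A :* (con (+ 1) :+ y)) refl A y ⟩
      A * (1# + y) ∎

    -- `p₃` times H²G², with B² replaced by its value, so that 1 + 2y arises as (1 + 4y) - 2y. The
    -- common factor AD² is cancelled.
    H⁴G² : H ^ 4 * G ^ 2 ≈ A ^ 2 * D * (1# + 2# * y)
    H⁴G² = unit-cancel (unit-* (unit-* unit-D unit-D) unit-A) (begin
      D * D * A * (H ^ 4 * G ^ 2)
        ≈⟨ solve 5 (λ q A D G H →
             D :* D :* A :* (H :^ 4 :* G :^ 2)
             := H :^ 2 :* G :^ 2 :* (D :^ 2 :* (A :* H :^ 2) :+ q :* (con (+ 2) :* G :^ 2 :* D) :* A :^ 2)
                :- con (+ 2) :* D :* A :^ 2 :* (q :* (G :^ 4 :* H :^ 2))) refl q A D G H ⟩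
      H ^ 2 * G ^ 2 * (D ^ 2 * (A * H ^ 2) + q * (2# * G ^ 2 * D) * A ^ 2)
      - 2# * D * A ^ 2 * (q * (G ^ 4 * H ^ 2))
        ≈⟨ +-cong (*-congˡ (sym p₃)) (-‿cong (*-congˡ qG⁴H²)) ⟩
      H ^ 2 * G ^ 2 * (B ^ 2 * (C * T ^ 2)) - 2# * D * A ^ 2 * (A * D ^ 2 * y)
        ≈⟨ +-congʳ (solve 5 (λ B C G H T → H :^ 2 :* G :^ 2 :* (B :^ 2 :* (C :* T :^ 2))
             := C :* B :^ 2 :* (H :* T :* G) :^ 2) refl B C G H T) ⟩
      C * B ^ 2 * htg ^ 2 - 2# * D * A ^ 2 * (A * D ^ 2 * y)
        ≈⟨ +-congʳ (trans (unit² HTG≈1 _) (*-congˡ B²)) ⟩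
      C * (A ^ 4 * D ^ 4 * (1# + 4# * y)) - 2# * D * A ^ 2 * (A * D ^ 2 * y)
        ≈⟨ +-congʳ (solve 4 (λ A C D y → C :* (A :^ 4 :* D :^ 4 :* (con (+ 1) :+ con (+ 4) :* y))
             := A :^ 3 :* D :^ 3 :* (con (+ 1) :+ con (+ 4) :* y) :* (A :* C :* D)) refl A C D y) ⟩
      A ^ 3 * D ^ 3 * (1# + 4# * y) * acd - 2# * D * A ^ 2 * (A * D ^ 2 * y)
        ≈⟨ +-congʳ (*-congˡ ACD≈1) ⟩
      A ^ 3 * D ^ 3 * (1# + 4# * y) * 1# - 2# * D * A ^ 2 * (A * D ^ 2 * y)
        ≈⟨ solve 3 (λ A D y →
             A :^ 3 :* D :^ 3 :* (con (+ 1) :+ con (+ 4) :* y) :* con (+ 1) :- con (+ 2) :* D :* A :^ 2 :* (A :* D :^ 2 :* y)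
             := D :* D :* A :* (A :^ 2 :* D :* (con (+ 1) :+ con (+ 2) :* y))) refl A D y ⟩
      D * D * A * (A ^ 2 * D * (1# + 2# * y)) ∎)

  -- The seven identities as linear relations in y

  module Identities (q A B D G H z y : Carrier)
    (unit-G : Unit G) (unit-H : Unit H)
    (qG⁴H² : q * (G ^ 4 * H ^ 2) ≈ A * D ^ 2 * y)
    (B² : B ^ 2 ≈ A ^ 4 * D ^ 4 * (1# + 4# * y))
    (A²B²H⁴G² : A ^ 2 * B ^ 2 * (H ^ 4 * G ^ 2) ≈ D * (1# - 2# * y))
    (H⁴G² : H ^ 4 * G ^ 2 ≈ A ^ 2 * D * (1# + 2# * y))
    (B²D²H²G⁴ : B ^ 2 * D ^ 2 * (H ^ 2 * G ^ 4) ≈ A * (1# + y))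
    {f₁ f₂ f₃ f₄ f₆ f₁₂ : Carrier}
    (f₁≈ : f₁ ≈ A * B * (H * z)) (f₂≈ : f₂ ≈ B * z) (f₃≈ : f₃ ≈ H * z)
    (f₄≈ : f₄ ≈ B * z * (D * G)) (f₆≈ : f₆ ≈ z) (f₁₂≈ : f₁₂ ≈ z * G)
    where

    private
      -- One expression serves for two evaluations, at the eta products and at their monomials.
      Shape : Set
      Shape = (_ _ _ _ _ _ _ : Polynomial 7) → Polynomial 7

      at : Shape → Vec Carrier 7 → Carrier
      at p = eval (p (var (# 0)) (var (# 1)) (var (# 2)) (var (# 3)) (var (# 4)) (var (# 5)) (var (# 6)))

      fs monos : Vec Carrier 7
      fs    = f₁ ∷ f₂ ∷ f₃ ∷ f₄ ∷ f₆ ∷ f₁₂ ∷ q ∷ []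
      monos = A * B * (H * z) ∷ B * z ∷ H * z ∷ B * z * (D * G) ∷ z ∷ z * G ∷ q ∷ []

      substitute : ∀ lhs rhs → at lhs monos ≈ at rhs monos → at lhs fs ≈ at rhs fs
      substitute lhs rhs eq = trans (to-monos lhs) (trans eq (sym (to-monos rhs)))
        where
        to-monos : ∀ p → at p fs ≈ at p monos
        to-monos p = eval-cong (p _ _ _ _ _ _ _) (f₁≈ ∷ f₂≈ ∷ f₃≈ ∷ f₄≈ ∷ f₆≈ ∷ f₁₂≈ ∷ refl ∷ [])

    -- Up to a common monomial, (1 - 2y) + (1 + 2y) = 2.
    identity₁ : (f₁ ^ 4 * f₆ ^ 2 + f₂ ^ 2 * f₃ ^ 4) * (f₂ * f₃ ^ 2 * f₁₂ ^ 3) ≈ 2# * (f₁ ^ 2 * f₄ * f₆ ^ 9)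
    identity₁ = substitute lhs rhs monomials
      where
      lhs rhs : Shape
      lhs f₁ f₂ f₃ f₄ f₆ f₁₂ q = (f₁ :^ 4 :* f₆ :^ 2 :+ f₂ :^ 2 :* f₃ :^ 4) :* (f₂ :* f₃ :^ 2 :* f₁₂ :^ 3)
      rhs f₁ f₂ f₃ f₄ f₆ f₁₂ q = con (+ 2) :* (f₁ :^ 2 :* f₄ :* f₆ :^ 9)

      monomials : ((A * B * (H * z)) ^ 4 * z ^ 2 + (B * z) ^ 2 * (H * z) ^ 4) * ((B * z) * (H * z) ^ 2 * (z * G) ^ 3) ≈
        2# * ((A * B * (H * z)) ^ 2 * (B * z * (D * G)) * z ^ 9)
      monomials = begin
        ((A * B * (H * z)) ^ 4 * z ^ 2 + (B * z) ^ 2 * (H * z) ^ 4) * ((B * z) * (H * z) ^ 2 * (z * G) ^ 3)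
          ≈⟨ solve 8 (λ q A B D G H z y →
            ((A :* B :* (H :* z)) :^ 4 :* z :^ 2 :+ (B :* z) :^ 2 :* (H :* z) :^ 4) :* ((B :* z) :* (H :* z) :^ 2 :* (z :* G) :^ 3)
            := B :^ 3 :* H :^ 2 :* G :* z :^ 12 :* (A :^ 2 :* (A :^ 2 :* B :^ 2 :* (H :^ 4 :* G :^ 2)) :+ (H :^ 4 :* G :^ 2))) refl q A B D G H z y ⟩
        B ^ 3 * H ^ 2 * G * z ^ 12 * (A ^ 2 * (A ^ 2 * B ^ 2 * (H ^ 4 * G ^ 2)) + (H ^ 4 * G ^ 2))
          ≈⟨ *-congˡ (+-cong (*-congˡ A²B²H⁴G²) H⁴G²) ⟩
        B ^ 3 * H ^ 2 * G * z ^ 12 * (A ^ 2 * (D * (1# - 2# * y)) + (A ^ 2 * D * (1# + 2# * y)))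
          ≈⟨ solve 8 (λ q A B D G H z y →
            B :^ 3 :* H :^ 2 :* G :* z :^ 12 :* (A :^ 2 :* (D :* (con (+ 1) :- con (+ 2) :* y)) :+ (A :^ 2 :* D :* (con (+ 1) :+ con (+ 2) :* y)))
            := B :^ 3 :* H :^ 2 :* G :* z :^ 12 :* (con (+ 2) :* (A :^ 2 :* D))) refl q A B D G H z y ⟩
        B ^ 3 * H ^ 2 * G * z ^ 12 * (2# * (A ^ 2 * D))
          ≈⟨ solve 8 (λ q A B D G H z y →
            B :^ 3 :* H :^ 2 :* G :* z :^ 12 :* (con (+ 2) :* (A :^ 2 :* D))
            := con (+ 2) :* ((A :* B :* (H :* z)) :^ 2 :* (B :* z :* (D :* G)) :* z :^ 9)) refl q A B D G H z y ⟩
        2# * ((A * B * (H * z)) ^ 2 * (B * z * (D * G)) * z ^ 9) ∎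

    -- Comes from (1 + 2y) - (1 - 2y) = 4y. The unit G² completes the powers of G in `H⁴G²` and
    -- `qG⁴H²` and is cancelled again.
    identity₂ : (f₂ ^ 2 * f₃ ^ 4 - f₁ ^ 4 * f₆ ^ 2) * f₄ ≈ 4# * (q * (f₁ * f₂ ^ 2 * f₃ * f₁₂ ^ 3))
    identity₂ = substitute lhs rhs monomials
      where
      lhs rhs : Shape
      lhs f₁ f₂ f₃ f₄ f₆ f₁₂ q = (f₂ :^ 2 :* f₃ :^ 4 :- f₁ :^ 4 :* f₆ :^ 2) :* f₄
      rhs f₁ f₂ f₃ f₄ f₆ f₁₂ q = con (+ 4) :* (q :* (f₁ :* f₂ :^ 2 :* f₃ :* f₁₂ :^ 3))

      monomials : ((B * z) ^ 2 * (H * z) ^ 4 - (A * B * (H * z)) ^ 4 * z ^ 2) * (B * z * (D * G)) ≈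
        4# * (q * ((A * B * (H * z)) * (B * z) ^ 2 * (H * z) * (z * G) ^ 3))
      monomials = unit-cancel (unit-^ 2 unit-G) (begin
        G ^ 2 * (((B * z) ^ 2 * (H * z) ^ 4 - (A * B * (H * z)) ^ 4 * z ^ 2) * (B * z * (D * G)))
          ≈⟨ solve 8 (λ q A B D G H z y →
            G :^ 2 :* (((B :* z) :^ 2 :* (H :* z) :^ 4 :- (A :* B :* (H :* z)) :^ 4 :* z :^ 2) :* (B :* z :* (D :* G)))
            := B :^ 3 :* G :* z :^ 7 :* (D :* ((H :^ 4 :* G :^ 2) :- A :^ 2 :* (A :^ 2 :* B :^ 2 :* (H :^ 4 :* G :^ 2))))) refl q A B D G H z y ⟩
        B ^ 3 * G * z ^ 7 * (D * ((H ^ 4 * G ^ 2) - A ^ 2 * (A ^ 2 * B ^ 2 * (H ^ 4 * G ^ 2))))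
          ≈⟨ *-congˡ (*-congˡ (+-cong H⁴G² (-‿cong (*-congˡ A²B²H⁴G²)))) ⟩
        B ^ 3 * G * z ^ 7 * (D * ((A ^ 2 * D * (1# + 2# * y)) - A ^ 2 * (D * (1# - 2# * y))))
          ≈⟨ solve 8 (λ q A B D G H z y →
            B :^ 3 :* G :* z :^ 7 :* (D :* ((A :^ 2 :* D :* (con (+ 1) :+ con (+ 2) :* y)) :- A :^ 2 :* (D :* (con (+ 1) :- con (+ 2) :* y))))
            := B :^ 3 :* G :* z :^ 7 :* (con (+ 4) :* (A :* (A :* D :^ 2 :* y)))) refl q A B D G H z y ⟩
        B ^ 3 * G * z ^ 7 * (4# * (A * (A * D ^ 2 * y)))
          ≈⟨ *-congˡ (*-congˡ (*-congˡ qG⁴H²)) ⟨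
        B ^ 3 * G * z ^ 7 * (4# * (A * (q * (G ^ 4 * H ^ 2))))
          ≈⟨ solve 8 (λ q A B D G H z y →
            B :^ 3 :* G :* z :^ 7 :* (con (+ 4) :* (A :* (q :* (G :^ 4 :* H :^ 2))))
            := G :^ 2 :* (con (+ 4) :* (q :* ((A :* B :* (H :* z)) :* (B :* z) :^ 2 :* (H :* z) :* (z :* G) :^ 3)))) refl q A B D G H z y ⟩
        G ^ 2 * (4# * (q * ((A * B * (H * z)) * (B * z) ^ 2 * (H * z) * (z * G) ^ 3))) ∎)

    -- Comes from (1 + 4y) + 2(1 + y) = 3(1 + 2y).
    identity₃ : f₂ ^ 9 * f₃ * f₁₂ ^ 2 + 2# * (f₁ ^ 3 * f₄ ^ 6 * f₆ ^ 3) ≈ 3# * (f₁ ^ 2 * f₂ ^ 2 * f₃ ^ 3 * f₄ ^ 3 * f₆ * f₁₂)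
    identity₃ = substitute lhs rhs monomials
      where
      lhs rhs : Shape
      lhs f₁ f₂ f₃ f₄ f₆ f₁₂ q = f₂ :^ 9 :* f₃ :* f₁₂ :^ 2 :+ con (+ 2) :* (f₁ :^ 3 :* f₄ :^ 6 :* f₆ :^ 3)
      rhs f₁ f₂ f₃ f₄ f₆ f₁₂ q = con (+ 3) :* (f₁ :^ 2 :* f₂ :^ 2 :* f₃ :^ 3 :* f₄ :^ 3 :* f₆ :* f₁₂)

      monomials : (B * z) ^ 9 * (H * z) * (z * G) ^ 2 + 2# * ((A * B * (H * z)) ^ 3 * (B * z * (D * G)) ^ 6 * z ^ 3) ≈
        3# * ((A * B * (H * z)) ^ 2 * (B * z) ^ 2 * (H * z) ^ 3 * (B * z * (D * G)) ^ 3 * z * (z * G))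
      monomials = begin
        (B * z) ^ 9 * (H * z) * (z * G) ^ 2 + 2# * ((A * B * (H * z)) ^ 3 * (B * z * (D * G)) ^ 6 * z ^ 3)
          ≈⟨ solve 8 (λ q A B D G H z y →
            (B :* z) :^ 9 :* (H :* z) :* (z :* G) :^ 2 :+ con (+ 2) :* ((A :* B :* (H :* z)) :^ 3 :* (B :* z :* (D :* G)) :^ 6 :* z :^ 3)
            := B :^ 7 :* H :* G :^ 2 :* z :^ 12 :* ((B :^ 2) :+ con (+ 2) :* (A :^ 3 :* D :^ 4 :* (B :^ 2 :* D :^ 2 :* (H :^ 2 :* G :^ 4))))) refl q A B D G H z y ⟩
        B ^ 7 * H * G ^ 2 * z ^ 12 * ((B ^ 2) + 2# * (A ^ 3 * D ^ 4 * (B ^ 2 * D ^ 2 * (H ^ 2 * G ^ 4))))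
          ≈⟨ *-congˡ (+-cong B² (*-congˡ (*-congˡ B²D²H²G⁴))) ⟩
        B ^ 7 * H * G ^ 2 * z ^ 12 * ((A ^ 4 * D ^ 4 * (1# + 4# * y)) + 2# * (A ^ 3 * D ^ 4 * (A * (1# + y))))
          ≈⟨ solve 8 (λ q A B D G H z y →
            B :^ 7 :* H :* G :^ 2 :* z :^ 12 :* ((A :^ 4 :* D :^ 4 :* (con (+ 1) :+ con (+ 4) :* y)) :+ con (+ 2) :* (A :^ 3 :* D :^ 4 :* (A :* (con (+ 1) :+ y))))
            := B :^ 7 :* H :* G :^ 2 :* z :^ 12 :* (con (+ 3) :* (A :^ 2 :* D :^ 3 :* (A :^ 2 :* D :* (con (+ 1) :+ con (+ 2) :* y))))) refl q A B D G H z y ⟩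
        B ^ 7 * H * G ^ 2 * z ^ 12 * (3# * (A ^ 2 * D ^ 3 * (A ^ 2 * D * (1# + 2# * y))))
          ≈⟨ *-congˡ (*-congˡ (*-congˡ H⁴G²)) ⟨
        B ^ 7 * H * G ^ 2 * z ^ 12 * (3# * (A ^ 2 * D ^ 3 * (H ^ 4 * G ^ 2)))
          ≈⟨ solve 8 (λ q A B D G H z y →
            B :^ 7 :* H :* G :^ 2 :* z :^ 12 :* (con (+ 3) :* (A :^ 2 :* D :^ 3 :* (H :^ 4 :* G :^ 2)))
            := con (+ 3) :* ((A :* B :* (H :* z)) :^ 2 :* (B :* z) :^ 2 :* (H :* z) :^ 3 :* (B :* z :* (D :* G)) :^ 3 :* z :* (z :* G))) refl q A B D G H z y ⟩
        3# * ((A * B * (H * z)) ^ 2 * (B * z) ^ 2 * (H * z) ^ 3 * (B * z * (D * G)) ^ 3 * z * (z * G)) ∎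

    -- Comes from (1 + 4y) - (1 + y) = 3y.
    identity₄ : f₂ ^ 9 * f₃ * f₁₂ ^ 2 - f₁ ^ 3 * f₄ ^ 6 * f₆ ^ 3 ≈ 3# * (q * (f₁ ^ 3 * f₂ ^ 2 * f₄ ^ 2 * f₆ * f₁₂ ^ 4))
    identity₄ = substitute lhs rhs monomials
      where
      lhs rhs : Shape
      lhs f₁ f₂ f₃ f₄ f₆ f₁₂ q = f₂ :^ 9 :* f₃ :* f₁₂ :^ 2 :- f₁ :^ 3 :* f₄ :^ 6 :* f₆ :^ 3
      rhs f₁ f₂ f₃ f₄ f₆ f₁₂ q = con (+ 3) :* (q :* (f₁ :^ 3 :* f₂ :^ 2 :* f₄ :^ 2 :* f₆ :* f₁₂ :^ 4))

      monomials : (B * z) ^ 9 * (H * z) * (z * G) ^ 2 - (A * B * (H * z)) ^ 3 * (B * z * (D * G)) ^ 6 * z ^ 3 ≈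
        3# * (q * ((A * B * (H * z)) ^ 3 * (B * z) ^ 2 * (B * z * (D * G)) ^ 2 * z * (z * G) ^ 4))
      monomials = begin
        (B * z) ^ 9 * (H * z) * (z * G) ^ 2 - (A * B * (H * z)) ^ 3 * (B * z * (D * G)) ^ 6 * z ^ 3
          ≈⟨ solve 8 (λ q A B D G H z y →
            (B :* z) :^ 9 :* (H :* z) :* (z :* G) :^ 2 :- (A :* B :* (H :* z)) :^ 3 :* (B :* z :* (D :* G)) :^ 6 :* z :^ 3
            := B :^ 7 :* H :* G :^ 2 :* z :^ 12 :* ((B :^ 2) :- A :^ 3 :* D :^ 4 :* (B :^ 2 :* D :^ 2 :* (H :^ 2 :* G :^ 4)))) refl q A B D G H z y ⟩
        B ^ 7 * H * G ^ 2 * z ^ 12 * ((B ^ 2) - A ^ 3 * D ^ 4 * (B ^ 2 * D ^ 2 * (H ^ 2 * G ^ 4)))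
          ≈⟨ *-congˡ (+-cong B² (-‿cong (*-congˡ B²D²H²G⁴))) ⟩
        B ^ 7 * H * G ^ 2 * z ^ 12 * ((A ^ 4 * D ^ 4 * (1# + 4# * y)) - A ^ 3 * D ^ 4 * (A * (1# + y)))
          ≈⟨ solve 8 (λ q A B D G H z y →
            B :^ 7 :* H :* G :^ 2 :* z :^ 12 :* ((A :^ 4 :* D :^ 4 :* (con (+ 1) :+ con (+ 4) :* y)) :- A :^ 3 :* D :^ 4 :* (A :* (con (+ 1) :+ y)))
            := B :^ 7 :* H :* G :^ 2 :* z :^ 12 :* (con (+ 3) :* (A :^ 3 :* D :^ 2 :* (A :* D :^ 2 :* y)))) refl q A B D G H z y ⟩
        B ^ 7 * H * G ^ 2 * z ^ 12 * (3# * (A ^ 3 * D ^ 2 * (A * D ^ 2 * y)))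
          ≈⟨ *-congˡ (*-congˡ (*-congˡ qG⁴H²)) ⟨
        B ^ 7 * H * G ^ 2 * z ^ 12 * (3# * (A ^ 3 * D ^ 2 * (q * (G ^ 4 * H ^ 2))))
          ≈⟨ solve 8 (λ q A B D G H z y →
            B :^ 7 :* H :* G :^ 2 :* z :^ 12 :* (con (+ 3) :* (A :^ 3 :* D :^ 2 :* (q :* (G :^ 4 :* H :^ 2))))
            := con (+ 3) :* (q :* ((A :* B :* (H :* z)) :^ 3 :* (B :* z) :^ 2 :* (B :* z :* (D :* G)) :^ 2 :* z :* (z :* G) :^ 4))) refl q A B D G H z y ⟩
        3# * (q * ((A * B * (H * z)) ^ 3 * (B * z) ^ 2 * (B * z * (D * G)) ^ 2 * z * (z * G) ^ 4)) ∎

    -- Comes from (1 + 2y) - (1 + y) = y. The unit H²G² supplies the powers of H and G that the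
    -- known relations contain.
    identity₅ : (f₂ ^ 2 * f₃ ^ 3 * f₁₂ - f₁ * f₄ ^ 3 * f₆ ^ 2) * f₄ ≈ q * (f₁ * f₂ ^ 2 * f₁₂ ^ 4)
    identity₅ = substitute lhs rhs monomials
      where
      lhs rhs : Shape
      lhs f₁ f₂ f₃ f₄ f₆ f₁₂ q = (f₂ :^ 2 :* f₃ :^ 3 :* f₁₂ :- f₁ :* f₄ :^ 3 :* f₆ :^ 2) :* f₄
      rhs f₁ f₂ f₃ f₄ f₆ f₁₂ q = q :* (f₁ :* f₂ :^ 2 :* f₁₂ :^ 4)

      monomials : ((B * z) ^ 2 * (H * z) ^ 3 * (z * G) - (A * B * (H * z)) * (B * z * (D * G)) ^ 3 * z ^ 2) * (B * z * (D * G)) ≈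
        q * ((A * B * (H * z)) * (B * z) ^ 2 * (z * G) ^ 4)
      monomials = unit-cancel (unit-* (unit-^ 2 unit-H) (unit-^ 2 unit-G)) (begin
        H ^ 2 * G ^ 2 * (((B * z) ^ 2 * (H * z) ^ 3 * (z * G) - (A * B * (H * z)) * (B * z * (D * G)) ^ 3 * z ^ 2) * (B * z * (D * G)))
          ≈⟨ solve 8 (λ q A B D G H z y →
            H :^ 2 :* G :^ 2 :* (((B :* z) :^ 2 :* (H :* z) :^ 3 :* (z :* G) :- (A :* B :* (H :* z)) :* (B :* z :* (D :* G)) :^ 3 :* z :^ 2) :* (B :* z :* (D :* G)))
            := B :^ 3 :* H :* G :^ 2 :* z :^ 7 :* (D :* (H :^ 4 :* G :^ 2) :- A :* D :^ 2 :* (B :^ 2 :* D :^ 2 :* (H :^ 2 :* G :^ 4)))) refl q A B D G H z y ⟩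
        B ^ 3 * H * G ^ 2 * z ^ 7 * (D * (H ^ 4 * G ^ 2) - A * D ^ 2 * (B ^ 2 * D ^ 2 * (H ^ 2 * G ^ 4)))
          ≈⟨ *-congˡ (+-cong (*-congˡ H⁴G²) (-‿cong (*-congˡ B²D²H²G⁴))) ⟩
        B ^ 3 * H * G ^ 2 * z ^ 7 * (D * (A ^ 2 * D * (1# + 2# * y)) - A * D ^ 2 * (A * (1# + y)))
          ≈⟨ solve 8 (λ q A B D G H z y →
            B :^ 3 :* H :* G :^ 2 :* z :^ 7 :* (D :* (A :^ 2 :* D :* (con (+ 1) :+ con (+ 2) :* y)) :- A :* D :^ 2 :* (A :* (con (+ 1) :+ y)))
            := B :^ 3 :* H :* G :^ 2 :* z :^ 7 :* (A :* (A :* D :^ 2 :* y))) refl q A B D G H z y ⟩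
        B ^ 3 * H * G ^ 2 * z ^ 7 * (A * (A * D ^ 2 * y))
          ≈⟨ *-congˡ (*-congˡ qG⁴H²) ⟨
        B ^ 3 * H * G ^ 2 * z ^ 7 * (A * (q * (G ^ 4 * H ^ 2)))
          ≈⟨ solve 8 (λ q A B D G H z y →
            B :^ 3 :* H :* G :^ 2 :* z :^ 7 :* (A :* (q :* (G :^ 4 :* H :^ 2)))
            := H :^ 2 :* G :^ 2 :* (q :* ((A :* B :* (H :* z)) :* (B :* z) :^ 2 :* (z :* G) :^ 4))) refl q A B D G H z y ⟩
        H ^ 2 * G ^ 2 * (q * ((A * B * (H * z)) * (B * z) ^ 2 * (z * G) ^ 4)) ∎)

    -- Comes from 2(1 + 2y) - (1 + 4y) = 1.
    identity₆ : (2# * (f₁ ^ 2 * f₃ ^ 2 * f₄ ^ 3 * f₆) - f₂ ^ 7 * f₁₂) * (f₂ ^ 3 * f₃ ^ 4 * f₁₂ ^ 3) ≈ f₁ ^ 4 * f₄ ^ 4 * f₆ ^ 10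
    identity₆ = substitute lhs rhs monomials
      where
      lhs rhs : Shape
      lhs f₁ f₂ f₃ f₄ f₆ f₁₂ q = (con (+ 2) :* (f₁ :^ 2 :* f₃ :^ 2 :* f₄ :^ 3 :* f₆) :- f₂ :^ 7 :* f₁₂) :* (f₂ :^ 3 :* f₃ :^ 4 :* f₁₂ :^ 3)
      rhs f₁ f₂ f₃ f₄ f₆ f₁₂ q = f₁ :^ 4 :* f₄ :^ 4 :* f₆ :^ 10

      monomials : (2# * ((A * B * (H * z)) ^ 2 * (H * z) ^ 2 * (B * z * (D * G)) ^ 3 * z) - (B * z) ^ 7 * (z * G)) * ((B * z) ^ 3 * (H * z) ^ 4 * (z * G) ^ 3) ≈
        (A * B * (H * z)) ^ 4 * (B * z * (D * G)) ^ 4 * z ^ 10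
      monomials = begin
        (2# * ((A * B * (H * z)) ^ 2 * (H * z) ^ 2 * (B * z * (D * G)) ^ 3 * z) - (B * z) ^ 7 * (z * G)) * ((B * z) ^ 3 * (H * z) ^ 4 * (z * G) ^ 3)
          ≈⟨ solve 8 (λ q A B D G H z y →
            (con (+ 2) :* ((A :* B :* (H :* z)) :^ 2 :* (H :* z) :^ 2 :* (B :* z :* (D :* G)) :^ 3 :* z) :- (B :* z) :^ 7 :* (z :* G)) :* ((B :* z) :^ 3 :* (H :* z) :^ 4 :* (z :* G) :^ 3)
            := B :^ 8 :* H :^ 4 :* G :^ 4 :* z :^ 18 :* (con (+ 2) :* (A :^ 2 :* D :^ 3 :* (H :^ 4 :* G :^ 2)) :- (B :^ 2))) refl q A B D G H z y ⟩
        B ^ 8 * H ^ 4 * G ^ 4 * z ^ 18 * (2# * (A ^ 2 * D ^ 3 * (H ^ 4 * G ^ 2)) - (B ^ 2))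
          ≈⟨ *-congˡ (+-cong (*-congˡ (*-congˡ H⁴G²)) (-‿cong B²)) ⟩
        B ^ 8 * H ^ 4 * G ^ 4 * z ^ 18 * (2# * (A ^ 2 * D ^ 3 * (A ^ 2 * D * (1# + 2# * y))) - (A ^ 4 * D ^ 4 * (1# + 4# * y)))
          ≈⟨ solve 8 (λ q A B D G H z y →
            B :^ 8 :* H :^ 4 :* G :^ 4 :* z :^ 18 :* (con (+ 2) :* (A :^ 2 :* D :^ 3 :* (A :^ 2 :* D :* (con (+ 1) :+ con (+ 2) :* y))) :- (A :^ 4 :* D :^ 4 :* (con (+ 1) :+ con (+ 4) :* y)))
            := B :^ 8 :* H :^ 4 :* G :^ 4 :* z :^ 18 :* (A :^ 4 :* D :^ 4)) refl q A B D G H z y ⟩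
        B ^ 8 * H ^ 4 * G ^ 4 * z ^ 18 * (A ^ 4 * D ^ 4)
          ≈⟨ solve 8 (λ q A B D G H z y →
            B :^ 8 :* H :^ 4 :* G :^ 4 :* z :^ 18 :* (A :^ 4 :* D :^ 4)
            := (A :* B :* (H :* z)) :^ 4 :* (B :* z :* (D :* G)) :^ 4 :* z :^ 10) refl q A B D G H z y ⟩
        (A * B * (H * z)) ^ 4 * (B * z * (D * G)) ^ 4 * z ^ 10 ∎

    -- Comes from 4(1 + y) - (1 - 2y) = 3(1 + 2y), again after multiplication by H²G².
    identity₇ : (4# * (f₃ * f₄ ^ 3) - f₁ ^ 3 * f₁₂) * (f₁ * f₆ ^ 2) ≈ 3# * (f₂ ^ 2 * f₃ ^ 4 * f₁₂)
    identity₇ = substitute lhs rhs monomials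
      where
      lhs rhs : Shape
      lhs f₁ f₂ f₃ f₄ f₆ f₁₂ q = (con (+ 4) :* (f₃ :* f₄ :^ 3) :- f₁ :^ 3 :* f₁₂) :* (f₁ :* f₆ :^ 2)
      rhs f₁ f₂ f₃ f₄ f₆ f₁₂ q = con (+ 3) :* (f₂ :^ 2 :* f₃ :^ 4 :* f₁₂)

      monomials : (4# * ((H * z) * (B * z * (D * G)) ^ 3) - (A * B * (H * z)) ^ 3 * (z * G)) * ((A * B * (H * z)) * z ^ 2) ≈
        3# * ((B * z) ^ 2 * (H * z) ^ 4 * (z * G))
      monomials = unit-cancel (unit-* (unit-^ 2 unit-H) (unit-^ 2 unit-G)) (begin
        H ^ 2 * G ^ 2 * ((4# * ((H * z) * (B * z * (D * G)) ^ 3) - (A * B * (H * z)) ^ 3 * (z * G)) * ((A * B * (H * z)) * z ^ 2))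
          ≈⟨ solve 8 (λ q A B D G H z y →
            H :^ 2 :* G :^ 2 :* ((con (+ 4) :* ((H :* z) :* (B :* z :* (D :* G)) :^ 3) :- (A :* B :* (H :* z)) :^ 3 :* (z :* G)) :* ((A :* B :* (H :* z)) :* z :^ 2))
            := B :^ 2 :* H :^ 2 :* G :* z :^ 7 :* (con (+ 4) :* (A :* D :* (B :^ 2 :* D :^ 2 :* (H :^ 2 :* G :^ 4))) :- A :^ 2 :* (A :^ 2 :* B :^ 2 :* (H :^ 4 :* G :^ 2)))) refl q A B D G H z y ⟩
        B ^ 2 * H ^ 2 * G * z ^ 7 * (4# * (A * D * (B ^ 2 * D ^ 2 * (H ^ 2 * G ^ 4))) - A ^ 2 * (A ^ 2 * B ^ 2 * (H ^ 4 * G ^ 2)))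
          ≈⟨ *-congˡ (+-cong (*-congˡ (*-congˡ B²D²H²G⁴)) (-‿cong (*-congˡ A²B²H⁴G²))) ⟩
        B ^ 2 * H ^ 2 * G * z ^ 7 * (4# * (A * D * (A * (1# + y))) - A ^ 2 * (D * (1# - 2# * y)))
          ≈⟨ solve 8 (λ q A B D G H z y →
            B :^ 2 :* H :^ 2 :* G :* z :^ 7 :* (con (+ 4) :* (A :* D :* (A :* (con (+ 1) :+ y))) :- A :^ 2 :* (D :* (con (+ 1) :- con (+ 2) :* y)))
            := B :^ 2 :* H :^ 2 :* G :* z :^ 7 :* (con (+ 3) :* (A :^ 2 :* D :* (con (+ 1) :+ con (+ 2) :* y)))) refl q A B D G H z y ⟩
        B ^ 2 * H ^ 2 * G * z ^ 7 * (3# * (A ^ 2 * D * (1# + 2# * y)))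
          ≈⟨ *-congˡ (*-congˡ H⁴G²) ⟨
        B ^ 2 * H ^ 2 * G * z ^ 7 * (3# * (H ^ 4 * G ^ 2))
          ≈⟨ solve 8 (λ q A B D G H z y →
            B :^ 2 :* H :^ 2 :* G :* z :^ 7 :* (con (+ 3) :* (H :^ 4 :* G :^ 2))
            := H :^ 2 :* G :^ 2 :* (con (+ 3) :* ((B :* z) :^ 2 :* (H :* z) :^ 4 :* (z :* G)))) refl q A B D G H z y ⟩
        H ^ 2 * G ^ 2 * (3# * ((B * z) ^ 2 * (H * z) ^ 4 * (z * G))) ∎)

-- Eta products as products over residue classes modulo 6

module EtaProducts {c ℓ} (R : CommutativeRing c ℓ) (q : CommutativeRing.Carrier R) (K : ℕ)
  (q^K≈0 : CommutativeRing._≈_ R (Exp._^_ (CommutativeRing.semiring R) q K) (CommutativeRing.0# R)) where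

  open TripleProduct R
  open Theta R q K q^K≈0
  open IntegerSolver R
  open EtaAlgebra R

  open CommutativeRing R hiding (zero)
  open import Relation.Binary.Reasoning.Setoid setoid
  open Exp semiring using (_^_; ^-homo-*; ^-assocʳ)

  prod-* : ∀ N g h → prod N (λ j → g j * h j) ≈ prod N g * prod N h
  prod-* zero    g h = sym (*-identityˡ 1#)
  prod-* (suc N) g h = trans (*-congˡ (prod-* N g h))
    (solve 4 (λ a b x y → a :* b :* (x :* y) := a :* x :* (b :* y)) refl _ _ _ _)

  prod-1 : ∀ N → prod N (λ _ → 1#) ≈ 1#
  prod-1 zero    = refl
  prod-1 (suc N) = trans (*-identityˡ _) (prod-1 N)

  prod-swap : ∀ N M (g : ℕ → ℕ → Carrier) →
    prod N (λ j → prod M λ r → g r j) ≈ prod M (λ r → prod N (g r))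
  prod-swap N zero    g = prod-1 N
  prod-swap N (suc M) g = trans (prod-* N (g M) _) (*-congˡ (prod-swap N M g))

  prod-+ : ∀ m M g → prod (m ℕ.+ M) g ≈ prod m (λ r → g (r ℕ.+ M)) * prod M g
  prod-+ zero    M g = sym (*-identityˡ _)
  prod-+ (suc m) M g = trans (*-congˡ (prod-+ m M g)) (sym (*-assoc _ _ _))

  prod-blocks : ∀ N m g → prod (N ℕ.* m) g ≈ prod N (λ j → prod m λ r → g (r ℕ.+ j ℕ.* m))
  prod-blocks zero    m g = refl
  prod-blocks (suc N) m g = trans (prod-+ m (N ℕ.* m) g) (*-congˡ (prod-blocks N m g))

  prod-shift : ∀ N g → prod (suc N) g ≈ prod N (λ j → g (suc j)) * g 0
  prod-shift zero    g = *-comm _ _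
  prod-shift (suc N) g = trans (*-congˡ (prod-shift N g)) (sym (*-assoc _ _ _))

  prod-unit : ∀ N {g} → (∀ j → Unit (g j)) → Unit (prod N g)
  prod-unit zero    unit-g = 1# , *-identityˡ 1#
  prod-unit (suc N) unit-g = unit-* (unit-g N) (prod-unit N unit-g)

  φ⁻ φ⁺ : ℕ → Carrier
  φ⁻ e = 1# - q ^ e
  φ⁺ e = 1# + q ^ e

  Trivial : (ℕ → Carrier) → Set ℓ
  Trivial φ = ∀ {e} → K ≤ e → φ e ≈ 1#

  φ⁻-trivial : Trivial φ⁻
  φ⁻-trivial K≤e = trans
    (+-congˡ (trans (-‿cong (^-vanish q^K≈0 K≤e)) (RingProperties.-0#≈0# ring))) (+-identityʳ 1#)

  φ⁺-trivial : Trivial φ⁺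
  φ⁺-trivial K≤e = trans (+-congˡ (^-vanish q^K≈0 K≤e)) (+-identityʳ 1#)

  multiples residue : (ℕ → Carrier) → ℕ → Carrier
  multiples φ n = prod K λ j → φ (n ℕ.* suc j)
  residue   φ a = prod K λ j → φ (a ℕ.+ 6 ℕ.* j)

  -- Since nm = 6, the multiples of n fall into m classes modulo 6. To give each class K factors the
  -- product is lengthened to Km factors; the new exponents are at least K, so these factors are 1.
  multiples-residues : ∀ {φ} → Trivial φ → ∀ n m .{{_ : NonZero n}} .{{_ : NonZero m}} → n ℕ.* m ≡ 6 →
    multiples φ n ≈ prod m λ r → residue φ (n ℕ.* suc r)
  multiples-residues {φ} trivial n m nm≡6 = begin
    prod K (λ j → φ (n ℕ.* suc j))
      ≈⟨ prod-stable (ℕₚ.m≤m*n K m) (λ j K≤j → trivial (ℕₚ.≤-trans (ℕₚ.m≤n⇒m≤1+n K≤j) (ℕₚ.m≤n*m (suc j) n))) ⟨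
    prod (K ℕ.* m) (λ j → φ (n ℕ.* suc j))
      ≈⟨ prod-blocks K m _ ⟩
    prod K (λ j → prod m λ r → φ (n ℕ.* suc (r ℕ.+ j ℕ.* m)))
      ≈⟨ prod-swap K m (λ r j → φ (n ℕ.* suc (r ℕ.+ j ℕ.* m))) ⟩
    prod m (λ r → prod K λ j → φ (n ℕ.* suc (r ℕ.+ j ℕ.* m)))
      ≈⟨ prod-cong m (λ r → prod-cong K λ j → reflexive (≡.cong φ (index r j))) ⟩
    prod m (λ r → residue φ (n ℕ.* suc r)) ∎
    where
    expand : ∀ n m r j → n ℕ.* (1 ℕ.+ (r ℕ.+ j ℕ.* m)) ≡ n ℕ.* (1 ℕ.+ r) ℕ.+ n ℕ.* m ℕ.* j
    expand = ℕ-solve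

    index : ∀ r j → n ℕ.* suc (r ℕ.+ j ℕ.* m) ≡ n ℕ.* suc r ℕ.+ 6 ℕ.* j
    index r j = ≡.trans (expand n m r j) (≡.cong (λ k → n ℕ.* suc r ℕ.+ k ℕ.* j) nm≡6)

  multiples-double : ∀ n → multiples φ⁻ (n ℕ.+ n) ≈ multiples φ⁻ n * multiples φ⁺ n
  multiples-double n = trans (prod-cong K factor) (prod-* K _ _)
    where
    factor : ∀ j → φ⁻ ((n ℕ.+ n) ℕ.* suc j) ≈ φ⁻ (n ℕ.* suc j) * φ⁺ (n ℕ.* suc j)
    factor j = begin
      1# - q ^ ((n ℕ.+ n) ℕ.* suc j)
        ≡⟨ ≡.cong φ⁻ (ℕₚ.*-distribʳ-+ (suc j) n n) ⟩
      1# - q ^ (n ℕ.* suc j ℕ.+ n ℕ.* suc j)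
        ≈⟨ +-congˡ (-‿cong (^-homo-* q (n ℕ.* suc j) (n ℕ.* suc j))) ⟩
      1# - x * x
        ≈⟨ solve 1 (λ x → con (+ 1) :- x :* x := (con (+ 1) :- x) :* (con (+ 1) :+ x)) refl x ⟩
      (1# - x) * (1# + x) ∎
      where x = q ^ (n ℕ.* suc j)

  residue-unit : ∀ a .{{_ : NonZero a}} → Unit (residue φ⁻ a)
  residue-unit a = prod-unit K λ j → factor-unit (a ℕ.+ 6 ℕ.* j) (ℕₚ.≤-trans (ℕ.>-nonZero⁻¹ a) (ℕₚ.m≤m+n a _))
    where
    factor-unit : ∀ e → 1 ≤ e → Unit (φ⁻ e)
    factor-unit e 1≤e = geometric (q ^ e) K , minus-unique (geometric-fixed {n = K}
      (trans (^-assocʳ q e K) (^-vanish q^K≈0 (ℕₚ.m≤n*m K e {{ℕ.>-nonZero 1≤e}}))))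

  -- The factor 1 + q⁰ = 2 is the origin of the coefficients 2 and 4 in the relations below. A
  -- trivial factor is appended beforehand, so that K factors remain once it is split off.
  residue-0 : residue φ⁺ 0 ≈ 2# * residue φ⁺ 6
  residue-0 = begin
    prod K (λ j → φ⁺ (6 ℕ.* j))
      ≈⟨ *-identityˡ _ ⟨
    1# * prod K (λ j → φ⁺ (6 ℕ.* j))
      ≈⟨ *-congʳ (φ⁺-trivial (ℕₚ.m≤n*m K 6)) ⟨
    prod (suc K) (λ j → φ⁺ (6 ℕ.* j))
      ≈⟨ prod-shift K _ ⟩
    prod K (λ j → φ⁺ (6 ℕ.* suc j)) * 2#
      ≈⟨ *-comm _ _ ⟩
    2# * prod K (λ j → φ⁺ (6 ℕ.* suc j))
      ≈⟨ *-congˡ (prod-cong K λ j → reflexive (≡.cong φ⁺ (ℕₚ.*-suc 6 j))) ⟩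
    2# * residue φ⁺ 6 ∎

  theta-residues : ∀ s φ → s * s ≈ 1# → (∀ e → 1# + s * q ^ e ≈ φ e) → ∀ c c′ → c ℕ.+ c′ ≡ 6 →
    theta s c c′ ≈ multiples φ⁻ 6 * (residue φ c * residue φ c′)
  theta-residues s φ s²≈1 φ-eq c c′ c+c′≡6 = trans
    (≡.subst (λ p → theta s c c′ ≈
        prod K (λ j → 1# - q ^ (p ℕ.* suc j))
      * (prod K (λ j → 1# + s * q ^ (c ℕ.+ p ℕ.* j)) * prod K (λ j → 1# + s * q ^ (c′ ℕ.+ p ℕ.* j))))
      c+c′≡6 (theta-jacobi s c c′ s²≈1 (≡.subst (1 ≤_) (≡.sym c+c′≡6) (s≤s z≤n))))
    (*-congˡ (*-cong (prod-cong K λ j → φ-eq _) (prod-cong K λ j → φ-eq _)))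

  -1# : Carrier
  -1# = - 1#

  private
    1²≈1 : 1# * 1# ≈ 1#
    1²≈1 = *-identityˡ 1#

    -1²≈1 : -1# * -1# ≈ 1#
    -1²≈1 = solve 0 ((:- con (+ 1)) :* (:- con (+ 1)) := con (+ 1)) refl

  theta⁺ : ∀ c c′ → c ℕ.+ c′ ≡ 6 → theta 1# c c′ ≈ multiples φ⁻ 6 * (residue φ⁺ c * residue φ⁺ c′)
  theta⁺ = theta-residues 1# φ⁺ 1²≈1 λ e → +-congˡ (*-identityˡ _)

  theta⁻ : ∀ c c′ → c ℕ.+ c′ ≡ 6 → theta -1# c c′ ≈ multiples φ⁻ 6 * (residue φ⁻ c * residue φ⁻ c′)
  theta⁻ = theta-residues -1# φ⁻ -1²≈1 λ e →
    solve 1 (λ x → con (+ 1) :+ (:- con (+ 1)) :* x := con (+ 1) :- x) refl (q ^ e)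

  -- As eta quotients: A = f₁f₆/(f₂f₃), B = f₂/f₆, D = f₄f₆/(f₂f₁₂), G = f₁₂/f₆, H = f₃/f₆, z = f₆.
  A B C D G H T z b₀ b₁ b₂ b₃ : Carrier
  A = residue φ⁻ 1 * residue φ⁻ 5
  B = residue φ⁻ 2 * residue φ⁻ 4
  C = residue φ⁺ 1 * residue φ⁺ 5
  D = residue φ⁺ 2 * residue φ⁺ 4
  G = residue φ⁺ 6
  H = residue φ⁻ 3
  T = residue φ⁺ 3
  z = multiples φ⁻ 6
  b₀ = theta 1# 6 6
  b₁ = theta 1# 4 8
  b₂ = theta 1# 2 10
  b₃ = theta 1# 0 12

  private
    pos : ∀ {n} → 1 ≤ suc n
    pos = s≤s z≤n

  -- The square of Σ sⁿ q^(3n² - jn) is the case (u, v, w) = (0, j, 3 - j) of the product formula,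
  -- up to the reflection n ↦ -n.
  theta₁² : ∀ s → s * s ≈ 1# → theta s 2 4 * theta s 2 4 ≈ b₀ * b₁ + s * q ^ 2 * (b₃ * b₂)
  theta₁² s s²≈1 = begin
    theta s 2 4 * theta s 2 4    ≈⟨ *-congʳ (theta-sym s 2 4 pos) ⟩
    theta s 4 2 * theta s 2 4    ≈⟨ theta-product 0 1 2 pos s s²≈1 ⟩
    _                            ≈⟨ +-cong (*-congˡ (theta-sym 1# 8 4 pos)) (*-congˡ (*-congʳ (theta-sym 1# 12 0 pos))) ⟩
    b₀ * b₁ + s * q ^ 2 * (b₃ * b₂) ∎

  theta₂² : ∀ s → s * s ≈ 1# → theta s 1 5 * theta s 1 5 ≈ b₀ * b₂ + s * q ^ 1 * (b₃ * b₁)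
  theta₂² s s²≈1 = begin
    theta s 1 5 * theta s 1 5    ≈⟨ *-congʳ (theta-sym s 1 5 pos) ⟩
    theta s 5 1 * theta s 1 5    ≈⟨ theta-product 0 2 1 pos s s²≈1 ⟩
    _                            ≈⟨ +-cong (*-congˡ (theta-sym 1# 10 2 pos)) (*-congˡ (*-congʳ (theta-sym 1# 12 0 pos))) ⟩
    b₀ * b₂ + s * q ^ 1 * (b₃ * b₁) ∎

  theta₀² : ∀ s → s * s ≈ 1# → theta s 3 3 * theta s 3 3 ≈ b₀ * b₀ + s * q ^ 3 * (b₃ * b₃)
  theta₀² s s²≈1 = trans (theta-product 0 0 3 pos s s²≈1) (+-congˡ (*-congˡ (*-congʳ (theta-sym 1# 12 0 pos))))

  theta₃² : ∀ s → s * s ≈ 1# → theta s 0 6 * theta s 0 6 ≈ b₀ * b₃ + s * q ^ 0 * (b₃ * b₀)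
  theta₃² s s²≈1 = begin
    theta s 0 6 * theta s 0 6    ≈⟨ *-congʳ (theta-sym s 0 6 pos) ⟩
    theta s 6 0 * theta s 0 6    ≈⟨ theta-product 0 3 0 pos s s²≈1 ⟩
    _                            ≈⟨ +-cong (*-congˡ (theta-sym 1# 12 0 pos)) (*-congˡ (*-congʳ (theta-sym 1# 12 0 pos))) ⟩
    b₀ * b₃ + s * q ^ 0 * (b₃ * b₀) ∎

  theta₂₀ : ∀ s → s * s ≈ 1# → theta s 1 5 * theta s 3 3 ≈ b₁ * b₁ + s * q ^ 1 * (b₂ * b₂)
  theta₂₀ s s²≈1 = begin
    theta s 1 5 * theta s 3 3    ≈⟨ *-comm _ _ ⟩
    theta s 3 3 * theta s 1 5    ≈⟨ theta-product 1 1 1 pos s s²≈1 ⟩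
    _                            ≈⟨ +-cong (*-congˡ (theta-sym 1# 8 4 pos)) (*-congˡ (*-congʳ (theta-sym 1# 10 2 pos))) ⟩
    b₁ * b₁ + s * q ^ 1 * (b₂ * b₂) ∎

  theta₃₁ : ∀ s → s * s ≈ 1# → theta s 0 6 * theta s 2 4 ≈ b₁ * b₂ + s * q ^ 0 * (b₂ * b₁)
  theta₃₁ s s²≈1 = begin
    theta s 0 6 * theta s 2 4    ≈⟨ *-comm _ _ ⟩
    theta s 2 4 * theta s 0 6    ≈⟨ *-congʳ (theta-sym s 2 4 pos) ⟩
    theta s 4 2 * theta s 0 6    ≈⟨ theta-product 1 2 0 pos s s²≈1 ⟩
    _                            ≈⟨ +-cong (*-congˡ (theta-sym 1# 10 2 pos)) (*-congˡ (*-congʳ (theta-sym 1# 10 2 pos))) ⟩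
    b₁ * b₂ + s * q ^ 0 * (b₂ * b₁) ∎

  z≈ : z ≈ residue φ⁻ 6
  z≈ = trans (multiples-residues φ⁻-trivial 6 1 ≡.refl) (*-identityʳ _)

  unit-z : Unit z
  unit-z with z⁻¹ , inverse ← residue-unit 6 = z⁻¹ , trans (*-congʳ z≈) inverse

  f₁≈ : multiples φ⁻ 1 ≈ A * B * (H * z)
  f₁≈ = begin
    multiples φ⁻ 1 ≈⟨ multiples-residues φ⁻-trivial 1 6 ≡.refl ⟩
    _ ≈⟨ solve 6 (λ a b c d e f → f :* (e :* (d :* (c :* (b :* (a :* con (+ 1)))))) := a :* e :* (b :* d) :* (c :* f)) refl
           (residue φ⁻ 1) (residue φ⁻ 2) (residue φ⁻ 3) (residue φ⁻ 4) (residue φ⁻ 5) (residue φ⁻ 6) ⟩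
    A * B * (H * residue φ⁻ 6) ≈⟨ *-congˡ (*-congˡ z≈) ⟨
    A * B * (H * z) ∎

  f₂≈ : multiples φ⁻ 2 ≈ B * z
  f₂≈ = begin
    multiples φ⁻ 2 ≈⟨ multiples-residues φ⁻-trivial 2 3 ≡.refl ⟩
    _ ≈⟨ solve 3 (λ a b c → c :* (b :* (a :* con (+ 1))) := a :* b :* c) refl
           (residue φ⁻ 2) (residue φ⁻ 4) (residue φ⁻ 6) ⟩
    B * residue φ⁻ 6 ≈⟨ *-congˡ z≈ ⟨
    B * z ∎

  f₃≈ : multiples φ⁻ 3 ≈ H * z
  f₃≈ = begin
    multiples φ⁻ 3 ≈⟨ multiples-residues φ⁻-trivial 3 2 ≡.refl ⟩
    _ ≈⟨ solve 2 (λ a b → b :* (a :* con (+ 1)) := a :* b) refl (residue φ⁻ 3) (residue φ⁻ 6) ⟩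
    H * residue φ⁻ 6 ≈⟨ *-congˡ z≈ ⟨
    H * z ∎

  f₄≈ : multiples φ⁻ 4 ≈ B * z * (D * G)
  f₄≈ = trans (multiples-double 2) (*-cong f₂≈ (trans (multiples-residues φ⁺-trivial 2 3 ≡.refl)
    (solve 3 (λ a b c → c :* (b :* (a :* con (+ 1))) := a :* b :* c) refl
      (residue φ⁺ 2) (residue φ⁺ 4) (residue φ⁺ 6))))

  f₁₂≈ : multiples φ⁻ 12 ≈ z * G
  f₁₂≈ = trans (multiples-double 6) (*-congˡ (trans (multiples-residues φ⁺-trivial 6 1 ≡.refl) (*-identityʳ _)))

  -- Euler's f₃ ∏ (1 + q³ⁿ) = f₆, where f₃ = Hz and the product is TG.
  HTG≈1 : H * T * G ≈ 1#
  HTG≈1 = unit-cancel unit-z (begin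
    z * (H * T * G)        ≈⟨ solve 4 (λ z H T G → z :* (H :* T :* G) := H :* z :* (G :* (T :* con (+ 1)))) refl z H T G ⟩
    H * z * (G * (T * 1#)) ≈⟨ *-cong f₃≈ (multiples-residues φ⁺-trivial 3 2 ≡.refl) ⟨
    multiples φ⁻ 3 * multiples φ⁺ 3  ≈⟨ multiples-double 3 ⟨
    z                      ≈⟨ *-identityʳ z ⟨
    z * 1#                 ∎)

  -- Euler's f₁ ∏ (1 + qⁿ) = f₂. The classes divisible by 3 contribute `H * T * G` and `z`, so only
  -- `A * C * D` is left after cancelling f₂ = Bz.
  ACD≈1 : A * C * D ≈ 1#
  ACD≈1 = unit-cancel (unit-* (unit-* (residue-unit 2) (residue-unit 4)) unit-z) (begin
    B * z * (A * C * D)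
      ≈⟨ *-identityʳ _ ⟨
    B * z * (A * C * D) * 1#
      ≈⟨ *-congˡ HTG≈1 ⟨
    B * z * (A * C * D) * (H * T * G)
      ≈⟨ solve 10 (λ z A B H T G d₁ d₂ d₄ d₅ → B :* z :* (A :* (d₁ :* d₅) :* (d₂ :* d₄)) :* (H :* T :* G)
           := A :* B :* (H :* z) :* (G :* (d₅ :* (d₄ :* (T :* (d₂ :* (d₁ :* con (+ 1)))))))) refl
           z A B H T G (residue φ⁺ 1) (residue φ⁺ 2) (residue φ⁺ 4) (residue φ⁺ 5) ⟩
    _ ≈⟨ *-cong f₁≈ (multiples-residues φ⁺-trivial 1 6 ≡.refl) ⟨
    multiples φ⁻ 1 * multiples φ⁺ 1
      ≈⟨ multiples-double 1 ⟨
    multiples φ⁻ 2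
      ≈⟨ f₂≈ ⟩
    B * z
      ≈⟨ *-identityʳ _ ⟨
    B * z * 1# ∎)

  private
    -- Each theta function carries a factor z, so every Plücker relation is homogeneous of degree 4
    -- in z, and z⁴ cancels.
    scaled-product : ∀ {θ θ′ x y E E′} → θ ≈ z * x → θ′ ≈ z * y → θ * θ′ ≈ E → E ≈ E′ → z ^ 2 * (x * y) ≈ E′
    scaled-product {θ} {θ′} {x} {y} {E} {E′} θ≈ θ′≈ θθ′≈ E≈ = begin
      z ^ 2 * (x * y)     ≈⟨ solve 3 (λ z x y → z :^ 2 :* (x :* y) := z :* x :* (z :* y)) refl z x y ⟩
      z * x * (z * y)     ≈⟨ *-cong θ≈ θ′≈ ⟨
      θ * θ′              ≈⟨ θθ′≈ ⟩
      E                   ≈⟨ E≈ ⟩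
      E′                  ∎

    theta₃⁺ : theta 1# 0 6 ≈ z * (2# * G * G)
    theta₃⁺ = trans (theta⁺ 0 6 ≡.refl) (*-congˡ (*-congʳ residue-0))

    minus₂ : ∀ x y → x + -1# * q ^ 2 * y ≈ x - q * q * y
    minus₂ x y = solve 3 (λ q x y → x :+ (:- con (+ 1)) :* q :^ 2 :* y := x :- q :* q :* y) refl q x y

    minus₁ : ∀ x y → x + -1# * q ^ 1 * y ≈ x - q * y
    minus₁ x y = solve 3 (λ q x y → x :+ (:- con (+ 1)) :* q :^ 1 :* y := x :- q :* y) refl q x y

    plus₀ : ∀ x y → x + 1# * q ^ 0 * y ≈ x + y
    plus₀ x y = solve 3 (λ q x y → x :+ con (+ 1) :* q :^ 0 :* y := x :+ y) refl q x y

    plus₁ : ∀ x y → x + 1# * q ^ 1 * y ≈ x + q * y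
    plus₁ x y = solve 3 (λ q x y → x :+ con (+ 1) :* q :^ 1 :* y := x :+ q :* y) refl q x y

    plus₂ : ∀ x y → x + 1# * q ^ 2 * y ≈ x + q * q * y
    plus₂ x y = solve 3 (λ q x y → x :+ con (+ 1) :* q :^ 2 :* y := x :+ q :* q :* y) refl q x y

    plus₃ : ∀ x y → x + 1# * q ^ 3 * y ≈ x + q * q * q * y
    plus₃ x y = solve 3 (λ q x y → x :+ con (+ 1) :* q :^ 3 :* y := x :+ q :* q :* q :* y) refl q x y

    open Plücker q b₀ b₁ b₂ b₃
      (scaled-product (theta⁻ 2 4 ≡.refl) (theta⁻ 2 4 ≡.refl) (theta₁² -1# -1²≈1) (minus₂ _ _))
      (scaled-product (theta⁻ 1 5 ≡.refl) (theta⁻ 1 5 ≡.refl) (theta₂² -1# -1²≈1) (minus₁ _ _))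
      (scaled-product (theta⁻ 1 5 ≡.refl) (theta⁻ 3 3 ≡.refl) (theta₂₀ -1# -1²≈1) (minus₁ _ _))
      (scaled-product (theta⁺ 3 3 ≡.refl) (theta⁺ 3 3 ≡.refl) (theta₀² 1# 1²≈1) (plus₃ _ _))
      (scaled-product (theta⁺ 2 4 ≡.refl) (theta⁺ 2 4 ≡.refl) (theta₁² 1# 1²≈1) (plus₂ _ _))
      (scaled-product (theta⁺ 1 5 ≡.refl) (theta⁺ 1 5 ≡.refl) (theta₂² 1# 1²≈1) (plus₁ _ _))
      (scaled-product theta₃⁺ theta₃⁺ (theta₃² 1# 1²≈1) (plus₀ _ _))
      (scaled-product (theta⁺ 1 5 ≡.refl) (theta⁺ 3 3 ≡.refl) (theta₂₀ 1# 1²≈1) (plus₁ _ _))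
      (scaled-product theta₃⁺ (theta⁺ 2 4 ≡.refl) (theta₃₁ 1# 1²≈1) (plus₀ _ _))

    unit-z⁴ : Unit (z ^ 4)
    unit-z⁴ = unit-^ 4 unit-z

    p₁ : B ^ 2 * C ^ 2 ≈ A ^ 2 * D ^ 2 + q * (4# * G ^ 4) * (A * H ^ 2)
    p₁ = unit-cancel unit-z⁴ (trans
      (solve 3 (λ z B C → z :^ 4 :* (B :^ 2 :* C :^ 2) := z :^ 2 :* (B :* B) :* (z :^ 2 :* (C :* C))) refl z B C)
      (trans plücker₁
      (solve 6 (λ z q A D G H →
           z :^ 2 :* (A :* A) :* (z :^ 2 :* (D :* D))
           :+ q :* (z :^ 2 :* (con (+ 2) :* G :* G :* (con (+ 2) :* G :* G))) :* (z :^ 2 :* (A :* (H :* H)))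
        := z :^ 4 :* (A :^ 2 :* D :^ 2 :+ q :* (con (+ 4) :* G :^ 4) :* (A :* H :^ 2))) refl z q A D G H)))

    p₂ : D ^ 2 * (C * T ^ 2) ≈ B ^ 2 * (A * H ^ 2) + q * (2# * G ^ 2 * D) * C ^ 2
    p₂ = unit-cancel unit-z⁴ (trans
      (solve 4 (λ z C D T → z :^ 4 :* (D :^ 2 :* (C :* T :^ 2)) := z :^ 2 :* (D :* D) :* (z :^ 2 :* (C :* (T :* T)))) refl z C D T)
      (trans plücker₂
      (solve 8 (λ z q A B C D G H →
           z :^ 2 :* (B :* B) :* (z :^ 2 :* (A :* (H :* H)))
           :+ q :* (z :^ 2 :* (con (+ 2) :* G :* G :* D)) :* (z :^ 2 :* (C :* C))
        := z :^ 4 :* (B :^ 2 :* (A :* H :^ 2) :+ q :* (con (+ 2) :* G :^ 2 :* D) :* C :^ 2)) refl z q A B C D G H)))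

    p₃ : B ^ 2 * (C * T ^ 2) ≈ D ^ 2 * (A * H ^ 2) + q * (2# * G ^ 2 * D) * A ^ 2
    p₃ = unit-cancel unit-z⁴ (trans
      (solve 4 (λ z B C T → z :^ 4 :* (B :^ 2 :* (C :* T :^ 2)) := z :^ 2 :* (B :* B) :* (z :^ 2 :* (C :* (T :* T)))) refl z B C T)
      (trans plücker₃
      (solve 6 (λ z q A D G H →
           z :^ 2 :* (D :* D) :* (z :^ 2 :* (A :* (H :* H)))
           :+ q :* (z :^ 2 :* (con (+ 2) :* G :* G :* D)) :* (z :^ 2 :* (A :* A))
        := z :^ 4 :* (D :^ 2 :* (A :* H :^ 2) :+ q :* (con (+ 2) :* G :^ 2 :* D) :* A :^ 2)) refl z q A D G H)))

    p₄ : B ^ 2 * D ^ 2 ≈ q * (A ^ 2 * C ^ 2) + T ^ 4 * (A * H ^ 2)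
    p₄ = unit-cancel unit-z⁴ (trans
      (solve 3 (λ z B D → z :^ 4 :* (B :^ 2 :* D :^ 2) := z :^ 2 :* (B :* B) :* (z :^ 2 :* (D :* D))) refl z B D)
      (trans plücker₄
      (solve 6 (λ z q A C H T →
           q :* (z :^ 2 :* (A :* A) :* (z :^ 2 :* (C :* C)))
           :+ z :^ 2 :* (T :* T :* (T :* T)) :* (z :^ 2 :* (A :* (H :* H)))
        := z :^ 4 :* (q :* (A :^ 2 :* C :^ 2) :+ T :^ 4 :* (A :* H :^ 2))) refl z q A C H T)))

    unit-A : Unit A
    unit-A = unit-* (residue-unit 1) (residue-unit 5)

    unit-H : Unit H
    unit-H = residue-unit 3

    unit-D : Unit D
    unit-D = A * C , trans (*-comm D (A * C)) ACD≈1

    unit-G : Unit G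
    unit-G = H * T , trans (*-comm G (H * T)) HTG≈1

    open Parametrisation q A B C D G H T unit-A unit-D ACD≈1 HTG≈1 p₁ p₂ p₃ p₄

  module EtaIdentities {f₁ f₂ f₃ f₄ f₆ f₁₂ : Carrier}
    (h₁ : f₁ ≈ multiples φ⁻ 1) (h₂ : f₂ ≈ multiples φ⁻ 2) (h₃ : f₃ ≈ multiples φ⁻ 3)
    (h₄ : f₄ ≈ multiples φ⁻ 4) (h₆ : f₆ ≈ multiples φ⁻ 6) (h₁₂ : f₁₂ ≈ multiples φ⁻ 12) where

    open Identities q A B D G H z y unit-G unit-H qG⁴H² B² A²B²H⁴G² H⁴G² B²D²H²G⁴
      (trans h₁ f₁≈) (trans h₂ f₂≈) (trans h₃ f₃≈) (trans h₄ f₄≈) h₆ (trans h₁₂ f₁₂≈) public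

-- Transfer of the identities to the notation for series

-- The operations are variables so that comparing the resulting statements with
-- those for series never unfolds a product of series into coefficients; for the
-- same reason each power is a variable with an equation.
module SeriesIdentities
  {C : Set} (_≈_ : C → C → Set) (_+_ _*_ _-_ : C → C → C) (-_ : C → C) (0# 1# : C)
  (isCommutativeRing : IsCommutativeRing _≈_ _+_ _*_ -_ 0# 1#)
  (power : C → ℕ → C) (_·_ : ℤ → C → C) (inv : C → C)
  (Divisor : C → Set) (_/_ : (x y : C) {_ : Divisor y} → C)
  where

  R : CommutativeRing _ _
  R = record { isCommutativeRing = isCommutativeRing }

  open CommutativeRing R using (semiring; sym; trans; *-assoc; *-congˡ; *-congʳ; *-identityʳ; +-congˡ; +-congʳ)
  open Exp semiring using () renaming (_^_ to _^ᴿ_)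
  open EtaAlgebra R using (2#; 3#; 4#)
  open EtaProducts R using (multiples; φ⁻; module EtaIdentities)

  module Statements (q : C) (K : ℕ) (q^K≈0 : (q ^ᴿ K) ≈ 0#)
    (minus : ∀ x y → x - y ≡ x + (- y))
    (power≡ : ∀ x n → power x n ≡ x ^ᴿ n)
    (double : ∀ x → (2# * x) ≈ ((+ 2) · x))
    (triple : ∀ x → (3# * x) ≈ ((+ 3) · x))
    (quadruple : ∀ x → (4# * x) ≈ ((+ 4) · x))
    (quotient : ∀ x y {d} → _/_ x y {d} ≡ (x * inv y))
    (inverse : ∀ {y} → Divisor y → (y * inv y) ≈ 1#)
    {f₁ f₂ f₃ f₄ f₆ f₁₂ : C}
    (h₁ : f₁ ≈ multiples q K q^K≈0 (φ⁻ q K q^K≈0) 1)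
    (h₂ : f₂ ≈ multiples q K q^K≈0 (φ⁻ q K q^K≈0) 2)
    (h₃ : f₃ ≈ multiples q K q^K≈0 (φ⁻ q K q^K≈0) 3)
    (h₄ : f₄ ≈ multiples q K q^K≈0 (φ⁻ q K q^K≈0) 4)
    (h₆ : f₆ ≈ multiples q K q^K≈0 (φ⁻ q K q^K≈0) 6)
    (h₁₂ : f₁₂ ≈ multiples q K q^K≈0 (φ⁻ q K q^K≈0) 12)
    where

    open EtaIdentities q K q^K≈0 h₁ h₂ h₃ h₄ h₆ h₁₂

    divide-by : ∀ {x y z} → Divisor y → (x * y) ≈ z → x ≈ (z * inv y)
    divide-by {x} d xy≈z = trans (sym (*-identityʳ x)) (trans (*-congˡ (sym (inverse d)))
      (trans (sym (*-assoc _ _ _)) (*-congʳ xy≈z)))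

    statement₁ : ∀ {f₁^4 f₆^2 f₂^2 f₃^4 f₁^2 f₆^9 f₃^2 f₁₂^3} →
      f₁^4 ≡ power f₁ 4 → f₆^2 ≡ power f₆ 2 → f₂^2 ≡ power f₂ 2 → f₃^4 ≡ power f₃ 4 →
      f₁^2 ≡ power f₁ 2 → f₆^9 ≡ power f₆ 9 → f₃^2 ≡ power f₃ 2 → f₁₂^3 ≡ power f₁₂ 3 →
      ∀ {d} → ((f₁^4 * f₆^2) + (f₂^2 * f₃^4)) ≈ ((+ 2) · (_/_ ((f₁^2 * f₄) * f₆^9) ((f₂ * f₃^2) * f₁₂^3) {d}))
    statement₁ ≡.refl ≡.refl ≡.refl ≡.refl ≡.refl ≡.refl ≡.refl ≡.refl {d}
      rewrite quotient (((power f₁ 2) * f₄) * (power f₆ 9)) ((f₂ * (power f₃ 2)) * (power f₁₂ 3)) {d}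
        | power≡ f₁ 4 | power≡ f₆ 2 | power≡ f₂ 2 | power≡ f₃ 4 | power≡ f₁ 2 | power≡ f₆ 9
        | power≡ f₃ 2 | power≡ f₁₂ 3
      = trans (divide-by d identity₁) (trans (*-assoc _ _ _) (double _))

    statement₂ : ∀ {f₂^2 f₃^4 f₁^4 f₆^2 f₁₂^3} →
      f₂^2 ≡ power f₂ 2 → f₃^4 ≡ power f₃ 4 → f₁^4 ≡ power f₁ 4 → f₆^2 ≡ power f₆ 2 →
      f₁₂^3 ≡ power f₁₂ 3 →
      ∀ {d} → ((f₂^2 * f₃^4) - (f₁^4 * f₆^2)) ≈ ((+ 4) · (q * (_/_ (((f₁ * f₂^2) * f₃) * f₁₂^3) f₄ {d})))
    statement₂ ≡.refl ≡.refl ≡.refl ≡.refl ≡.refl {d}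
      rewrite quotient (((f₁ * (power f₂ 2)) * f₃) * (power f₁₂ 3)) f₄ {d}
        | minus ((power f₂ 2) * (power f₃ 4)) ((power f₁ 4) * (power f₆ 2)) | power≡ f₂ 2
        | power≡ f₃ 4 | power≡ f₁ 4 | power≡ f₆ 2 | power≡ f₁₂ 3
      = trans (divide-by d identity₂) (trans (trans (*-assoc _ _ _) (*-congˡ (*-assoc _ _ _))) (quadruple _))

    statement₃ : ∀ {f₂^9 f₁₂^2 f₁^3 f₄^6 f₆^3 f₁^2 f₂^2 f₃^3 f₄^3} →
      f₂^9 ≡ power f₂ 9 → f₁₂^2 ≡ power f₁₂ 2 → f₁^3 ≡ power f₁ 3 → f₄^6 ≡ power f₄ 6 →
      f₆^3 ≡ power f₆ 3 → f₁^2 ≡ power f₁ 2 → f₂^2 ≡ power f₂ 2 → f₃^3 ≡ power f₃ 3 →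
      f₄^3 ≡ power f₄ 3 →
      (((f₂^9 * f₃) * f₁₂^2) + ((+ 2) · ((f₁^3 * f₄^6) * f₆^3))) ≈ ((+ 3) · (((((f₁^2 * f₂^2) * f₃^3) * f₄^3) * f₆) * f₁₂))
    statement₃ ≡.refl ≡.refl ≡.refl ≡.refl ≡.refl ≡.refl ≡.refl ≡.refl ≡.refl
      rewrite power≡ f₂ 9 | power≡ f₁₂ 2 | power≡ f₁ 3 | power≡ f₄ 6 | power≡ f₆ 3 | power≡ f₁ 2
        | power≡ f₂ 2 | power≡ f₃ 3 | power≡ f₄ 3
      = trans (+-congˡ (sym (double _))) (trans identity₃ (triple _))

    statement₄ : ∀ {f₂^9 f₁₂^2 f₁^3 f₄^6 f₆^3 f₂^2 f₄^2 f₁₂^4} →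
      f₂^9 ≡ power f₂ 9 → f₁₂^2 ≡ power f₁₂ 2 → f₁^3 ≡ power f₁ 3 → f₄^6 ≡ power f₄ 6 →
      f₆^3 ≡ power f₆ 3 → f₂^2 ≡ power f₂ 2 → f₄^2 ≡ power f₄ 2 → f₁₂^4 ≡ power f₁₂ 4 →
      (((f₂^9 * f₃) * f₁₂^2) - ((f₁^3 * f₄^6) * f₆^3)) ≈ ((+ 3) · (q * ((((f₁^3 * f₂^2) * f₄^2) * f₆) * f₁₂^4)))
    statement₄ ≡.refl ≡.refl ≡.refl ≡.refl ≡.refl ≡.refl ≡.refl ≡.refl
      rewrite minus (((power f₂ 9) * f₃) * (power f₁₂ 2)) (((power f₁ 3) * (power f₄ 6)) * (power f₆ 3))
        | power≡ f₂ 9 | power≡ f₁₂ 2 | power≡ f₁ 3 | power≡ f₄ 6 | power≡ f₆ 3 | power≡ f₂ 2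
        | power≡ f₄ 2 | power≡ f₁₂ 4
      = trans identity₄ (triple _)

    statement₅ : ∀ {f₂^2 f₃^3 f₄^3 f₆^2 f₁₂^4} →
      f₂^2 ≡ power f₂ 2 → f₃^3 ≡ power f₃ 3 → f₄^3 ≡ power f₄ 3 → f₆^2 ≡ power f₆ 2 →
      f₁₂^4 ≡ power f₁₂ 4 →
      ∀ {d} → (((f₂^2 * f₃^3) * f₁₂) - ((f₁ * f₄^3) * f₆^2)) ≈ (q * (_/_ ((f₁ * f₂^2) * f₁₂^4) f₄ {d}))
    statement₅ ≡.refl ≡.refl ≡.refl ≡.refl ≡.refl {d}
      rewrite quotient ((f₁ * (power f₂ 2)) * (power f₁₂ 4)) f₄ {d}
        | minus (((power f₂ 2) * (power f₃ 3)) * f₁₂) ((f₁ * (power f₄ 3)) * (power f₆ 2))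
        | power≡ f₂ 2 | power≡ f₃ 3 | power≡ f₄ 3 | power≡ f₆ 2 | power≡ f₁₂ 4
      = trans (divide-by d identity₅) (*-assoc _ _ _)

    statement₆ : ∀ {f₁^2 f₃^2 f₄^3 f₂^7 f₁^4 f₄^4 f₆^10 f₂^3 f₃^4 f₁₂^3} →
      f₁^2 ≡ power f₁ 2 → f₃^2 ≡ power f₃ 2 → f₄^3 ≡ power f₄ 3 → f₂^7 ≡ power f₂ 7 →
      f₁^4 ≡ power f₁ 4 → f₄^4 ≡ power f₄ 4 → f₆^10 ≡ power f₆ 10 → f₂^3 ≡ power f₂ 3 →
      f₃^4 ≡ power f₃ 4 → f₁₂^3 ≡ power f₁₂ 3 →
      ∀ {d} → (((+ 2) · (((f₁^2 * f₃^2) * f₄^3) * f₆)) - (f₂^7 * f₁₂)) ≈ (_/_ ((f₁^4 * f₄^4) * f₆^10) ((f₂^3 * f₃^4) * f₁₂^3) {d})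
    statement₆ ≡.refl ≡.refl ≡.refl ≡.refl ≡.refl ≡.refl ≡.refl ≡.refl ≡.refl ≡.refl {d}
      rewrite quotient (((power f₁ 4) * (power f₄ 4)) * (power f₆ 10)) (((power f₂ 3) * (power f₃ 4)) * (power f₁₂ 3)) {d}
        | minus ((+ 2) · ((((power f₁ 2) * (power f₃ 2)) * (power f₄ 3)) * f₆)) ((power f₂ 7) * f₁₂)
        | power≡ f₁ 2 | power≡ f₃ 2 | power≡ f₄ 3 | power≡ f₂ 7 | power≡ f₁ 4 | power≡ f₄ 4
        | power≡ f₆ 10 | power≡ f₂ 3 | power≡ f₃ 4 | power≡ f₁₂ 3
      = trans (+-congʳ (sym (double _))) (divide-by d identity₆)

    statement₇ : ∀ {f₄^3 f₁^3 f₂^2 f₃^4 f₆^2} →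
      f₄^3 ≡ power f₄ 3 → f₁^3 ≡ power f₁ 3 → f₂^2 ≡ power f₂ 2 → f₃^4 ≡ power f₃ 4 →
      f₆^2 ≡ power f₆ 2 →
      ∀ {d} → (((+ 4) · (f₃ * f₄^3)) - (f₁^3 * f₁₂)) ≈ ((+ 3) · (_/_ ((f₂^2 * f₃^4) * f₁₂) (f₁ * f₆^2) {d}))
    statement₇ ≡.refl ≡.refl ≡.refl ≡.refl ≡.refl {d}
      rewrite quotient (((power f₂ 2) * (power f₃ 4)) * f₁₂) (f₁ * (power f₆ 2)) {d}
        | minus ((+ 4) · (f₃ * (power f₄ 3))) ((power f₁ 3) * f₁₂) | power≡ f₄ 3 | power≡ f₁ 3
        | power≡ f₂ 2 | power≡ f₃ 4 | power≡ f₆ 2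
      = trans (+-congʳ (sym (quadruple _))) (trans (divide-by d identity₇) (trans (*-assoc _ _ _) (triple _)))

open import Defs
open import Data.Product.Base using (_×_)

-- Power series modulo a power of q form a commutative ring

module SeriesRing where

  open ≡ using (refl; sym; trans; cong; cong₂)
  open Sum ℤₚ.+-*-semiring using (sum-cong-≗)

  open ≡.≡-Reasoning

  *-cong-≤ : ∀ {F F′ G G′} k → (∀ i → i ≤ k → F i ≡ F′ i) → (∀ i → i ≤ k → G i ≡ G′ i) →
    (F * G) k ≡ (F′ * G′) k
  *-cong-≤ k F≡F′ G≡G′ = sum-cong-≗ λ i →
    cong₂ ℤ._*_ (F≡F′ (toℕ i) (toℕ≤pred[n] i)) (G≡G′ (k ∸ toℕ i) (ℕₚ.m∸n≤m k (toℕ i)))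

  -- The product peels off its first term by computation; commutativity needs the last one as well.
  *-suc-last : ∀ F G k → (F * G) (suc k) ≡ (F * (G ∘ suc)) k ℤ.+ F (suc k) ℤ.* G 0
  *-suc-last F G zero    = swap (F 0) (G 1) (F 1) (G 0)
    where
    swap : ∀ a b c d → a ℤ.* b ℤ.+ (c ℤ.* d ℤ.+ + 0) ≡ a ℤ.* b ℤ.+ + 0 ℤ.+ c ℤ.* d
    swap = ℤ-solve
  *-suc-last F G (suc k) = begin
    F 0 ℤ.* G (suc (suc k)) ℤ.+ ((F ∘ suc) * G) (suc k)
      ≡⟨ cong (ℤ._+_ (F 0 ℤ.* G (suc (suc k)))) (*-suc-last (F ∘ suc) G k) ⟩
    F 0 ℤ.* G (suc (suc k)) ℤ.+ (((F ∘ suc) * (G ∘ suc)) k ℤ.+ F (suc (suc k)) ℤ.* G 0)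
      ≡⟨ ℤₚ.+-assoc (F 0 ℤ.* G (suc (suc k))) (((F ∘ suc) * (G ∘ suc)) k) (F (suc (suc k)) ℤ.* G 0) ⟨
    (F * (G ∘ suc)) (suc k) ℤ.+ F (suc (suc k)) ℤ.* G 0 ∎

  *-comm : ∀ F G → F * G ≗ G * F
  *-comm F G zero    = cong (ℤ._+ 0ℤ) (ℤₚ.*-comm (F 0) (G 0))
  *-comm F G (suc k) = begin
    F 0 ℤ.* G (suc k) ℤ.+ ((F ∘ suc) * G) k   ≡⟨ cong₂ ℤ._+_ (ℤₚ.*-comm (F 0) (G (suc k))) (*-comm (F ∘ suc) G k) ⟩
    G (suc k) ℤ.* F 0 ℤ.+ (G * (F ∘ suc)) k   ≡⟨ ℤₚ.+-comm (G (suc k) ℤ.* F 0) _ ⟩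
    (G * (F ∘ suc)) k ℤ.+ G (suc k) ℤ.* F 0   ≡⟨ *-suc-last G F k ⟨
    (G * F) (suc k)                           ∎

  *-distribʳ-+ : ∀ F G H → (G + H) * F ≗ G * F + H * F
  *-distribʳ-+ F G H zero    = expand (G 0) (H 0) (F 0)
    where
    expand : ∀ g h f → (g ℤ.+ h) ℤ.* f ℤ.+ + 0 ≡ g ℤ.* f ℤ.+ + 0 ℤ.+ (h ℤ.* f ℤ.+ + 0)
    expand = ℤ-solve
  *-distribʳ-+ F G H (suc k) = trans
    (cong (ℤ._+_ ((G 0 ℤ.+ H 0) ℤ.* F (suc k))) (*-distribʳ-+ F (G ∘ suc) (H ∘ suc) k))
    (expand (G 0) (H 0) (F (suc k)) (((G ∘ suc) * F) k) (((H ∘ suc) * F) k))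
    where
    expand : ∀ g h f a b → (g ℤ.+ h) ℤ.* f ℤ.+ (a ℤ.+ b) ≡ g ℤ.* f ℤ.+ a ℤ.+ (h ℤ.* f ℤ.+ b)
    expand = ℤ-solve

  *-distribˡ-+ : ∀ F G H → F * (G + H) ≗ F * G + F * H
  *-distribˡ-+ F G H k = begin
    (F * (G + H)) k          ≡⟨ *-comm F (G + H) k ⟩
    ((G + H) * F) k          ≡⟨ *-distribʳ-+ F G H k ⟩
    (G * F + H * F) k        ≡⟨ cong₂ ℤ._+_ (*-comm G F k) (*-comm H F k) ⟩
    (F * G + F * H) k        ∎

  ·-*-assoc : ∀ c F G → (c · F) * G ≗ c · (F * G)
  ·-*-assoc c F G zero    = assoc c (F 0) (G 0)
    where
    assoc : ∀ c f g → c ℤ.* f ℤ.* g ℤ.+ + 0 ≡ c ℤ.* (f ℤ.* g ℤ.+ + 0)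
    assoc = ℤ-solve
  ·-*-assoc c F G (suc k) = trans
    (cong (ℤ._+_ (c ℤ.* F 0 ℤ.* G (suc k))) (·-*-assoc c (F ∘ suc) G k))
    (collect c (F 0) (G (suc k)) (((F ∘ suc) * G) k))
    where
    collect : ∀ c f g a → c ℤ.* f ℤ.* g ℤ.+ c ℤ.* a ≡ c ℤ.* (f ℤ.* g ℤ.+ a)
    collect = ℤ-solve

  -- Induction on the degree: `(F * G) ∘ suc` is `F 0 · (G ∘ suc) + (F ∘ suc) * G` by computation,
  -- so distributivity reduces the claim to `F ∘ suc`.
  *-assoc : ∀ F G H → (F * G) * H ≗ F * (G * H)
  *-assoc F G H zero    = assoc (F 0) (G 0) (H 0)
    where
    assoc : ∀ f g h → (f ℤ.* g ℤ.+ + 0) ℤ.* h ℤ.+ + 0 ≡ f ℤ.* (g ℤ.* h ℤ.+ + 0) ℤ.+ + 0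
    assoc = ℤ-solve
  *-assoc F G H (suc k) = begin
    (F * G) 0 ℤ.* H (suc k) ℤ.+ ((F 0 · (G ∘ suc) + (F ∘ suc) * G) * H) k
      ≡⟨ cong (ℤ._+_ ((F * G) 0 ℤ.* H (suc k))) (*-distribʳ-+ H (F 0 · (G ∘ suc)) ((F ∘ suc) * G) k) ⟩
    (F * G) 0 ℤ.* H (suc k) ℤ.+ (((F 0 · (G ∘ suc)) * H) k ℤ.+ (((F ∘ suc) * G) * H) k)
      ≡⟨ cong (ℤ._+_ ((F * G) 0 ℤ.* H (suc k)))
           (cong₂ ℤ._+_ (·-*-assoc (F 0) (G ∘ suc) H k) (*-assoc (F ∘ suc) G H k)) ⟩
    (F * G) 0 ℤ.* H (suc k) ℤ.+ (F 0 ℤ.* ((G ∘ suc) * H) k ℤ.+ ((F ∘ suc) * (G * H)) k)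
      ≡⟨ collect (F 0) (G 0) (H (suc k)) (((G ∘ suc) * H) k) (((F ∘ suc) * (G * H)) k) ⟩
    F 0 ℤ.* (G * H) (suc k) ℤ.+ ((F ∘ suc) * (G * H)) k ∎
    where
    collect : ∀ f g h a b → (f ℤ.* g ℤ.+ + 0) ℤ.* h ℤ.+ (f ℤ.* a ℤ.+ b) ≡ f ℤ.* (g ℤ.* h ℤ.+ a) ℤ.+ b
    collect = ℤ-solve

  *-identityˡ : ∀ F → 1# * F ≗ F
  *-identityˡ F k = unit-* 1# F k λ _ _ → refl

  infix 4 _≈[_]_

  -- Congruence modulo q^K. As a record it does not unfold to statements about coefficients, so both
  -- series can be recovered by unification.
  record _≈[_]_ (F : Series) (K : ℕ) (G : Series) : Set where
    constructor mod
    field coefficient : ∀ k → k < K → F k ≡ G k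

  open _≈[_]_ public

  ≗⇒≈ : ∀ {K F G} → F ≗ G → F ≈[ K ] G
  ≗⇒≈ F≗G = mod λ k _ → F≗G k

  isCommutativeRing : ∀ K → IsCommutativeRing (λ F G → F ≈[ K ] G) _+_ _*_ -_ 0# 1#
  isCommutativeRing K = record
    { isRing = record
      { +-isAbelianGroup = record
        { isGroup = record
          { isMonoid = record
            { isSemigroup = record
              { isMagma = record
                { isEquivalence = record
                  { refl = mod λ _ _ → refl
                  ; sym = λ (mod p) → mod λ k k<K → sym (p k k<K)
                  ; trans = λ (mod p) (mod r) → mod λ k k<K → trans (p k k<K) (r k k<K)
                  }
                ; ∙-cong = λ (mod p) (mod r) → mod λ k k<K → cong₂ ℤ._+_ (p k k<K) (r k k<K)
                }
              ; assoc = λ F G H → mod λ k _ → ℤₚ.+-assoc (F k) (G k) (H k)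
              }
            ; identity = (λ F → mod λ k _ → ℤₚ.+-identityˡ (F k)) , (λ F → mod λ k _ → ℤₚ.+-identityʳ (F k))
            }
          ; inverse = (λ F → mod λ k _ → ℤₚ.+-inverseˡ (F k)) , (λ F → mod λ k _ → ℤₚ.+-inverseʳ (F k))
          ; ⁻¹-cong = λ (mod p) → mod λ k k<K → cong ℤ.-_ (p k k<K)
          }
        ; comm = λ F G → mod λ k _ → ℤₚ.+-comm (F k) (G k)
        }
      ; *-cong = λ (mod p) (mod r) → mod λ k k<K → *-cong-≤ k
          (λ i i≤k → p i (ℕₚ.≤-<-trans i≤k k<K)) (λ i i≤k → r i (ℕₚ.≤-<-trans i≤k k<K))
      ; *-assoc = λ F G H → ≗⇒≈ (*-assoc F G H)
      ; *-identity = (λ F → ≗⇒≈ (*-identityˡ F))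
                   , (λ F → ≗⇒≈ λ k → trans (*-comm F 1# k) (*-identityˡ F k))
      ; distrib = (λ F G H → ≗⇒≈ (*-distribˡ-+ F G H)) , (λ F G H → ≗⇒≈ (*-distribʳ-+ F G H))
      }
    ; *-comm = λ F G → ≗⇒≈ (*-comm F G)
    }

open SeriesRing using (_≈[_]_; mod; coefficient; ≗⇒≈; isCommutativeRing)

pow : Series → ℕ → Series
pow F n = F ^ n

pow≡ : ∀ F n → F ^ n ≡ pow F n
pow≡ F n = ≡.refl

-- The identities modulo each power of q, and the passage to series

module Modulo (K : ℕ) where
  module Ops = SeriesIdentities (λ F G → F ≈[ K ] G) _+_ _*_ _-_ -_ 0# 1# (isCommutativeRing K)
    pow _·_ inv (λ G → True (G 0 ℤₚ.≟ + 1)) _/_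

  open Ops using (R)

  open CommutativeRing R using (setoid; semiring)
    renaming (*-identityˡ to ≈-*-identityˡ; distribʳ to ≈-distribʳ; +-cong to ≈-+-cong)
  open Exp semiring using () renaming (_^_ to _^ᴷ_)
  open TripleProduct R using (prod)
  open EtaAlgebra R using (2#; 3#; 4#)
  open import Relation.Binary.Reasoning.Setoid setoid

  ^ᴷ≡^ : ∀ F n → F ^ᴷ n ≡ F ^ n
  ^ᴷ≡^ F zero    = ≡.refl
  ^ᴷ≡^ F (suc n) = ≡.cong (F *_) (^ᴷ≡^ F n)

  q^K≈0 : (q ^ᴷ K) ≈[ K ] 0#
  q^K≈0 = mod λ k k<K → ≡.trans (≡.cong (λ F → F k) (^ᴷ≡^ q K)) (q^-low K k k<K)

  open EtaProducts R q K q^K≈0 using (multiples; φ⁻)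

  -- Below degree K the product of K factors already has the coefficients of the infinite one.
  f≈multiples : ∀ n .{{_ : NonZero n}} → f n ≈[ K ] multiples φ⁻ n
  f≈multiples n = mod λ k k<K → ≡.trans
    (≡.sym (f-limit n k K (ℕₚ.<⇒≤ k<K))) (≡.cong (λ F → F k) (pochhammer K))
    where
    pochhammer : ∀ N → qPochhammer n N ≡ prod N (λ j → φ⁻ (n ℕ.* suc j))
    pochhammer zero    = ≡.refl
    pochhammer (suc N) = ≡.cong₂ (λ F G → (1# - F) * G) (≡.sym (^ᴷ≡^ q (n ℕ.* suc N))) (pochhammer N)

  2#-* : ∀ F → 2# * F ≈[ K ] (+ 2 · F)
  2#-* F = begin
    2# * F            ≈⟨ ≈-distribʳ F 1# 1# ⟩
    1# * F + 1# * F   ≈⟨ ≈-+-cong (≈-*-identityˡ F) (≈-*-identityˡ F) ⟩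
    F + F             ≈⟨ ≗⇒≈ (λ k → double (F k)) ⟩
    + 2 · F           ∎
    where
    double : ∀ x → x ℤ.+ x ≡ + 2 ℤ.* x
    double = ℤ-solve

  3#-* : ∀ F → 3# * F ≈[ K ] (+ 3 · F)
  3#-* F = begin
    3# * F             ≈⟨ ≈-distribʳ F 2# 1# ⟩
    2# * F + 1# * F    ≈⟨ ≈-+-cong (2#-* F) (≈-*-identityˡ F) ⟩
    + 2 · F + F        ≈⟨ ≗⇒≈ (λ k → triple (F k)) ⟩
    + 3 · F            ∎
    where
    triple : ∀ x → + 2 ℤ.* x ℤ.+ x ≡ + 3 ℤ.* x
    triple = ℤ-solve

  4#-* : ∀ F → 4# * F ≈[ K ] (+ 4 · F)
  4#-* F = begin
    4# * F             ≈⟨ ≈-distribʳ F 3# 1# ⟩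
    3# * F + 1# * F    ≈⟨ ≈-+-cong (3#-* F) (≈-*-identityˡ F) ⟩
    + 3 · F + F        ≈⟨ ≗⇒≈ (λ k → quadruple (F k)) ⟩
    + 4 · F            ∎
    where
    quadruple : ∀ x → + 3 ℤ.* x ℤ.+ x ≡ + 4 ℤ.* x
    quadruple = ℤ-solve

  open Ops.Statements q K q^K≈0 (λ _ _ → ≡.refl) (λ F n → ≡.sym (^ᴷ≡^ F n)) 2#-* 3#-* 4#-* (λ _ _ → ≡.refl)
    (λ {G} G₀≡1 → ≗⇒≈ (inv-inverseʳ G (toWitness G₀≡1)))
    (f≈multiples 1) (f≈multiples 2) (f≈multiples 3) (f≈multiples 4) (f≈multiples 6) (f≈multiples 12)
    public using (statement₁; statement₂; statement₃; statement₄; statement₅; statement₆; statement₇)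

-- The coefficient of qᵏ is visible modulo q^(k + 1).
≈⇒≗ : ∀ {F G} → (∀ K → F ≈[ K ] G) → F ≗ G
≈⇒≗ F≈G k = coefficient (F≈G (suc k)) k (ℕₚ.n<1+n k)

identity₁ = λ (K : ℕ) → Modulo.statement₁ K
  (pow≡ (f 1) 4) (pow≡ (f 6) 2) (pow≡ (f 2) 2) (pow≡ (f 3) 4) (pow≡ (f 1) 2) (pow≡ (f 6) 9)
  -- `tt` certifies that the denominator has constant coefficient 1, which is decided by evaluation.
  (pow≡ (f 3) 2) (pow≡ (f 12) 3) {tt}
identity₂ = λ (K : ℕ) → Modulo.statement₂ K
  (pow≡ (f 2) 2) (pow≡ (f 3) 4) (pow≡ (f 1) 4) (pow≡ (f 6) 2) (pow≡ (f 12) 3) {tt}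
identity₃ = λ (K : ℕ) → Modulo.statement₃ K
  (pow≡ (f 2) 9) (pow≡ (f 12) 2) (pow≡ (f 1) 3) (pow≡ (f 4) 6) (pow≡ (f 6) 3) (pow≡ (f 1) 2)
  (pow≡ (f 2) 2) (pow≡ (f 3) 3) (pow≡ (f 4) 3)
identity₄ = λ (K : ℕ) → Modulo.statement₄ K
  (pow≡ (f 2) 9) (pow≡ (f 12) 2) (pow≡ (f 1) 3) (pow≡ (f 4) 6) (pow≡ (f 6) 3) (pow≡ (f 2) 2)
  (pow≡ (f 4) 2) (pow≡ (f 12) 4)
identity₅ = λ (K : ℕ) → Modulo.statement₅ K
  (pow≡ (f 2) 2) (pow≡ (f 3) 3) (pow≡ (f 4) 3) (pow≡ (f 6) 2) (pow≡ (f 12) 4) {tt}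
identity₆ = λ (K : ℕ) → Modulo.statement₆ K
  (pow≡ (f 1) 2) (pow≡ (f 3) 2) (pow≡ (f 4) 3) (pow≡ (f 2) 7) (pow≡ (f 1) 4) (pow≡ (f 4) 4)
  (pow≡ (f 6) 10) (pow≡ (f 2) 3) (pow≡ (f 3) 4) (pow≡ (f 12) 3) {tt}
identity₇ = λ (K : ℕ) → Modulo.statement₇ K
  (pow≡ (f 4) 3) (pow≡ (f 1) 3) (pow≡ (f 2) 2) (pow≡ (f 3) 4) (pow≡ (f 6) 2) {tt}

lemma4p1 :
      (f 1 ^ 4 * f 6 ^ 2 + f 2 ^ 2 * f 3 ^ 4
        ≗ + 2 · ((f 1 ^ 2 * f 4 * f 6 ^ 9) / (f 2 * f 3 ^ 2 * f 12 ^ 3)))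
    × (f 2 ^ 2 * f 3 ^ 4 - f 1 ^ 4 * f 6 ^ 2
        ≗ + 4 · (q * ((f 1 * f 2 ^ 2 * f 3 * f 12 ^ 3) / f 4)))
    × (f 2 ^ 9 * f 3 * f 12 ^ 2 + + 2 · (f 1 ^ 3 * f 4 ^ 6 * f 6 ^ 3)
        ≗ + 3 · (f 1 ^ 2 * f 2 ^ 2 * f 3 ^ 3 * f 4 ^ 3 * f 6 * f 12))
    × (f 2 ^ 9 * f 3 * f 12 ^ 2 - f 1 ^ 3 * f 4 ^ 6 * f 6 ^ 3
        ≗ + 3 · (q * (f 1 ^ 3 * f 2 ^ 2 * f 4 ^ 2 * f 6 * f 12 ^ 4)))
    × (f 2 ^ 2 * f 3 ^ 3 * f 12 - f 1 * f 4 ^ 3 * f 6 ^ 2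
        ≗ q * ((f 1 * f 2 ^ 2 * f 12 ^ 4) / f 4))
    × (+ 2 · (f 1 ^ 2 * f 3 ^ 2 * f 4 ^ 3 * f 6) - f 2 ^ 7 * f 12
        ≗ (f 1 ^ 4 * f 4 ^ 4 * f 6 ^ 10) / (f 2 ^ 3 * f 3 ^ 4 * f 12 ^ 3))
    × (+ 4 · (f 3 * f 4 ^ 3) - f 1 ^ 3 * f 12
        ≗ + 3 · ((f 2 ^ 2 * f 3 ^ 4 * f 12) / (f 1 * f 6 ^ 2)))
lemma4p1 = ≈⇒≗ identity₁ , ≈⇒≗ identity₂ , ≈⇒≗ identity₃ , ≈⇒≗ identity₄ , ≈⇒≗ identity₅ , ≈⇒≗ identity₆ , ≈⇒≗ identity₇
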